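{- Let $\chi$ be a primitive nonprincipal Dirichlet character with conductor $q$, and let $\Phi=\{j\mid 1\le j\le q-1,\ \gcd(j,q)=1\}$. Then for all integers $n\ge 1$, $$L_n(\chi)=\frac{1}{q^n}\sum_{(k_j)_{j\in\Phi}}\ \prod_{j\in\Phi}\frac{\chi(j)^{k_j}}{k_j!}\sum_{k=1}^{k_j}(-1)^kB_{k_j,k}\left(\psi(\tfrac jq),\psi_1(\tfrac jq),\ldots,\psi_{k_j-k}(\tfrac jq)\right),$$ where the outer sum is over all families $(k_j)_{j\in\Phi}$ of nonnegative integers with $\sum_{j\in\Phi}k_j=n$, and where for $k_j=0$ the factor of the product belonging to $j$ is understood to be $1$.
   Context: $L_n(\chi):=\sum_{1\le k_1<\dots<k_n}\frac{\chi(k_1)}{k_1}\cdots\frac{\chi(k_n)}{k_n}$, understood as the limit as $N\to\infty$ of the sums over $1\le k_1<\dots<k_n\le N$. $\psi(y)=\Gamma'(y)/\Gamma(y)$ is the digamma function, $\psi_0=\psi$, and $\psi_j=\psi^{(j)}$ is its $j$th derivative for $j\ge1$. For $1\le k\le n$, the partial exponential Bell polynomial is $$B_{n,k}(x_1,\ldots,x_{n-k+1})=\sum\frac{n!}{j_1!\cdots j_{n-k+1}!}\left(\frac{x_1}{1!}\right)^{j_1}\cdots\left(\frac{x_{n-k+1}}{(n-k+1)!}\right)^{j_{n-k+1}},$$ summed over all nonnegative integers $j_1,\ldots,j_{n-k+1}$ with $j_1+j_2+\dots+j_{n-k+1}=k$ and $j_1+2j_2+\dots+(n-k+1)j_{n-k+1}=n$.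 -}

module Defs where

open import Level using (0ℓ)
open import Algebra.Bundles.Raw using (RawRing)
import Algebra.Definitions.RawSemiring as RawSemiringDefs
open import Data.Nat.Base as ℕ using (ℕ; zero; suc; NonZero; _!)
import Data.Nat.Properties as ℕ
import Data.Nat.Divisibility as ℕ
open import Data.Nat.GCD using (gcd)
open import Data.Integer.Base as ℤ using (ℤ; +_)
import Data.Integer.Divisibility as ℤ
open import Data.Rational.Base as ℚ using (ℚ; 0ℚ; 1ℚ; ½; _≤_; _<_; _/_; positive; nonNegative)
open import Data.Rational.Properties
open import Data.Rational.Solver using (module +-*-Solver)
open import Data.Fin.Base using (toℕ)
open import Data.List.Base as List using (List; []; _∷_; _++_; upTo; filter; cartesianProductWith)
open import Data.Vec.Functional as Vector using (Vector)
open import Data.Product using (Σ; ∃; _×_; _,_; proj₁; proj₂)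
open import Data.Sum.Base using (inj₁; inj₂)
open import Function.Base using (_∘_)
open import Relation.Nullary using (¬_; yes; no)
open import Relation.Nullary.Negation using (contradiction)
open import Relation.Binary.PropositionalEquality

Eventually : (ℕ → Set) → Set
Eventually P = ∃ λ N → ∀ n → N ℕ.≤ n → P n

-- Cauchy sequences of rationals; equality of reals is _≈ʳ_.
record ℝ : Set where
  constructor mkℝ
  field
    seq    : ℕ → ℚ
    cauchy : ∀ ε → 0ℚ < ε →
             ∃ λ N → ∀ m n → N ℕ.≤ m → N ℕ.≤ n → ℚ.∣ seq m ℚ.- seq n ∣ ≤ ε

open ℝ public

infix  4 _≈ʳ_ _≤ʳ_ _≈ᶜ_
infixl 6 _+ʳ_ _-ʳ_ _+ᶜ_
infixl 7 _*ʳ_ _*ᶜ_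
infix  8 -ʳ_ -ᶜ_

_≈ʳ_ : ℝ → ℝ → Set
x ≈ʳ y = ∀ ε → 0ℚ < ε → Eventually λ n → ℚ.∣ seq x n ℚ.- seq y n ∣ ≤ ε

_≤ʳ_ : ℝ → ℝ → Set
x ≤ʳ y = ∀ ε → 0ℚ < ε → Eventually λ n → seq x n ≤ seq y n ℚ.+ ε

Positive : ℝ → Set
Positive x = ∃ λ ε → 0ℚ < ε × Eventually λ n → ε ≤ seq x n

fromℚ : ℚ → ℝ
fromℚ p = mkℝ (λ _ → p) λ ε 0<ε → 0 , λ _ _ _ _ →
  ≤-trans (≤-reflexive (cong ℚ.∣_∣ (+-inverseʳ p))) (<⇒≤ 0<ε)

fromℕ : ℕ → ℝ
fromℕ n = fromℚ (+ n / 1)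

0ʳ 1ʳ : ℝ
0ʳ = fromℚ 0ℚ
1ʳ = fromℚ 1ℚ

private
  half-pos : ∀ {ε} → 0ℚ < ε → 0ℚ < ½ ℚ.* ε
  half-pos {ε} 0<ε = positive⁻¹ (½ ℚ.* ε) {{pos*pos⇒pos ½ ε {{positive 0<ε}}}}

  half+half : ∀ ε → ½ ℚ.* ε ℚ.+ ½ ℚ.* ε ≡ ε
  half+half ε = trans (sym (*-distribʳ-+ ε ½ ½)) (*-identityˡ ε)

  ≤⊔ˡ : ∀ {m n k} → m ℕ.⊔ n ℕ.≤ k → m ℕ.≤ k
  ≤⊔ˡ {m} {n} = ℕ.≤-trans (ℕ.m≤m⊔n m n)

  ≤⊔ʳ : ∀ {m n k} → m ℕ.⊔ n ℕ.≤ k → n ℕ.≤ k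
  ≤⊔ʳ {m} {n} = ℕ.≤-trans (ℕ.m≤n⊔m m n)

_+ʳ_ : ℝ → ℝ → ℝ
seq (x +ʳ y) n = seq x n ℚ.+ seq y n
cauchy (x +ʳ y) ε 0<ε
  with M , hM ← cauchy x (½ ℚ.* ε) (half-pos 0<ε)
  with N , hN ← cauchy y (½ ℚ.* ε) (half-pos 0<ε)
  = M ℕ.⊔ N , λ m n Nm Nn → begin
    ℚ.∣ (seq x m ℚ.+ seq y m) ℚ.- (seq x n ℚ.+ seq y n) ∣
      ≡⟨ cong ℚ.∣_∣ (rearrange (seq x m) (seq y m) (seq x n) (seq y n)) ⟩
    ℚ.∣ (seq x m ℚ.- seq x n) ℚ.+ (seq y m ℚ.- seq y n) ∣
      ≤⟨ ∣p+q∣≤∣p∣+∣q∣ (seq x m ℚ.- seq x n) (seq y m ℚ.- seq y n) ⟩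
    ℚ.∣ seq x m ℚ.- seq x n ∣ ℚ.+ ℚ.∣ seq y m ℚ.- seq y n ∣
      ≤⟨ +-mono-≤ (hM m n (≤⊔ˡ {M} {N} Nm) (≤⊔ˡ {M} {N} Nn))
                  (hN m n (≤⊔ʳ {M} {N} Nm) (≤⊔ʳ {M} {N} Nn)) ⟩
    ½ ℚ.* ε ℚ.+ ½ ℚ.* ε
      ≡⟨ half+half ε ⟩
    ε ∎
  where
  open ≤-Reasoning
  open +-*-Solver
  rearrange : ∀ a b c d → (a ℚ.+ b) ℚ.- (c ℚ.+ d) ≡ (a ℚ.- c) ℚ.+ (b ℚ.- d)
  rearrange = solve 4 (λ a b c d → (a :+ b) :- (c :+ d) := (a :- c) :+ (b :- d)) refl

-ʳ_ : ℝ → ℝ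
seq (-ʳ x) n = ℚ.- seq x n
cauchy (-ʳ x) ε 0<ε with N , hN ← cauchy x ε 0<ε
  = N , λ m n Nm Nn → ≤-trans
      (≤-reflexive (trans
        (cong ℚ.∣_∣ (sym (neg-distrib-+ (seq x m) (ℚ.- seq x n))))
        (∣-p∣≡∣p∣ (seq x m ℚ.- seq x n))))
      (hN m n Nm Nn)

_-ʳ_ : ℝ → ℝ → ℝ
x -ʳ y = x +ʳ (-ʳ y)

∣_∣ʳ : ℝ → ℝ
seq ∣ x ∣ʳ n = ℚ.∣ seq x n ∣
cauchy ∣ x ∣ʳ ε 0<ε with N , hN ← cauchy x ε 0<ε
  = N , λ m n Nm Nn → ≤-trans (reverse (seq x m) (seq x n)) (hN m n Nm Nn)
  where
  open ≤-Reasoning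
  open +-*-Solver
  split : ∀ a b → a ≡ (a ℚ.- b) ℚ.+ b
  split = solve 2 (λ a b → a := (a :- b) :+ b) refl
  cancel : ∀ a b → (a ℚ.+ b) ℚ.- b ≡ a
  cancel = solve 2 (λ a b → (a :+ b) :- b := a) refl
  flip-minus : ∀ a b → ℚ.- (a ℚ.- b) ≡ b ℚ.- a
  flip-minus = solve 2 (λ a b → :- (a :- b) := b :- a) refl

  one-sided : ∀ a b → ℚ.∣ a ∣ ℚ.- ℚ.∣ b ∣ ≤ ℚ.∣ a ℚ.- b ∣
  one-sided a b = begin
    ℚ.∣ a ∣ ℚ.- ℚ.∣ b ∣
      ≡⟨ cong (λ c → ℚ.∣ c ∣ ℚ.- ℚ.∣ b ∣) (split a b) ⟩
    ℚ.∣ (a ℚ.- b) ℚ.+ b ∣ ℚ.- ℚ.∣ b ∣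
      ≤⟨ +-monoˡ-≤ (ℚ.- ℚ.∣ b ∣) (∣p+q∣≤∣p∣+∣q∣ (a ℚ.- b) b) ⟩
    (ℚ.∣ a ℚ.- b ∣ ℚ.+ ℚ.∣ b ∣) ℚ.- ℚ.∣ b ∣
      ≡⟨ cancel ℚ.∣ a ℚ.- b ∣ ℚ.∣ b ∣ ⟩
    ℚ.∣ a ℚ.- b ∣ ∎

  abs-cases : ∀ c d → c ≤ d → ℚ.- c ≤ d → ℚ.∣ c ∣ ≤ d
  abs-cases c d c≤d -c≤d with ∣p∣≡p∨∣p∣≡-p c
  ... | inj₁ eq = ≤-trans (≤-reflexive eq) c≤d
  ... | inj₂ eq = ≤-trans (≤-reflexive eq) -c≤d

  reverse : ∀ a b → ℚ.∣ ℚ.∣ a ∣ ℚ.- ℚ.∣ b ∣ ∣ ≤ ℚ.∣ a ℚ.- b ∣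
  reverse a b = abs-cases _ _ (one-sided a b) (begin
    ℚ.- (ℚ.∣ a ∣ ℚ.- ℚ.∣ b ∣)  ≡⟨ flip-minus ℚ.∣ a ∣ ℚ.∣ b ∣ ⟩
    ℚ.∣ b ∣ ℚ.- ℚ.∣ a ∣        ≤⟨ one-sided b a ⟩
    ℚ.∣ b ℚ.- a ∣              ≡⟨ cong ℚ.∣_∣ (flip-minus a b) ⟨
    ℚ.∣ ℚ.- (a ℚ.- b) ∣        ≡⟨ ∣-p∣≡∣p∣ (a ℚ.- b) ⟩
    ℚ.∣ a ℚ.- b ∣ ∎)

private
  *-mono-≤-0 : ∀ {a b c d} → 0ℚ ≤ c → 0ℚ ≤ b → a ≤ b → c ≤ d → a ℚ.* c ≤ b ℚ.* d
  *-mono-≤-0 {a} {b} {c} {d} 0≤c 0≤b a≤b c≤d = ≤-trans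
    (*-monoʳ-≤-nonNeg c {{nonNegative 0≤c}} a≤b)
    (*-monoˡ-≤-nonNeg b {{nonNegative 0≤b}} c≤d)

  bounded : ∀ x → ∃ λ B → 0ℚ < B × Eventually λ n → ℚ.∣ seq x n ∣ ≤ B
  bounded x with N , hN ← cauchy x 1ℚ (positive⁻¹ 1ℚ)
    = 1ℚ ℚ.+ ℚ.∣ seq x N ∣
    , positive⁻¹ _ {{pos+nonNeg⇒pos 1ℚ ℚ.∣ seq x N ∣ {{∣-∣-nonNeg (seq x N)}}}}
    , N , λ n Nn → begin
      ℚ.∣ seq x n ∣
        ≡⟨ cong ℚ.∣_∣ (split (seq x n) (seq x N)) ⟩
      ℚ.∣ (seq x n ℚ.- seq x N) ℚ.+ seq x N ∣
        ≤⟨ ∣p+q∣≤∣p∣+∣q∣ (seq x n ℚ.- seq x N) (seq x N) ⟩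
      ℚ.∣ seq x n ℚ.- seq x N ∣ ℚ.+ ℚ.∣ seq x N ∣
        ≤⟨ +-monoˡ-≤ ℚ.∣ seq x N ∣ (hN n N Nn ℕ.≤-refl) ⟩
      1ℚ ℚ.+ ℚ.∣ seq x N ∣ ∎
    where
    open ≤-Reasoning
    open +-*-Solver
    split : ∀ a b → a ≡ (a ℚ.- b) ℚ.+ b
    split = solve 2 (λ a b → a := (a :- b) :+ b) refl

  -- δ with B δ = ε
  divide : ∀ {B ε} → 0ℚ < B → 0ℚ < ε → ∃ λ δ → 0ℚ < δ × B ℚ.* δ ≡ ε
  divide {B} {ε} 0<B 0<ε = B⁻¹ ℚ.* ε
    , positive⁻¹ _ {{pos*pos⇒pos B⁻¹ {{1/pos⇒pos B {{B>0}}}} ε {{positive 0<ε}}}}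
    , trans (sym (*-assoc B B⁻¹ ε))
        (trans (cong (ℚ._* ε) (*-inverseʳ B {{B≢0}})) (*-identityˡ ε))
    where
    B>0 : ℚ.Positive B
    B>0 = positive 0<B
    B≢0 : ℚ.NonZero B
    B≢0 = pos⇒nonZero B {{B>0}}
    B⁻¹ : ℚ
    B⁻¹ = (ℚ.1/ B) {{B≢0}}

private
  *-estimate : ∀ {A B δ η ε} a b c d → 0ℚ < A → 0ℚ < B →
    A ℚ.* δ ≡ ½ ℚ.* ε → B ℚ.* η ≡ ½ ℚ.* ε →
    ℚ.∣ a ∣ ≤ A → ℚ.∣ d ∣ ≤ B → ℚ.∣ b ℚ.- d ∣ ≤ δ → ℚ.∣ a ℚ.- c ∣ ≤ η →
    ℚ.∣ a ℚ.* b ℚ.- c ℚ.* d ∣ ≤ ε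
  *-estimate {A} {B} {δ} {η} {ε} a b c d 0<A 0<B Aδ Bη ha hd hbd hac = begin
    ℚ.∣ a ℚ.* b ℚ.- c ℚ.* d ∣
      ≡⟨ cong ℚ.∣_∣ (rearrange a b c d) ⟩
    ℚ.∣ a ℚ.* (b ℚ.- d) ℚ.+ d ℚ.* (a ℚ.- c) ∣
      ≤⟨ ∣p+q∣≤∣p∣+∣q∣ (a ℚ.* (b ℚ.- d)) (d ℚ.* (a ℚ.- c)) ⟩
    ℚ.∣ a ℚ.* (b ℚ.- d) ∣ ℚ.+ ℚ.∣ d ℚ.* (a ℚ.- c) ∣
      ≡⟨ cong₂ ℚ._+_ (∣p*q∣≡∣p∣*∣q∣ a (b ℚ.- d)) (∣p*q∣≡∣p∣*∣q∣ d (a ℚ.- c)) ⟩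
    ℚ.∣ a ∣ ℚ.* ℚ.∣ b ℚ.- d ∣ ℚ.+ ℚ.∣ d ∣ ℚ.* ℚ.∣ a ℚ.- c ∣
      ≤⟨ +-mono-≤
           (*-mono-≤-0 {ℚ.∣ a ∣} {A} {ℚ.∣ b ℚ.- d ∣} {δ} (0≤∣p∣ (b ℚ.- d)) (<⇒≤ 0<A) ha hbd)
           (*-mono-≤-0 {ℚ.∣ d ∣} {B} {ℚ.∣ a ℚ.- c ∣} {η} (0≤∣p∣ (a ℚ.- c)) (<⇒≤ 0<B) hd hac) ⟩
    A ℚ.* δ ℚ.+ B ℚ.* η
      ≡⟨ cong₂ ℚ._+_ Aδ Bη ⟩
    ½ ℚ.* ε ℚ.+ ½ ℚ.* ε
      ≡⟨ half+half ε ⟩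
    ε ∎
    where
    open ≤-Reasoning
    open +-*-Solver
    rearrange : ∀ a b c d →
      a ℚ.* b ℚ.- c ℚ.* d ≡ a ℚ.* (b ℚ.- d) ℚ.+ d ℚ.* (a ℚ.- c)
    rearrange = solve 4 (λ a b c d →
      a :* b :- c :* d := a :* (b :- d) :+ d :* (a :- c)) refl

_*ʳ_ : ℝ → ℝ → ℝ
seq (x *ʳ y) n = seq x n ℚ.* seq y n
cauchy (x *ʳ y) ε 0<ε =
  let A , 0<A , K , hK = bounded x
      B , 0<B , L , hL = bounded y
      δ , 0<δ , Aδ = divide 0<A (half-pos 0<ε)
      η , 0<η , Bη = divide 0<B (half-pos 0<ε)
      M , hM = cauchy y δ 0<δ
      N , hN = cauchy x η 0<η
      KL = λ {k} → ≤⊔ˡ {K ℕ.⊔ L} {M ℕ.⊔ N} {k}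
      MN = λ {k} → ≤⊔ʳ {K ℕ.⊔ L} {M ℕ.⊔ N} {k}
  in (K ℕ.⊔ L) ℕ.⊔ (M ℕ.⊔ N) , λ m n Nm Nn →
    *-estimate (seq x m) (seq y m) (seq x n) (seq y n) 0<A 0<B Aδ Bη
      (hK m (≤⊔ˡ {K} {L} (KL Nm)))
      (hL n (≤⊔ʳ {K} {L} (KL Nn)))
      (hM m n (≤⊔ˡ {M} {N} (MN Nm)) (≤⊔ˡ {M} {N} (MN Nn)))
      (hN m n (≤⊔ʳ {M} {N} (MN Nm)) (≤⊔ʳ {M} {N} (MN Nn)))

-- 1/p, with 1/0 = 0
invℚ : ℚ → ℚ
invℚ p with p ≟ 0ℚ
... | yes _   = 0ℚ
... | no  p≢0 = (ℚ.1/ p) {{ℚ.≢-nonZero p≢0}}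

private
  invℚ-inverse : ∀ {p} → 0ℚ < p → p ℚ.* invℚ p ≡ 1ℚ
  invℚ-inverse {p} 0<p with p ≟ 0ℚ
  ... | yes p≡0 = contradiction (sym p≡0) (<⇒≢ 0<p)
  ... | no  p≢0 = *-inverseʳ p {{ℚ.≢-nonZero p≢0}}

recip : (x : ℝ) → Positive x → ℝ
seq (recip x _) n = invℚ (seq x n)
cauchy (recip x (β , 0<β , K , hK)) ε 0<ε
  with N , hN ← cauchy x (ε ℚ.* (β ℚ.* β)) (positive⁻¹ _ {{pos*pos⇒pos ε {{positive 0<ε}}
                   (β ℚ.* β) {{pos*pos⇒pos β {{positive 0<β}} β {{positive 0<β}}}}}})
  = K ℕ.⊔ N , λ m n Nm Nn →
      estimate (seq x m) (seq x n)
        (hK m (≤⊔ˡ {K} {N} Nm)) (hK n (≤⊔ˡ {K} {N} Nn))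
        (hN m n (≤⊔ʳ {K} {N} Nm) (≤⊔ʳ {K} {N} Nn))
  where
  open ≤-Reasoning
  open +-*-Solver
  0≤ββ : 0ℚ ≤ β ℚ.* β
  0≤ββ = <⇒≤ (positive⁻¹ _ {{pos*pos⇒pos β {{positive 0<β}} β {{positive 0<β}}}})
  rearrange : ∀ a b u v →
    (u ℚ.- v) ℚ.* (a ℚ.* b) ≡ (a ℚ.* u) ℚ.* b ℚ.- (b ℚ.* v) ℚ.* a
  rearrange = solve 4 (λ a b u v →
    (u :- v) :* (a :* b) := (a :* u) :* b :- (b :* v) :* a) refl
  units : ∀ a b → 1ℚ ℚ.* b ℚ.- 1ℚ ℚ.* a ≡ ℚ.- (a ℚ.- b)
  units = solve 2 (λ a b → con 1ℚ :* b :- con 1ℚ :* a := :- (a :- b)) refl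

  estimate : ∀ a b → β ≤ a → β ≤ b → ℚ.∣ a ℚ.- b ∣ ≤ ε ℚ.* (β ℚ.* β) →
             ℚ.∣ invℚ a ℚ.- invℚ b ∣ ≤ ε
  estimate a b β≤a β≤b h = *-cancelʳ-≤-pos (a ℚ.* b) {{positive 0<ab}} (begin
    ℚ.∣ u ℚ.- v ∣ ℚ.* (a ℚ.* b)
      ≡⟨ cong (ℚ.∣ u ℚ.- v ∣ ℚ.*_) (0≤p⇒∣p∣≡p (<⇒≤ 0<ab)) ⟨
    ℚ.∣ u ℚ.- v ∣ ℚ.* ℚ.∣ a ℚ.* b ∣
      ≡⟨ ∣p*q∣≡∣p∣*∣q∣ (u ℚ.- v) (a ℚ.* b) ⟨
    ℚ.∣ (u ℚ.- v) ℚ.* (a ℚ.* b) ∣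
      ≡⟨ cong ℚ.∣_∣ (rearrange a b u v) ⟩
    ℚ.∣ (a ℚ.* u) ℚ.* b ℚ.- (b ℚ.* v) ℚ.* a ∣
      ≡⟨ cong₂ (λ s t → ℚ.∣ s ℚ.* b ℚ.- t ℚ.* a ∣) (invℚ-inverse 0<a) (invℚ-inverse 0<b) ⟩
    ℚ.∣ 1ℚ ℚ.* b ℚ.- 1ℚ ℚ.* a ∣
      ≡⟨ cong ℚ.∣_∣ (units a b) ⟩
    ℚ.∣ ℚ.- (a ℚ.- b) ∣
      ≡⟨ ∣-p∣≡∣p∣ (a ℚ.- b) ⟩
    ℚ.∣ a ℚ.- b ∣
      ≤⟨ h ⟩
    ε ℚ.* (β ℚ.* β)
      ≤⟨ *-monoˡ-≤-nonNeg ε {{nonNegative (<⇒≤ 0<ε)}}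
           (*-mono-≤-0 (<⇒≤ 0<β) (<⇒≤ 0<a) β≤a β≤b) ⟩
    ε ℚ.* (a ℚ.* b) ∎)
    where
    u v : ℚ
    u = invℚ a
    v = invℚ b
    0<a : 0ℚ < a
    0<a = <-≤-trans 0<β β≤a
    0<b : 0ℚ < b
    0<b = <-≤-trans 0<β β≤b
    0<ab : 0ℚ < a ℚ.* b
    0<ab = positive⁻¹ _ {{pos*pos⇒pos a {{positive 0<a}} b {{positive 0<b}}}}

ℝ-rawRing : RawRing 0ℓ 0ℓ
ℝ-rawRing = record
  { Carrier = ℝ ; _≈_ = _≈ʳ_ ; _+_ = _+ʳ_ ; _*_ = _*ʳ_ ; -_ = -ʳ_ ; 0# = 0ʳ ; 1# = 1ʳ }

record ℂ : Set where
  constructor _+i_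
  field
    re : ℝ
    im : ℝ

open ℂ public

_≈ᶜ_ : ℂ → ℂ → Set
z ≈ᶜ w = re z ≈ʳ re w × im z ≈ʳ im w

fromℝ : ℝ → ℂ
fromℝ x = x +i 0ʳ

0ᶜ 1ᶜ : ℂ
0ᶜ = fromℝ 0ʳ
1ᶜ = fromℝ 1ʳ

_+ᶜ_ _*ᶜ_ : ℂ → ℂ → ℂ
(a +i b) +ᶜ (c +i d) = (a +ʳ c) +i (b +ʳ d)
(a +i b) *ᶜ (c +i d) = (a *ʳ c -ʳ b *ʳ d) +i (a *ʳ d +ʳ b *ʳ c)

-ᶜ_ : ℂ → ℂ
-ᶜ (a +i b) = (-ʳ a) +i (-ʳ b)

ℂ-rawRing : RawRing 0ℓ 0ℓ
ℂ-rawRing = record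
  { Carrier = ℂ ; _≈_ = _≈ᶜ_ ; _+_ = _+ᶜ_ ; _*_ = _*ᶜ_ ; -_ = -ᶜ_ ; 0# = 0ᶜ ; 1# = 1ᶜ }

module FiniteOps (R : RawRing 0ℓ 0ℓ) where
  open RawRing R
  open RawSemiringDefs rawSemiring public using (_^_; product)

  ∑ ∏ : {A : Set} → List A → (A → Carrier) → Carrier
  ∑ xs f = List.foldr (λ x s → f x + s) 0# xs
  ∏ xs f = List.foldr (λ x s → f x * s) 1# xs

module Opsʳ = FiniteOps ℝ-rawRing
module Opsᶜ = FiniteOps ℂ-rawRing

infix 4 _⟶ʳ_ _⟶ᶜ_

_⟶ʳ_ : (ℕ → ℝ) → ℝ → Set
s ⟶ʳ l = ∀ ε → 0ℚ < ε → Eventually λ n → ∣ s n -ʳ l ∣ʳ ≤ʳ fromℚ ε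

_⟶ᶜ_ : (ℕ → ℂ) → ℂ → Set
s ⟶ᶜ l = ((re ∘ s) ⟶ʳ re l) × ((im ∘ s) ⟶ʳ im l)

-- Functions on (0,∞).  Respect for _≈ʳ_ is not assumed; it follows from
-- differentiability.
Fun⁺ : Set
Fun⁺ = (y : ℝ) → Positive y → ℝ

HasDerivative : Fun⁺ → Fun⁺ → Set
HasDerivative f f′ =
  ∀ y (y>0 : Positive y) ε → 0ℚ < ε → ∃ λ δ → 0ℚ < δ ×
  (∀ z (z>0 : Positive z) → ∣ z -ʳ y ∣ʳ ≤ʳ fromℚ δ →
   ∣ f z z>0 -ʳ f y y>0 -ʳ f′ y y>0 *ʳ (z -ʳ y) ∣ʳ ≤ʳ fromℚ ε *ʳ ∣ z -ʳ y ∣ʳ)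

1/fact : ℕ → ℚ
1/fact n = (+ 1 / (n !)) {{n ℕ.!≢0}}

-- y = eˣ
IsExp : ℝ → ℝ → Set
IsExp x y = (λ N → ∑ (upTo N) λ k → x ^ k *ʳ fromℚ (1/fact k)) ⟶ʳ y
  where open Opsʳ

-- y = nˣ
IsPower : ℕ → ℝ → ℝ → Set
IsPower n x y = ∃ λ log-n → IsExp log-n (fromℕ n) × IsExp (x *ʳ log-n) y

shift-positive : ∀ x → Positive x → ∀ i → Positive (x +ʳ fromℕ i)
shift-positive x (β , 0<β , N , hN) i = β , 0<β , N , λ n Nn →
  ≤-trans (≤-reflexive (sym (+-identityʳ β)))
          (+-mono-≤ (hN n Nn) (nonNegative⁻¹ (+ i / 1) {{normalize-nonNeg i 1}}))

-- Γ(x) = lim n! nˣ / (x (x + 1) ⋯ (x + n)) for x > 0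
IsGamma : Fun⁺ → Set
IsGamma Γ = ∀ x (x>0 : Positive x) →
  ∃ λ (pow : ℕ → ℝ) →
    (∀ n → 1 ℕ.≤ n → IsPower n x (pow n)) ×
    ((λ n → fromℕ (n !) *ʳ pow n
            *ʳ ∏ (upTo (suc n)) (λ i → recip (x +ʳ fromℕ i) (shift-positive x x>0 i)))
     ⟶ʳ Γ x x>0)
  where open Opsʳ

-- ψ 0 = Γ′ / Γ and ψ j is the j-th derivative of ψ 0
record IsPolygamma (Γ : Fun⁺) (ψ : ℕ → Fun⁺) : Set where
  field
    digamma    : HasDerivative Γ (λ y y>0 → ψ 0 y y>0 *ʳ Γ y y>0)
    derivative : ∀ j → HasDerivative (ψ j) (ψ (suc j))

-- χ a ≉ 0 for gcd (a , q) = 1 follows from the other laws.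
record IsDirichletCharacter (q : ℕ) (χ : ℤ → ℂ) : Set where
  field
    χ-*        : ∀ a b → χ (a ℤ.* b) ≈ᶜ χ a *ᶜ χ b
    χ-1        : χ (+ 1) ≈ᶜ 1ᶜ
    χ-periodic : ∀ a → χ (a ℤ.+ + q) ≈ᶜ χ a
    χ-vanish   : ∀ a → gcd ℤ.∣ a ∣ q ≢ 1 → χ a ≈ᶜ 0ᶜ

Principal : ℕ → (ℤ → ℂ) → Set
Principal q χ = ∀ a → gcd ℤ.∣ a ∣ q ≡ 1 → χ a ≈ᶜ 1ᶜ

InducedModulus : ℕ → (ℤ → ℂ) → ℕ → Set
InducedModulus q χ d =
  d ℕ.∣ q × (∀ a → gcd ℤ.∣ a ∣ q ≡ 1 → + d ℤ.∣ (a ℤ.- + 1) → χ a ≈ᶜ 1ᶜ)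

Primitive : ℕ → (ℤ → ℂ) → Set
Primitive q χ = ∀ d → InducedModulus q χ d → d ≡ q

ℕ⁺ : Set
ℕ⁺ = Σ ℕ NonZero

-- 1, …, N
interval : ℕ → List ℕ⁺
interval N = List.map (λ i → suc i , _) (upTo N)

-- The n-element sublists, in the given order
choose : {A : Set} → ℕ → List A → List (List A)
choose zero    _        = [] ∷ []
choose (suc n) []       = []
choose (suc n) (x ∷ xs) = List.map (x ∷_) (choose n xs) ++ choose (suc n) xs

-- Families of m naturals, each at most b
families≤ : (m b : ℕ) → List (Vector ℕ m)
families≤ zero    b = Vector.[] ∷ []
families≤ (suc m) b = cartesianProductWith Vector._∷_ (upTo (suc b)) (families≤ m b)

sumℕ : ∀ {m} → Vector ℕ m → ℕ
sumℕ = Vector.foldr ℕ._+_ 0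

-- All families of m naturals with sum n; the bound n on the entries is automatic.
familiesWithSum : (m n : ℕ) → List (Vector ℕ m)
familiesWithSum m n = filter (λ k → sumℕ k ℕ.≟ n) (families≤ m n)

Φ : ℕ → List ℕ⁺
Φ q = filter (λ j → gcd (proj₁ j) q ℕ.≟ 1) (interval (q ℕ.∸ 1))

-- All j_1, …, j_{n-k+1} with Σ j_i = k and Σ i j_i = n; position i holds j_{i+1}.
bellExponents : (n k : ℕ) → List (Vector ℕ (suc (n ℕ.∸ k)))
bellExponents n k = filter (λ j → sumℕ (λ i → suc (toℕ i) ℕ.* j i) ℕ.≟ n)
                           (familiesWithSum (suc (n ℕ.∸ k)) k)

-- The partial exponential Bell polynomial for 1 ≤ k ≤ n; x i is the variable x_{i+1}.
Bell : (n k : ℕ) → Vector ℝ (suc (n ℕ.∸ k)) → ℝ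
Bell n k x = ∑ (bellExponents n k) λ j →
    fromℕ (n !)
    *ʳ product (λ i → fromℚ (1/fact (j i)))
    *ʳ product (λ i → (x i *ʳ fromℚ (1/fact (suc (toℕ i)))) ^ j i)
  where open Opsʳ

-- Sum over 1 ≤ k₁ < ⋯ < kₙ ≤ N of χ(k₁)/k₁ ⋯ χ(kₙ)/kₙ
partialL : (ℤ → ℂ) → ℕ → ℕ → ℂ
partialL χ n N = ∑ (choose n (interval N)) λ ks →
    ∏ ks λ (k , k≢0) → χ (+ k) *ᶜ fromℝ (fromℚ ((+ 1 / k) {{k≢0}}))
  where open Opsᶜ

module _ (q : ℕ) .{{q≢0 : NonZero q}} where

  point : ℕ⁺ → ℝ
  point (j , _) = fromℚ (+ j / q)

  point-positive : ∀ j → Positive (point j)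
  point-positive (j , j≢0) = + j / q , positive⁻¹ _ {{normalize-pos j q {{q≢0}} {{j≢0}}}}
                           , 0 , λ _ _ → ≤-refl

  -- The factor at j with k_j = m:
  -- χ(j)^m / m! · Σ_{k=1}^m (-1)^k B_{m,k}(ψ(j/q), ψ₁(j/q), …, ψ_{m-k}(j/q))
  factor : (ℕ → Fun⁺) → (ℤ → ℂ) → ℕ⁺ → ℕ → ℂ
  factor ψ χ j zero      = 1ᶜ
  factor ψ χ j m@(suc _) =
      χ (+ proj₁ j) Opsᶜ.^ m *ᶜ fromℝ (fromℚ (1/fact m)) *ᶜ fromℝ
        (Opsʳ.∑ (interval m) λ (k , _) →
          (-ʳ 1ʳ) Opsʳ.^ k *ʳ Bell m k (λ i → ψ (toℕ i) (point j) (point-positive j)))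

module Submission where

-- For each N the truncated sums for n = 0, 1, 2, … are the coefficients of
-- ∏_{k ≤ N} (1 + t χ(k)/k).  The logarithmic derivative of this product has the
-- coefficients (−1)ⁱ Σ_{k ≤ N} (χ(k)/k)ⁱ⁺¹, and the coefficients of a series with
-- constant term 1 depend polynomially, hence continuously, on those of its
-- logarithmic derivative.  Splitting the power sums by residues modulo q shows that
-- these coefficients converge to −Σ_j (χ(j)/q)ⁱ⁺¹ ψ_i(j/q)/i!; for i = 0 the divergent terms log N
-- cancel because Σ χ(j) = 0.  This limit is the logarithmic derivative of
-- ∏_j exp(−Σ_{i ≥ 0} ψ_i(j/q) (χ(j) t/q)ⁱ⁺¹/(i+1)!), and the Bell polynomials are the
-- coefficients of such exponentials.
--
-- The values ψ_i(j/q) are computed from the definition of ψ_i as derivatives: Euler's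
-- products and the partial sums of Σ (y+i)⁻ᵏ lie above their tangents, and for
-- functions with this property pointwise convergence to a differentiable limit
-- implies convergence of the slopes.

-- The logic is constructive and reals are Cauchy sequences, which shapes several steps.
-- Nonprincipality is a bare negation and supplies no a with χ(a) ≠ 1; Σ χ(j) = 0 is therefore
-- reached by refuting its negation, which is legitimate because being zero is stable under double
-- negation. Differentiation does not commute with pointwise limits in general. A line through (y,
-- Fₙ(y)) below the graph of Fₙ helps because its slope is caught between the difference quotients
-- of Fₙ at y - k and y + k for one fixed k, so two pointwise limits suffice and no uniformity
-- enters. For Γ the slopes are Gₙ sₙ, with Gₙ Euler's product and sₙ its logarithmic derivative.
-- Passing to sₙ means dividing by Gₙ, so Gₙ must be bounded below uniformly in n. The bound ½ comes
-- from the tangent at 1, and this is why the points j/q are kept inside (0, 1). The logarithmic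
-- derivative β of a is expressed by a′ = β a. This makes sense over semirings, so the same modules
-- apply again to the semiring of power series, whose extra variable counts the parts in a Bell
-- polynomial.

open import Defs
open import Level using (0ℓ)
import Algebra.Properties.CommutativeMonoid.Mult
import Algebra.Properties.CommutativeMonoid.Sum
import Algebra.Properties.CommutativeSemiring.Exp
import Algebra.Properties.Ring
import Algebra.Properties.Semiring.Exp
import Algebra.Properties.Semiring.Mult
import Algebra.Properties.Semiring.Sum
import Algebra.Solver.Ring
import Algebra.Solver.Ring.NaturalCoefficients.Default as NatSolver
import Algebra.Structures.Biased as Biased
import Relation.Binary.Reasoning.Setoid as SetoidReasoning
open import Algebra.Bundles using (CommutativeSemiring; CommutativeRing)
open import Algebra.Definitions.RawSemiring as RawSemiringDefs using ()
open import Algebra.Solver.Ring.AlmostCommutativeRing using (fromCommutativeRing; _-Raw-AlmostCommutative⟶_)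
open import Data.Bool.Base using (true; false; if_then_else_)
open import Data.Fin.Base as Fin using (Fin; toℕ)
open import Data.Fin.Permutation using (Permutation; permutation)
import Data.Fin.Properties as Fin
open import Data.Integer.Base as ℤ using (ℤ; +_)
import Data.Integer.Properties as ℤ
open import Data.List.Base as List using (List; []; _∷_; _++_; upTo; applyUpTo; filter; cartesianProductWith; length; lookup)
open import Data.List.Properties using (upTo-∷ʳ)
open import Data.Maybe.Base as Maybe using (Maybe)
open import Data.Nat.Base as ℕ using (ℕ; zero; suc; z≤n; s≤s; _!; NonZero)
import Data.Nat.Coprimality as ℕ
import Data.Nat.Divisibility as ℕ
import Data.Nat.DivMod as ℕ
open import Data.Nat.GCD using (gcd; module Bézout)
import Data.Nat.Properties as ℕ
import Data.Nat.Solver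
open import Data.Product using (∃; _×_; _,_; proj₁; proj₂)
open import Data.Rational.Base as ℚ using (ℚ; 0ℚ; 1ℚ; ½; _/_)
import Data.Rational.Properties as ℚ
open import Data.Rational.Solver using (module +-*-Solver)
open import Data.Rational.Unnormalised.Base as ℚᵘ using (mkℚᵘ; *≡*; *≤*)
import Data.Rational.Unnormalised.Properties as ℚᵘ
open import Data.Sum.Base using (_⊎_; inj₁; inj₂; [_,_]′)
open import Data.Vec.Functional as Vector using (Vector)
open import Function.Base using (_∘_)
open import Relation.Nullary using (¬_; Dec; yes; no; does)
open import Relation.Nullary.Decidable using (dec⇒maybe)
open import Relation.Nullary.Negation using (contradiction)
open import Relation.Unary using (Pred; Decidable)
open import Relation.Binary.PropositionalEquality as ≡ using (_≡_; _≢_)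

-- Formal power series

module Sums (R : CommutativeSemiring 0ℓ 0ℓ) where
  open CommutativeSemiring R hiding (zero)
  open SetoidReasoning setoid
  open NatSolver R

  ∑ : {A : Set} → List A → (A → Carrier) → Carrier
  ∑ xs f = List.foldr (λ x s → f x + s) 0# xs

  module _ {A : Set} where

    ∑-cong : ∀ (xs : List A) {f g} → (∀ x → f x ≈ g x) → ∑ xs f ≈ ∑ xs g
    ∑-cong []       f≈g = refl
    ∑-cong (x ∷ xs) f≈g = +-cong (f≈g x) (∑-cong xs f≈g)

    ∑-++ : ∀ (xs ys : List A) f → ∑ (xs ++ ys) f ≈ ∑ xs f + ∑ ys f
    ∑-++ []       ys f = sym (+-identityˡ _)
    ∑-++ (x ∷ xs) ys f = trans (+-congˡ (∑-++ xs ys f)) (sym (+-assoc _ _ _))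

    ∑-map : ∀ {B : Set} (g : B → A) xs f → ∑ (List.map g xs) f ≈ ∑ xs (f ∘ g)
    ∑-map g []       f = refl
    ∑-map g (x ∷ xs) f = +-congˡ (∑-map g xs f)

    ∑-*ˡ : ∀ c (xs : List A) f → c * ∑ xs f ≈ ∑ xs (λ x → c * f x)
    ∑-*ˡ c []       f = zeroʳ c
    ∑-*ˡ c (x ∷ xs) f = trans (distribˡ _ _ _) (+-congˡ (∑-*ˡ c xs f))

    ∑-+ : ∀ (xs : List A) f g → ∑ xs (λ x → f x + g x) ≈ ∑ xs f + ∑ xs g
    ∑-+ []       f g = sym (+-identityˡ _)
    ∑-+ (x ∷ xs) f g = trans (+-congˡ (∑-+ xs f g))
      (solve 4 (λ a b c d → (a :+ b) :+ (c :+ d) := (a :+ c) :+ (b :+ d)) refl _ _ _ _)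

    ∑-0 : ∀ (xs : List A) {f} → (∀ x → f x ≈ 0#) → ∑ xs f ≈ 0#
    ∑-0 []       f≈0 = refl
    ∑-0 (x ∷ xs) f≈0 = trans (+-cong (f≈0 x) (∑-0 xs f≈0)) (+-identityˡ _)

    ∑-filter : ∀ {p} {P : Pred A p} (P? : Decidable P) xs f →
      ∑ (filter P? xs) f ≈ ∑ xs (λ x → if does (P? x) then f x else 0#)
    ∑-filter P? []       f = refl
    ∑-filter P? (x ∷ xs) f with does (P? x)
    ... | true  = +-congˡ (∑-filter P? xs f)
    ... | false = trans (∑-filter P? xs f) (sym (+-identityˡ _))

  ∑-swap : ∀ {A B : Set} (xs : List A) (ys : List B) (f : A → B → Carrier) →
    ∑ xs (λ x → ∑ ys (f x)) ≈ ∑ ys (λ y → ∑ xs (λ x → f x y))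
  ∑-swap []       ys f = sym (∑-0 ys (λ _ → refl))
  ∑-swap (x ∷ xs) ys f = trans (+-congˡ (∑-swap xs ys f)) (sym (∑-+ ys _ _))

  ∑-cartesian : ∀ {A B C : Set} (h : A → B → C) xs ys f →
    ∑ (cartesianProductWith h xs ys) f ≈ ∑ xs (λ x → ∑ ys (λ y → f (h x y)))
  ∑-cartesian h []       ys f = refl
  ∑-cartesian h (x ∷ xs) ys f = begin
    ∑ (List.map (h x) ys ++ cartesianProductWith h xs ys) f
      ≈⟨ ∑-++ (List.map (h x) ys) _ f ⟩
    ∑ (List.map (h x) ys) f + ∑ (cartesianProductWith h xs ys) f
      ≈⟨ +-cong (∑-map (h x) ys f) (∑-cartesian h xs ys f) ⟩
    ∑ ys (λ y → f (h x y)) + ∑ xs (λ x → ∑ ys (λ y → f (h x y))) ∎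

  ∑< : ℕ → (ℕ → Carrier) → Carrier
  ∑< n f = ∑ (upTo n) f

  private
    -- `upTo (suc n)` reduces to `0 ∷ applyUpTo suc n` and not to a shifted `upTo n`; this
    -- reindexing opens sums over initial segments to induction.
    ∑-applyUpTo : ∀ (g : ℕ → ℕ) n f → ∑ (applyUpTo g n) f ≡ ∑< n (f ∘ g)
    ∑-applyUpTo g zero    f = ≡.refl
    ∑-applyUpTo g (suc n) f = ≡.cong (λ s → f (g 0) + s)
      (≡.trans (∑-applyUpTo (g ∘ suc) n f) (≡.sym (∑-applyUpTo suc n (f ∘ g))))

  ∑<-suc : ∀ n f → ∑< (suc n) f ≡ f 0 + ∑< n (f ∘ suc)
  ∑<-suc n f = ≡.cong (λ s → f 0 + s) (∑-applyUpTo suc n f)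

  ∑<-cong : ∀ n {f g} → (∀ i → i ℕ.< n → f i ≈ g i) → ∑< n f ≈ ∑< n g
  ∑<-cong zero    f≈g = refl
  ∑<-cong (suc n) {f} {g} f≈g = begin
    ∑< (suc n) f           ≡⟨ ∑<-suc n f ⟩
    f 0 + ∑< n (f ∘ suc)   ≈⟨ +-cong (f≈g 0 (s≤s z≤n)) (∑<-cong n λ i i<n → f≈g (suc i) (s≤s i<n)) ⟩
    g 0 + ∑< n (g ∘ suc)   ≡⟨ ∑<-suc n g ⟨
    ∑< (suc n) g           ∎

  ∑<-last : ∀ n f → ∑< (suc n) f ≈ ∑< n f + f n
  ∑<-last zero    f = trans (+-identityʳ _) (sym (+-identityˡ _))
  ∑<-last (suc n) f = begin
    ∑< (suc (suc n)) f                  ≡⟨ ∑<-suc (suc n) f ⟩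
    f 0 + ∑< (suc n) (f ∘ suc)          ≈⟨ +-congˡ (∑<-last n (f ∘ suc)) ⟩
    f 0 + (∑< n (f ∘ suc) + f (suc n))  ≈⟨ +-assoc _ _ _ ⟨
    f 0 + ∑< n (f ∘ suc) + f (suc n)    ≡⟨ ≡.cong (_+ f (suc n)) (∑<-suc n f) ⟨
    ∑< (suc n) f + f (suc n)            ∎

  ∑<-+ : ∀ m n f → ∑< (m ℕ.+ n) f ≈ ∑< m f + ∑< n (λ i → f (m ℕ.+ i))
  ∑<-+ zero    n f = sym (+-identityˡ _)
  ∑<-+ (suc m) n f = begin
    ∑< (suc m ℕ.+ n) f                                          ≡⟨ ∑<-suc (m ℕ.+ n) f ⟩
    f 0 + ∑< (m ℕ.+ n) (f ∘ suc)                                ≈⟨ +-congˡ (∑<-+ m n (f ∘ suc)) ⟩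
    f 0 + (∑< m (f ∘ suc) + ∑< n (λ i → f (suc m ℕ.+ i)))       ≈⟨ +-assoc _ _ _ ⟨
    f 0 + ∑< m (f ∘ suc) + ∑< n (λ i → f (suc m ℕ.+ i))         ≡⟨ ≡.cong (_+ ∑< n (λ i → f (suc m ℕ.+ i))) (∑<-suc m f) ⟨
    ∑< (suc m) f + ∑< n (λ i → f (suc m ℕ.+ i))                 ∎

module PowerSeries (R : CommutativeSemiring 0ℓ 0ℓ) where
  open CommutativeSemiring R hiding (zero)
  open RawSemiringDefs rawSemiring using (product; sum) renaming (_×_ to _·_; _^_ to _^_)
  open Algebra.Properties.Semiring.Mult semiring using (×-congʳ; ×-comm-*)
  open Algebra.Properties.CommutativeMonoid.Mult +-commutativeMonoid using (×-distrib-+)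
  open Sums R
  open NatSolver R
  open SetoidReasoning setoid

  Series : Set
  Series = ℕ → Carrier

  infix  4 _≋_
  infixl 7 _⋆_
  infixl 6 _⊕_

  _≋_ : Series → Series → Set
  a ≋ b = ∀ n → a n ≈ b n

  tail : Series → Series
  tail a n = a (suc n)

  _⊕_ : Series → Series → Series
  (a ⊕ b) n = a n + b n

  -- The Cauchy product, by recursion on the degree: the constant term of the left factor is split
  -- off, and its tail takes its place one degree lower.
  _⋆_ : Series → Series → Series
  (a ⋆ b) zero    = a 0 * b 0
  (a ⋆ b) (suc n) = a 0 * b (suc n) + (tail a ⋆ b) n

  -- The monomial c tᵏ.
  mon : Carrier → ℕ → Series
  mon c zero    zero    = c
  mon c zero    (suc n) = 0#
  mon c (suc k) zero    = 0#
  mon c (suc k) (suc n) = mon c k n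

  0ˢ 1ˢ : Series
  0ˢ _ = 0#
  1ˢ = mon 1# 0

  ⋆-cong≤ : ∀ {a a′ b b′} n → (∀ i → i ℕ.≤ n → a i ≈ a′ i) → (∀ i → i ℕ.≤ n → b i ≈ b′ i) →
            (a ⋆ b) n ≈ (a′ ⋆ b′) n
  ⋆-cong≤ zero    a≈ b≈ = *-cong (a≈ 0 z≤n) (b≈ 0 z≤n)
  ⋆-cong≤ (suc n) a≈ b≈ = +-cong (*-cong (a≈ 0 z≤n) (b≈ (suc n) ℕ.≤-refl))
    (⋆-cong≤ n (λ i i≤n → a≈ (suc i) (s≤s i≤n)) (λ i i≤n → b≈ i (ℕ.m≤n⇒m≤1+n i≤n)))

  ⋆-cong : ∀ {a a′ b b′} → a ≋ a′ → b ≋ b′ → a ⋆ b ≋ a′ ⋆ b′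
  ⋆-cong a≋ b≋ n = ⋆-cong≤ n (λ i _ → a≋ i) (λ i _ → b≋ i)

  ⋆-distribʳ : ∀ c a b → (a ⊕ b) ⋆ c ≋ a ⋆ c ⊕ b ⋆ c
  ⋆-distribʳ c a b zero    = distribʳ _ _ _
  ⋆-distribʳ c a b (suc n) = trans (+-cong (distribʳ _ _ _) (⋆-distribʳ c (tail a) (tail b) n))
    (solve 4 (λ a b c d → (a :+ b) :+ (c :+ d) := (a :+ c) :+ (b :+ d)) refl _ _ _ _)

  ⋆-scaleˡ : ∀ x a b n → ((λ i → x * a i) ⋆ b) n ≈ x * (a ⋆ b) n
  ⋆-scaleˡ x a b zero    = *-assoc _ _ _
  ⋆-scaleˡ x a b (suc n) = trans (+-cong (*-assoc _ _ _) (⋆-scaleˡ x (tail a) b n)) (sym (distribˡ _ _ _))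

  ⋆-sucʳ : ∀ a b n → (a ⋆ b) (suc n) ≈ (a ⋆ tail b) n + a (suc n) * b 0
  ⋆-sucʳ a b zero    = refl
  ⋆-sucʳ a b (suc n) = trans (+-congˡ (⋆-sucʳ (tail a) b n)) (sym (+-assoc _ _ _))

  ⋆-comm : ∀ a b → a ⋆ b ≋ b ⋆ a
  ⋆-comm a b zero    = *-comm _ _
  ⋆-comm a b (suc n) = begin
    a 0 * b (suc n) + (tail a ⋆ b) n  ≈⟨ +-cong (*-comm _ _) (⋆-comm (tail a) b n) ⟩
    b (suc n) * a 0 + (b ⋆ tail a) n  ≈⟨ +-comm _ _ ⟩
    (b ⋆ tail a) n + b (suc n) * a 0  ≈⟨ ⋆-sucʳ b a n ⟨
    (b ⋆ a) (suc n) ∎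

  ⋆-assoc : ∀ a b c → (a ⋆ b) ⋆ c ≋ a ⋆ (b ⋆ c)
  ⋆-assoc a b c zero    = *-assoc _ _ _
  ⋆-assoc a b c (suc n) = begin
    a 0 * b 0 * c (suc n) + (((λ i → a 0 * b (suc i)) ⊕ tail a ⋆ b) ⋆ c) n
      ≈⟨ +-congˡ (⋆-distribʳ c _ _ n) ⟩
    a 0 * b 0 * c (suc n) + (((λ i → a 0 * b (suc i)) ⋆ c) n + ((tail a ⋆ b) ⋆ c) n)
      ≈⟨ +-congˡ (+-cong (⋆-scaleˡ (a 0) (tail b) c n) (⋆-assoc (tail a) b c n)) ⟩
    a 0 * b 0 * c (suc n) + (a 0 * (tail b ⋆ c) n + (tail a ⋆ (b ⋆ c)) n)
      ≈⟨ solve 5 (λ a b c d e → a :* b :* c :+ (a :* d :+ e) := a :* (b :* c :+ d) :+ e) refl _ _ _ _ _ ⟩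
    a 0 * (b 0 * c (suc n) + (tail b ⋆ c) n) + (tail a ⋆ (b ⋆ c)) n ∎

  ⋆-zeroˡ : ∀ a → 0ˢ ⋆ a ≋ 0ˢ
  ⋆-zeroˡ a zero    = zeroˡ _
  ⋆-zeroˡ a (suc n) = trans (+-cong (zeroˡ _) (⋆-zeroˡ a n)) (+-identityˡ _)

  mon-⋆0 : ∀ c a n → (mon c 0 ⋆ a) n ≈ c * a n
  mon-⋆0 c a zero    = refl
  mon-⋆0 c a (suc n) = trans (+-congˡ (⋆-zeroˡ a n)) (+-identityʳ _)

  mon-⋆suc : ∀ c k a n → (mon c (suc k) ⋆ a) (suc n) ≈ (mon c k ⋆ a) n
  mon-⋆suc c k a n = trans (+-congʳ (zeroˡ _)) (+-identityˡ _)

  ⋆-identityˡ : ∀ a → 1ˢ ⋆ a ≋ a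
  ⋆-identityˡ a n = trans (mon-⋆0 1# a n) (*-identityˡ _)

  mon-cong : ∀ {c c′} k → c ≈ c′ → mon c k ≋ mon c′ k
  mon-cong zero    c≈ zero    = c≈
  mon-cong zero    c≈ (suc n) = refl
  mon-cong (suc k) c≈ zero    = refl
  mon-cong (suc k) c≈ (suc n) = mon-cong k c≈ n

  mon-* : ∀ c d j k → mon c j ⋆ mon d k ≋ mon (c * d) (j ℕ.+ k)
  mon-* c d zero    zero    zero    = refl
  mon-* c d zero    zero    (suc n) = trans (mon-⋆0 c (mon d 0) (suc n)) (zeroʳ c)
  mon-* c d zero    (suc k) zero    = zeroʳ c
  mon-* c d zero    (suc k) (suc n) = begin
    (mon c 0 ⋆ mon d (suc k)) (suc n)  ≈⟨ mon-⋆0 c (mon d (suc k)) (suc n) ⟩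
    c * mon d k n                      ≈⟨ mon-⋆0 c (mon d k) n ⟨
    (mon c 0 ⋆ mon d k) n              ≈⟨ mon-* c d 0 k n ⟩
    mon (c * d) k n                    ∎
  mon-* c d (suc j) k       zero    = zeroˡ _
  mon-* c d (suc j) k       (suc n) = trans (mon-⋆suc c j (mon d k) n) (mon-* c d j k n)

  indicator-mon : ∀ c k n → (if does (k ℕ.≟ n) then c else 0#) ≈ mon c k n
  indicator-mon c zero    zero    = refl
  indicator-mon c zero    (suc n) = refl
  indicator-mon c (suc k) zero    = refl
  indicator-mon c (suc k) (suc n) = indicator-mon c k n

  -- A side condition w(x) = n on the index of a sum becomes the extraction of the coefficient of tⁿ
  -- once each term carries the weight t to the power w(x). Both constraints in the Bell polynomials
  -- are removed in this way.
  ∑-filter-mon : ∀ {A : Set} (w : A → ℕ) n xs f →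
    ∑ (filter (λ x → w x ℕ.≟ n) xs) f ≈ ∑ xs (λ x → mon (f x) (w x) n)
  ∑-filter-mon w n xs f = trans (∑-filter (λ x → w x ℕ.≟ n) xs f) (∑-cong xs λ x → indicator-mon (f x) (w x) n)

  seriesSemiring : CommutativeSemiring 0ℓ 0ℓ
  seriesSemiring = record
    { Carrier = Series ; _≈_ = _≋_ ; _+_ = _⊕_ ; _*_ = _⋆_ ; 0# = 0ˢ ; 1# = 1ˢ
    ; isCommutativeSemiring = Biased.isCommutativeSemiringˡ record
      { +-isCommutativeMonoid = record
        { isMonoid = record
          { isSemigroup = record
            { isMagma = record { isEquivalence = equiv ; ∙-cong = λ p q n → +-cong (p n) (q n) }
            ; assoc = λ a b c n → +-assoc _ _ _ }
          ; identity = (λ a n → +-identityˡ _) , (λ a n → +-identityʳ _) }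
        ; comm = λ a b n → +-comm _ _ }
      ; *-isCommutativeMonoid = record
        { isMonoid = record
          { isSemigroup = record
            { isMagma = record { isEquivalence = equiv ; ∙-cong = ⋆-cong }
            ; assoc = ⋆-assoc }
          ; identity = ⋆-identityˡ , (λ a n → trans (⋆-comm a 1ˢ n) (⋆-identityˡ a n)) }
        ; comm = ⋆-comm }
      ; distribʳ = ⋆-distribʳ
      ; zeroˡ = ⋆-zeroˡ } }
    where
    open import Relation.Binary.Structures using (IsEquivalence)
    equiv : IsEquivalence _≋_
    equiv = record { refl = λ n → refl ; sym = λ p n → sym (p n) ; trans = λ p q n → trans (p n) (q n) }

  private
    module S = CommutativeSemiring seriesSemiring
    module ΣS = Sums seriesSemiring
    module DS = RawSemiringDefs S.rawSemiring

  ∑-coeff : ∀ {A : Set} (xs : List A) a n → ΣS.∑ xs a n ≡ ∑ xs (λ x → a x n)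
  ∑-coeff []       a n = ≡.refl
  ∑-coeff (x ∷ xs) a n = ≡.cong (λ s → a x n + s) (∑-coeff xs a n)

  ∑-⋆-∑ : ∀ {A B : Set} (xs : List A) (ys : List B) a b →
    ΣS.∑ xs a ⋆ ΣS.∑ ys b ≋ ΣS.∑ xs (λ x → ΣS.∑ ys (λ y → a x ⋆ b y))
  ∑-⋆-∑ xs ys a b =
    S.trans (S.*-comm (ΣS.∑ xs a) (ΣS.∑ ys b)) (S.trans (ΣS.∑-*ˡ (ΣS.∑ ys b) xs a)
      (ΣS.∑-cong xs λ x → S.trans (S.*-comm (ΣS.∑ ys b) (a x)) (ΣS.∑-*ˡ (a x) ys b)))

  ∑-mon : ∀ N a n → n ℕ.< N → ∑< N (λ i → mon (a i) i n) ≈ a n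
  ∑-mon (suc N) a zero    n<N = begin
    ∑< (suc N) (λ i → mon (a i) i 0)  ≡⟨ ∑<-suc N (λ i → mon (a i) i 0) ⟩
    a 0 + ∑< N (λ i → 0#)             ≈⟨ +-congˡ (∑-0 (upTo N) λ _ → refl) ⟩
    a 0 + 0#                          ≈⟨ +-identityʳ _ ⟩
    a 0                               ∎
  ∑-mon (suc N) a (suc n) (s≤s n<N) = begin
    ∑< (suc N) (λ i → mon (a i) i (suc n))       ≡⟨ ∑<-suc N (λ i → mon (a i) i (suc n)) ⟩
    0# + ∑< N (λ i → mon (a (suc i)) i n)        ≈⟨ +-identityˡ _ ⟩
    ∑< N (λ i → mon (a (suc i)) i n)             ≈⟨ ∑-mon N (tail a) n n<N ⟩
    a (suc n)                                    ∎

  ⨂ : ∀ {m} → Vector Series m → Series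
  ⨂ = DS.product

  private
    -- Multiplying out the product of the series g_j, each cut off at degree b, gives one monomial
    -- for each family. The cut-off is harmless for the coefficient of tⁿ because n ≤ b.
    families-mon : ∀ m b (g : Vector Series m) n → n ℕ.≤ b →
      ∑ (families≤ m b) (λ k → mon (product (λ j → g j (k j))) (sumℕ k) n) ≈ ⨂ g n
    families-mon zero    b g n n≤b = +-identityʳ _
    families-mon (suc m) b g n n≤b = begin
      ∑ (families≤ (suc m) b) (λ k → mon (product (λ j → g j (k j))) (sumℕ k) n)
        ≈⟨ ∑-cartesian Vector._∷_ (upTo (suc b)) (families≤ m b) _ ⟩
      ∑< (suc b) (λ i → ∑ (families≤ m b) λ k → mon (g₀ i * f k) (i ℕ.+ sumℕ k) n)
        ≈⟨ ∑-cong (upTo (suc b)) (λ i → ∑-cong (families≤ m b) λ k → mon-* (g₀ i) (f k) i (sumℕ k) n) ⟨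
      ∑< (suc b) (λ i → ∑ (families≤ m b) λ k → (mon (g₀ i) i ⋆ mon (f k) (sumℕ k)) n)
        ≈⟨ ∑-cong (upTo (suc b)) (λ i → reflexive (∑-coeff (families≤ m b) (λ k → mon (g₀ i) i ⋆ mon (f k) (sumℕ k)) n)) ⟨
      ∑< (suc b) (λ i → ΣS.∑ (families≤ m b) (λ k → mon (g₀ i) i ⋆ mon (f k) (sumℕ k)) n)
        ≡⟨ ∑-coeff (upTo (suc b)) (λ i → ΣS.∑ (families≤ m b) (λ k → mon (g₀ i) i ⋆ mon (f k) (sumℕ k))) n ⟨
      ΣS.∑< (suc b) (λ i → ΣS.∑ (families≤ m b) λ k → mon (g₀ i) i ⋆ mon (f k) (sumℕ k)) n
        ≈⟨ ∑-⋆-∑ (upTo (suc b)) (families≤ m b) (λ i → mon (g₀ i) i) (λ k → mon (f k) (sumℕ k)) n ⟨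
      (ΣS.∑< (suc b) (λ i → mon (g₀ i) i) ⋆ ΣS.∑ (families≤ m b) (λ k → mon (f k) (sumℕ k))) n
        ≈⟨ ⋆-cong≤ n
             (λ i i≤n → trans (reflexive (∑-coeff (upTo (suc b)) (λ i → mon (g₀ i) i) i))
                              (∑-mon (suc b) g₀ i (s≤s (ℕ.≤-trans i≤n n≤b))))
             (λ i i≤n → trans (reflexive (∑-coeff (families≤ m b) (λ k → mon (f k) (sumℕ k)) i))
                              (families-mon m b g⁺ i (ℕ.≤-trans i≤n n≤b))) ⟩
      (g₀ ⋆ ⨂ g⁺) n ∎
      where
      g₀ : Series
      g₀ = g Fin.zero
      g⁺ : Vector Series m
      g⁺ j = g (Fin.suc j)
      f : Vector ℕ m → Carrier
      f k = product (λ j → g⁺ j (k j))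

  ∑-familiesWithSum : ∀ m n (g : Vector Series m) →
    ∑ (familiesWithSum m n) (λ k → product (λ j → g j (k j))) ≈ ⨂ g n
  ∑-familiesWithSum m n g =
    trans (∑-filter-mon sumℕ n (families≤ m n) _) (families-mon m n g n ℕ.≤-refl)

  linear : Carrier → Series
  linear x zero          = 1#
  linear x (suc zero)    = x
  linear x (suc (suc n)) = 0#

  ⋆-linear : ∀ a x n → (a ⋆ linear x) (suc n) ≈ a (suc n) + x * a n
  ⋆-linear a x n = begin
    (a ⋆ linear x) (suc n)                    ≈⟨ ⋆-comm a (linear x) (suc n) ⟩
    1# * a (suc n) + (tail (linear x) ⋆ a) n  ≈⟨ +-cong (*-identityˡ _) (⋆-cong tail-linear (λ _ → refl) n) ⟩
    a (suc n) + (mon x 0 ⋆ a) n               ≈⟨ +-congˡ (mon-⋆0 x a n) ⟩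
    a (suc n) + x * a n                       ∎
    where
    tail-linear : tail (linear x) ≋ mon x 0
    tail-linear zero    = refl
    tail-linear (suc n) = refl

  ∏ : {A : Set} → List A → (A → Carrier) → Carrier
  ∏ xs f = List.foldr (λ x s → f x * s) 1# xs

  elementary : {A : Set} → (A → Carrier) → List A → Series
  elementary f xs n = ∑ (choose n xs) (λ ks → ∏ ks f)

  -- The two halves of `choose`, sublists with x and sublists without x, are the two terms of the
  -- factor 1 + t f(x). Hence `elementary f xs` is the product of these factors.
  elementary-∷ : ∀ {A : Set} (f : A → Carrier) x xs →
    elementary f (x ∷ xs) ≋ elementary f xs ⋆ linear (f x)
  elementary-∷ f x xs zero    = sym (*-identityʳ _)
  elementary-∷ f x xs (suc n) = begin
    ∑ (List.map (x ∷_) (choose n xs) ++ choose (suc n) xs) (λ ks → ∏ ks f)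
      ≈⟨ ∑-++ (List.map (x ∷_) (choose n xs)) _ _ ⟩
    ∑ (List.map (x ∷_) (choose n xs)) (λ ks → ∏ ks f) + elementary f xs (suc n)
      ≈⟨ +-congʳ (trans (∑-map (x ∷_) (choose n xs) _) (sym (∑-*ˡ (f x) (choose n xs) _))) ⟩
    f x * elementary f xs n + elementary f xs (suc n)
      ≈⟨ +-comm _ _ ⟩
    elementary f xs (suc n) + f x * elementary f xs n
      ≈⟨ ⋆-linear (elementary f xs) (f x) n ⟨
    (elementary f xs ⋆ linear (f x)) (suc n) ∎

  d : Series → Series
  d a n = suc n · a (suc n)

  leibniz : ∀ a b → d (a ⋆ b) ≋ d a ⋆ b ⊕ a ⋆ d b
  leibniz a b zero    = solve 4 (λ a₀ a₁ b₀ b₁ → (a₀ :* b₁ :+ a₁ :* b₀) :+ con 0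
      := (a₁ :+ con 0) :* b₀ :+ a₀ :* (b₁ :+ con 0)) refl _ _ _ _
  leibniz a b (suc n) = begin
    suc (suc n) · (a 0 * b (suc (suc n)) + (tail a ⋆ b) (suc n))
      ≈⟨ ×-distrib-+ _ _ (suc (suc n)) ⟩
    -- One of the n + 2 copies of the coefficient of `tail a ⋆ b` is set aside. It makes up the
    -- difference between `tail (d a)` and `d (tail a)`, as (n+2) aₙ₊₂ = aₙ₊₂ + (n+1) aₙ₊₂.
    suc (suc n) · (a 0 * b (suc (suc n))) + ((a 1 * b (suc n) + (tail (tail a) ⋆ b) n) + suc n · (tail a ⋆ b) (suc n))
      ≈⟨ +-cong (sym (×-comm-* (suc (suc n)) _ _)) (+-congˡ (leibniz (tail a) b n)) ⟩
    a 0 * d b (suc n) + ((a 1 * b (suc n) + (tail (tail a) ⋆ b) n) + ((d (tail a) ⋆ b) n + (tail a ⋆ d b) n))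
      ≈⟨ solve 5 (λ x y z u v → x :+ ((y :+ z) :+ (u :+ v)) := (y :+ (z :+ u)) :+ (x :+ v)) refl _ _ _ _ _ ⟩
    (a 1 * b (suc n) + ((tail (tail a) ⋆ b) n + (d (tail a) ⋆ b) n)) + (a ⋆ d b) (suc n)
      ≈⟨ +-congʳ (+-cong (*-congʳ (sym (+-identityʳ _))) (sym (⋆-distribʳ b (tail (tail a)) (d (tail a)) n))) ⟩
    (d a ⋆ b) (suc n) + (a ⋆ d b) (suc n) ∎

  d-cong : ∀ {a b} → a ≋ b → d a ≋ d b
  d-cong a≋b n = ×-congʳ (suc n) (a≋b (suc n))

  -- The equation a′ = β a, multiplied out because neither division nor subtraction is available
  -- over a semiring.
  IsLogDerivative : Series → Series → Set
  IsLogDerivative β a = d a ≋ β ⋆ a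

  logDerivative-cong : ∀ {β β′ a a′} → β ≋ β′ → a ≋ a′ → IsLogDerivative β a → IsLogDerivative β′ a′
  logDerivative-cong β≋ a≋ h = S.trans (d-cong (S.sym a≋)) (S.trans h (⋆-cong β≋ a≋))

  logDerivative-⋆ : ∀ {β γ a b} → IsLogDerivative β a → IsLogDerivative γ b → IsLogDerivative (β ⊕ γ) (a ⋆ b)
  logDerivative-⋆ {β} {γ} {a} {b} ha hb = S.trans (leibniz a b)
    (S.trans (S.+-cong (⋆-cong ha (S.refl {b})) (⋆-cong (S.refl {a}) hb))
    (solveS 4 (λ a b β γ → (β ∙ a) ∙ b ⊞ a ∙ (γ ∙ b) ≗ (β ⊞ γ) ∙ (a ∙ b)) S.refl a b β γ))
    where open NatSolver seriesSemiring renaming (solve to solveS; _:*_ to _∙_; _:+_ to _⊞_; _:=_ to _≗_)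

  ·-0 : ∀ n → n · 0# ≈ 0#
  ·-0 zero    = refl
  ·-0 (suc n) = trans (+-identityˡ _) (·-0 n)

  logDerivative-1 : IsLogDerivative 0ˢ 1ˢ
  logDerivative-1 n = trans (·-0 (suc n)) (sym (⋆-zeroˡ 1ˢ n))

  logDerivative-⨂ : ∀ {m} (β g : Vector Series m) → (∀ j → IsLogDerivative (β j) (g j)) →
                    IsLogDerivative (DS.sum β) (⨂ g)
  logDerivative-⨂ {zero}  β g h = logDerivative-1
  logDerivative-⨂ {suc m} β g h = logDerivative-⋆ {b = ⨂ (g ∘ Fin.suc)} (h Fin.zero)
    (logDerivative-⨂ (β ∘ Fin.suc) (g ∘ Fin.suc) (h ∘ Fin.suc))

  -- The substitution of r t for t is multiplicative.
  geometric-⋆ : ∀ r a b n → ((λ i → r ^ i * a i) ⋆ (λ i → r ^ i * b i)) n ≈ r ^ n * (a ⋆ b) n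
  geometric-⋆ r a b zero    = solve 2 (λ a b → con 1 :* a :* (con 1 :* b) := con 1 :* (a :* b)) refl _ _
  geometric-⋆ r a b (suc n) = begin
    1# * a 0 * (r * r ^ n * b (suc n)) + ((λ i → r * r ^ i * a (suc i)) ⋆ _) n
      ≈⟨ +-congˡ (⋆-cong (λ i → *-assoc r (r ^ i) (a (suc i))) (λ _ → refl) n) ⟩
    1# * a 0 * (r * r ^ n * b (suc n)) + ((λ i → r * (r ^ i * a (suc i))) ⋆ _) n
      ≈⟨ +-congˡ (⋆-scaleˡ r (λ i → r ^ i * a (suc i)) _ n) ⟩
    1# * a 0 * (r * r ^ n * b (suc n)) + r * ((λ i → r ^ i * a (suc i)) ⋆ (λ i → r ^ i * b i)) n
      ≈⟨ +-congˡ (*-congˡ (geometric-⋆ r (tail a) b n)) ⟩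
    1# * a 0 * (r * r ^ n * b (suc n)) + r * (r ^ n * (tail a ⋆ b) n)
      ≈⟨ solve 5 (λ a r s b c → con 1 :* a :* (r :* s :* b) :+ r :* (s :* c) := r :* s :* (a :* b :+ c)) refl _ r _ _ _ ⟩
    r ^ suc n * (a ⋆ b) (suc n) ∎

  -- The chain rule for the substitution of r t for t, which accounts for the extra factor r.
  logDerivative-scale : ∀ r {β a} → IsLogDerivative β a →
    IsLogDerivative (λ i → r ^ suc i * β i) (λ i → r ^ i * a i)
  logDerivative-scale r {β} {a} h n = begin
    suc n · (r ^ suc n * a (suc n))                        ≈⟨ ×-comm-* (suc n) _ _ ⟨
    r ^ suc n * d a n                                      ≈⟨ *-congˡ (h n) ⟩
    r ^ suc n * (β ⋆ a) n                                  ≈⟨ *-assoc _ _ _ ⟩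
    r * (r ^ n * (β ⋆ a) n)                                ≈⟨ *-congˡ (geometric-⋆ r β a n) ⟨
    r * ((λ i → r ^ i * β i) ⋆ (λ i → r ^ i * a i)) n      ≈⟨ ⋆-scaleˡ r (λ i → r ^ i * β i) _ n ⟨
    ((λ i → r * (r ^ i * β i)) ⋆ (λ i → r ^ i * a i)) n    ≈⟨ ⋆-cong (λ i → *-assoc r _ _) (λ _ → refl) n ⟨
    ((λ i → r ^ suc i * β i) ⋆ (λ i → r ^ i * a i)) n      ∎

  -- x / (1 + x t) is a geometric series of ratio -x; y plays the role of -x, since the semiring has
  -- no negation.
  logDerivative-linear : ∀ x y → y + x ≈ 0# → IsLogDerivative (λ i → y ^ i * x) (linear x)
  logDerivative-linear x y y+x≈0 zero    = solve 1 (λ x → x :+ con 0 := con 1 :* x :* con 1) refl x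
  logDerivative-linear x y y+x≈0 (suc n) = begin
    suc (suc n) · 0#                                          ≈⟨ ×-comm-0 (suc (suc n)) ⟩
    0#                                                        ≈⟨ zeroʳ _ ⟨
    y ^ n * x * 0#                                            ≈⟨ *-congˡ y+x≈0 ⟨
    y ^ n * x * (y + x)                                       ≈⟨ solve 3 (λ x y p → p :* x :* (y :+ x) := y :* p :* x :+ x :* (p :* x)) refl x y _ ⟩
    y * y ^ n * x + x * (y ^ n * x)                           ≈⟨ ⋆-linear (λ i → y ^ i * x) x n ⟨
    ((λ i → y ^ i * x) ⋆ linear x) (suc n)                    ∎
    where
    ×-comm-0 : ∀ n → n · 0# ≈ 0#
    ×-comm-0 zero    = refl
    ×-comm-0 (suc n) = trans (+-identityˡ _) (×-comm-0 n)

  logDerivative-elementary : ∀ {A : Set} (f g : A → Carrier) → (∀ x → g x + f x ≈ 0#) → ∀ xs →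
    IsLogDerivative (λ i → ∑ xs (λ x → g x ^ i * f x)) (elementary f xs)
  logDerivative-elementary f g g+f []       = logDerivative-cong S.refl elementary-[] logDerivative-1
    where
    elementary-[] : 1ˢ ≋ elementary f []
    elementary-[] zero    = sym (+-identityʳ _)
    elementary-[] (suc n) = refl
  logDerivative-elementary f g g+f (x ∷ xs) = logDerivative-cong (λ n → +-comm _ _) (S.sym (elementary-∷ f x xs))
    (logDerivative-⋆ {b = linear (f x)} (logDerivative-elementary f g g+f xs)
      (logDerivative-linear (f x) (g x) (g+f x)))

-- Exponential series and uniqueness of solutions of a′ = β a

module Exponential (R : CommutativeSemiring 0ℓ 0ℓ)
  (1/suc : ℕ → CommutativeSemiring.Carrier R)
  (·-1/suc : ∀ n → CommutativeSemiring._≈_ R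
    (RawSemiringDefs._×_ (CommutativeSemiring.rawSemiring R) (suc n) (1/suc n))
    (CommutativeSemiring.1# R)) where
  open CommutativeSemiring R hiding (zero)
  open RawSemiringDefs rawSemiring using (product; sum) renaming (_×_ to _·_; _^_ to _^_)
  open Algebra.Properties.Semiring.Mult semiring using (×-congʳ; ×-assoc-*; ×-comm-*)
  open Algebra.Properties.CommutativeMonoid.Mult +-commutativeMonoid using (×-distrib-+)
  open Algebra.Properties.Semiring.Exp semiring using (^-congˡ)
  open Sums R
  open PowerSeries R
  open NatSolver R
  open SetoidReasoning setoid

  1/suc-*-· : ∀ n x → 1/suc n * (suc n · x) ≈ x
  1/suc-*-· n x = begin
    1/suc n * (suc n · x)  ≈⟨ ×-comm-* (suc n) _ _ ⟩
    suc n · (1/suc n * x)  ≈⟨ ×-assoc-* (suc n) _ _ ⟨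
    suc n · 1/suc n * x    ≈⟨ *-congʳ (·-1/suc n) ⟩
    1# * x                 ≈⟨ *-identityˡ x ⟩
    x                      ∎

  ·-cancel : ∀ n {x y} → suc n · x ≈ suc n · y → x ≈ y
  ·-cancel n {x} {y} h = trans (sym (1/suc-*-· n x)) (trans (*-congˡ h) (1/suc-*-· n y))

  -- (n+1) aₙ₊₁ is determined by a₀, ..., aₙ, and n+1 can be cancelled. The bound n turns strong
  -- induction into structural recursion.
  logDerivative-unique≤ : ∀ {β a b} → IsLogDerivative β a → IsLogDerivative β b → a 0 ≈ b 0 →
                          ∀ n i → i ℕ.≤ n → a i ≈ b i
  logDerivative-unique≤ ha hb a₀ n       zero    i≤n       = a₀
  logDerivative-unique≤ ha hb a₀ (suc n) (suc i) (s≤s i≤n) = ·-cancel i (begin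
    _  ≈⟨ ha i ⟩
    _  ≈⟨ ⋆-cong≤ i (λ _ _ → refl) (λ k k≤i → logDerivative-unique≤ ha hb a₀ n k (ℕ.≤-trans k≤i i≤n)) ⟩
    _  ≈⟨ hb i ⟨
    _  ∎)

  logDerivative-unique : ∀ {β a b} → IsLogDerivative β a → IsLogDerivative β b → a 0 ≈ b 0 → a ≋ b
  logDerivative-unique ha hb a₀ n = logDerivative-unique≤ ha hb a₀ n n ℕ.≤-refl

  1/n! : ℕ → Carrier
  1/n! zero    = 1#
  1/n! (suc n) = 1/suc n * 1/n! n

  ·-1/n! : ∀ n → suc n · 1/n! (suc n) ≈ 1/n! n
  ·-1/n! n = trans (sym (×-assoc-* (suc n) _ _)) (trans (*-congʳ (·-1/suc n)) (*-identityˡ _))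

  exp : Carrier → Series
  exp a k = a ^ k * 1/n! k

  exp-cong : ∀ {a b} → a ≈ b → exp a ≋ exp b
  exp-cong a≈b k = *-congʳ (^-congˡ k a≈b)

  logDerivative-exp : ∀ a → IsLogDerivative (mon a 0) (exp a)
  logDerivative-exp a n = begin
    suc n · (a * a ^ n * 1/n! (suc n))  ≈⟨ ×-comm-* (suc n) _ _ ⟨
    a * a ^ n * (suc n · 1/n! (suc n))  ≈⟨ *-congˡ (·-1/n! n) ⟩
    a * a ^ n * 1/n! n                  ≈⟨ *-assoc _ _ _ ⟩
    a * exp a n                         ≈⟨ mon-⋆0 a (exp a) n ⟨
    (mon a 0 ⋆ exp a) n                 ∎

  -- Both sides have the constant logarithmic derivative a + b and constant term 1.
  exp-+ : ∀ a b → exp a ⋆ exp b ≋ exp (a + b)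
  exp-+ a b = logDerivative-unique
    (logDerivative-⋆ {b = exp b} (logDerivative-exp a) (logDerivative-exp b))
    (logDerivative-cong mon-+ (λ _ → refl) (logDerivative-exp (a + b)))
    (solve 0 (con 1 :* con 1 :* (con 1 :* con 1) := con 1 :* con 1) refl)
    where
    mon-+ : mon (a + b) 0 ≋ mon a 0 ⊕ mon b 0
    mon-+ zero    = refl
    mon-+ (suc n) = sym (+-identityˡ _)

  exp-0 : exp 0# ≋ 1ˢ
  exp-0 zero    = *-identityˡ _
  exp-0 (suc n) = trans (*-congʳ (zeroˡ _)) (zeroˡ _)

  exp-⨂ : ∀ {m} (a : Vector Carrier m) → ⨂ (λ i → exp (a i)) ≋ exp (sum a)
  exp-⨂ {zero}  a n = sym (exp-0 n)
  exp-⨂ {suc m} a n = begin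
    (exp (a Fin.zero) ⋆ ⨂ (λ i → exp (a (Fin.suc i)))) n       ≈⟨ ⋆-cong (λ _ → refl) (exp-⨂ (a ∘ Fin.suc)) n ⟩
    (exp (a Fin.zero) ⋆ exp (sum (a ∘ Fin.suc))) n             ≈⟨ exp-+ _ _ n ⟩
    exp (sum a) n                                              ∎

  -- The multinomial theorem divided by k!, read off from the product of the exponentials of the a_i
  -- t.
  multinomial : ∀ {m} k (a : Vector Carrier m) →
    ∑ (familiesWithSum m k) (λ j → product (λ i → exp (a i) (j i))) ≈ exp (sum a) k
  multinomial {m} k a = trans (∑-familiesWithSum m k (λ i → exp (a i))) (exp-⨂ a k)

-- Bell polynomials as coefficients of exponentials of series

module Bell (R : CommutativeSemiring 0ℓ 0ℓ)
  (1/suc : ℕ → CommutativeSemiring.Carrier R)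
  (·-1/suc : ∀ n → CommutativeSemiring._≈_ R
    (RawSemiringDefs._×_ (CommutativeSemiring.rawSemiring R) (suc n) (1/suc n))
    (CommutativeSemiring.1# R)) where
  open CommutativeSemiring R hiding (zero)
  open RawSemiringDefs rawSemiring using (product; sum) renaming (_×_ to _·_; _^_ to _^_)
  open Algebra.Properties.Semiring.Mult semiring using (×-congʳ; ×-homo-+; ×-assoc-*; ×-comm-*)
  open Algebra.Properties.CommutativeSemiring.Exp R using (^-distrib-*)
  open Sums R
  open PowerSeries R
  open Exponential R 1/suc ·-1/suc
  open NatSolver R
  open SetoidReasoning setoid
  private
    module S = CommutativeSemiring seriesSemiring
    module ΣS = Sums seriesSemiring
    module DS = RawSemiringDefs S.rawSemiring
    open DS using () renaming (_^_ to _^ˢ_)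
    module ES = Algebra.Properties.Semiring.Exp S.semiring
    module CES = Algebra.Properties.CommutativeSemiring.Exp seriesSemiring

    ·-coeff : ∀ m a n → (m DS.× a) n ≡ m · a n
    ·-coeff zero    a n = ≡.refl
    ·-coeff (suc m) a n = ≡.cong (λ s → a n + s) (·-coeff m a n)

    constant-·-1/suc : ∀ n → suc n DS.× mon (1/suc n) 0 ≋ 1ˢ
    constant-·-1/suc n zero    = trans (reflexive (·-coeff (suc n) (mon (1/suc n) 0) 0)) (·-1/suc n)
    constant-·-1/suc n (suc i) = trans (reflexive (·-coeff (suc n) (mon (1/suc n) 0) (suc i))) (·-0 (suc n))

    module ExpS = Exponential seriesSemiring (λ n → mon (1/suc n) 0) constant-·-1/suc

  -- The series aᵏ/k!, which is the coefficient of uᵏ in exp(u a): the exponential in a second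
  -- variable u over the semiring of series in t.
  expˢ : Series → ℕ → Series
  expˢ = ExpS.exp

  private
    1/n!-mon : ∀ n → ExpS.1/n! n ≋ mon (1/n! n) 0
    1/n!-mon zero    = S.refl
    1/n!-mon (suc n) = S.trans (S.*-congˡ {mon (1/suc n) 0} (1/n!-mon n)) (mon-* _ _ 0 0)

  expˢ-coeff : ∀ a k n → expˢ a k n ≈ (a ^ˢ k) n * 1/n! k
  expˢ-coeff a k n = begin
    (a ^ˢ k ⋆ ExpS.1/n! k) n   ≈⟨ ⋆-cong (S.refl {a ^ˢ k}) (1/n!-mon k) n ⟩
    (a ^ˢ k ⋆ mon (1/n! k) 0) n  ≈⟨ ⋆-comm (a ^ˢ k) (mon (1/n! k) 0) n ⟩
    (mon (1/n! k) 0 ⋆ a ^ˢ k) n  ≈⟨ mon-⋆0 (1/n! k) (a ^ˢ k) n ⟩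
    1/n! k * (a ^ˢ k) n        ≈⟨ *-comm _ _ ⟩
    (a ^ˢ k) n * 1/n! k        ∎

  mon-^ : ∀ c i k → mon c i ^ˢ k ≋ mon (c ^ k) (i ℕ.* k)
  mon-^ c i zero    n = reflexive (≡.cong (λ m → mon 1# m n) (≡.sym (ℕ.*-zeroʳ i)))
  mon-^ c i (suc k) n = begin
    (mon c i ⋆ mon c i ^ˢ k) n               ≈⟨ ⋆-cong (S.refl {mon c i}) (mon-^ c i k) n ⟩
    (mon c i ⋆ mon (c ^ k) (i ℕ.* k)) n      ≈⟨ mon-* c (c ^ k) i (i ℕ.* k) n ⟩
    mon (c ^ suc k) (i ℕ.+ i ℕ.* k) n        ≡⟨ ≡.cong (λ m → mon (c ^ suc k) m n) (ℕ.*-suc i k) ⟨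
    mon (c ^ suc k) (i ℕ.* suc k) n          ∎

  product-mon : ∀ {m} (c : Vector Carrier m) (w : Vector ℕ m) →
    ⨂ (λ i → mon (c i) (w i)) ≋ mon (product c) (sumℕ w)
  product-mon {zero}  c w = S.refl
  product-mon {suc m} c w = S.trans
    (S.*-congˡ {mon (c Fin.zero) (w Fin.zero)} (product-mon (c ∘ Fin.suc) (w ∘ Fin.suc)))
    (mon-* (c Fin.zero) _ (w Fin.zero) _)

  ⨂-cong : ∀ {m} {f g : Vector Series m} → (∀ i → f i ≋ g i) → ⨂ f ≋ ⨂ g
  ⨂-cong {zero}  f≋g = S.refl
  ⨂-cong {suc m} {f} {g} f≋g = ⋆-cong (f≋g Fin.zero) (⨂-cong {m} {f ∘ Fin.suc} (f≋g ∘ Fin.suc))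

  -- The sum in B_{n,k}(x) / n!, with c_i = x_{i+1} / (i+1)!
  bellSum : (c : ℕ → Carrier) (n k : ℕ) → Carrier
  bellSum c n k = ∑ (bellExponents n k) λ j → product (λ i → exp (c (toℕ i)) (j i))

  private
    -- The multinomial theorem over the semiring of series, for the monomials c_i tⁱ⁺¹. The
    -- constraint Σ j_i = k belongs to the theorem; the weight Σ (i+1) j_i appears as the power of
    -- t.
    monomials : ∀ (c : ℕ → Carrier) m k n →
      ∑ (familiesWithSum m k) (λ j → mon (product (λ i → exp (c (toℕ i)) (j i)))
                                         (sumℕ (λ i → suc (toℕ i) ℕ.* j i)) n)
      ≈ expˢ (DS.sum {m} (λ i → mon (c (toℕ i)) (suc (toℕ i)))) k n
    monomials c m k n = begin
      ∑ F (λ j → mon (product (λ i → exp (c (toℕ i)) (j i))) (sumℕ (λ i → suc (toℕ i) ℕ.* j i)) n)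
        ≈⟨ ∑-cong F (λ j → product-mon {m} (λ i → exp (c (toℕ i)) (j i)) (λ i → suc (toℕ i) ℕ.* j i) n) ⟨
      ∑ F (λ j → ⨂ (λ i → mon (exp (c (toℕ i)) (j i)) (suc (toℕ i) ℕ.* j i)) n)
        ≈⟨ ∑-cong F (λ j → ⨂-cong {m} (λ i → factors (toℕ i) (j i)) n) ⟨
      ∑ F (λ j → ⨂ (λ i → expˢ (mon (c (toℕ i)) (suc (toℕ i))) (j i)) n)
        ≡⟨ ∑-coeff F _ n ⟨
      ΣS.∑ F (λ j → ⨂ (λ i → expˢ (mon (c (toℕ i)) (suc (toℕ i))) (j i))) n
        ≈⟨ ExpS.multinomial {m} k (λ i → mon (c (toℕ i)) (suc (toℕ i))) n ⟩
      expˢ (DS.sum {m} (λ i → mon (c (toℕ i)) (suc (toℕ i)))) k n ∎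
      where
      F = familiesWithSum m k
      factors : ∀ i j → expˢ (mon (c i) (suc i)) j ≋ mon (exp (c i) j) (suc i ℕ.* j)
      factors i j n = begin
        (mon (c i) (suc i) ^ˢ j ⋆ ExpS.1/n! j) n        ≈⟨ ⋆-cong (mon-^ (c i) (suc i) j) (1/n!-mon j) n ⟩
        (mon (c i ^ j) (suc i ℕ.* j) ⋆ mon (1/n! j) 0) n  ≈⟨ mon-* _ _ (suc i ℕ.* j) 0 n ⟩
        mon (exp (c i) j) (suc i ℕ.* j ℕ.+ 0) n         ≡⟨ ≡.cong (λ m → mon (exp (c i) j) m n) (ℕ.+-identityʳ (suc i ℕ.* j)) ⟩
        mon (exp (c i) j) (suc i ℕ.* j) n               ∎

  -- The series t a(t), kept as a product so that its powers split into tᵏ and aᵏ.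
  shift : Series → Series
  shift a = mon 1# 1 ⋆ a

  private
    shift-suc : ∀ a n → shift a (suc n) ≈ a n
    shift-suc a n = trans (mon-⋆suc 1# 0 a n) (⋆-identityˡ a n)

    mon1-⋆-+ : ∀ k a n → (mon 1# k ⋆ a) (k ℕ.+ n) ≈ a n
    mon1-⋆-+ zero    a n = ⋆-identityˡ a n
    mon1-⋆-+ (suc k) a n = trans (mon-⋆suc 1# k a (k ℕ.+ n)) (mon1-⋆-+ k a n)

    mon1-⋆-< : ∀ k a n → n ℕ.< k → (mon 1# k ⋆ a) n ≈ 0#
    mon1-⋆-< (suc k) a zero    n<k       = zeroˡ _
    mon1-⋆-< (suc k) a (suc n) (s≤s n<k) = trans (mon-⋆suc 1# k a n) (mon1-⋆-< k a n n<k)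

    1^n : ∀ n → 1# ^ n ≈ 1#
    1^n zero    = refl
    1^n (suc n) = trans (*-identityˡ _) (1^n n)

    shift-^ : ∀ a k → shift a ^ˢ k ≋ mon 1# k ⋆ a ^ˢ k
    shift-^ a k n = begin
      (shift a ^ˢ k) n                        ≈⟨ CES.^-distrib-* (mon 1# 1) a k n ⟩
      (mon 1# 1 ^ˢ k ⋆ a ^ˢ k) n              ≈⟨ ⋆-cong (mon-^ 1# 1 k) (S.refl {a ^ˢ k}) n ⟩
      (mon (1# ^ k) (1 ℕ.* k) ⋆ a ^ˢ k) n     ≡⟨ ≡.cong (λ m → (mon (1# ^ k) m ⋆ a ^ˢ k) n) (ℕ.*-identityˡ k) ⟩
      (mon (1# ^ k) k ⋆ a ^ˢ k) n             ≈⟨ ⋆-cong (mon-cong k (1^n k)) (S.refl {a ^ˢ k}) n ⟩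
      (mon 1# k ⋆ a ^ˢ k) n                   ∎

    ^-cong≤ : ∀ k {a b} n → (∀ i → i ℕ.≤ n → a i ≈ b i) → (a ^ˢ k) n ≈ (b ^ˢ k) n
    ^-cong≤ zero    n a≈b = refl
    ^-cong≤ (suc k) n a≈b = ⋆-cong≤ n a≈b (λ i i≤n → ^-cong≤ k i (λ j j≤i → a≈b j (ℕ.≤-trans j≤i i≤n)))

    sum-mon-zero : ∀ {m} (f : Vector Carrier m) (w : Vector ℕ m) →
      DS.sum (λ i → mon (f i) (suc (w i))) 0 ≈ 0#
    sum-mon-zero {zero}  f w = refl
    sum-mon-zero {suc m} f w = trans (+-identityˡ _) (sum-mon-zero (f ∘ Fin.suc) (w ∘ Fin.suc))

    sum-mon-suc : ∀ {m} (f : Vector Carrier m) (w : Vector ℕ m) n →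
      DS.sum (λ i → mon (f i) (suc (w i))) (suc n) ≡ DS.sum (λ i → mon (f i) (w i)) n
    sum-mon-suc {zero}  f w n = ≡.refl
    sum-mon-suc {suc m} f w n = ≡.cong (λ s → mon (f Fin.zero) (w Fin.zero) n + s)
      (sum-mon-suc (f ∘ Fin.suc) (w ∘ Fin.suc) n)

    sum-mon-shift : ∀ {m} (f : Vector Carrier m) (w : Vector ℕ m) →
      DS.sum (λ i → mon (f i) (suc (w i))) ≋ shift (DS.sum (λ i → mon (f i) (w i)))
    sum-mon-shift f w zero    = trans (sum-mon-zero f w) (sym (zeroˡ _))
    sum-mon-shift f w (suc n) = trans (reflexive (sum-mon-suc f w n)) (sym (shift-suc _ n))

    truncate : ∀ m (c : ℕ → Carrier) i → i ℕ.< m → DS.sum {m} (λ i → mon (c (toℕ i)) (toℕ i)) i ≈ c i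
    truncate (suc m) c zero    i<m       =
      trans (+-congˡ (sum-mon-zero {m} (c ∘ suc ∘ toℕ) toℕ)) (+-identityʳ _)
    truncate (suc m) c (suc i) (s≤s i<m) = trans (+-identityˡ _)
      (trans (reflexive (sum-mon-suc {m} (c ∘ suc ∘ toℕ) toℕ i)) (truncate m (c ∘ suc) i i<m))

  -- The Bell polynomial contains only c₀, ..., cₙ₋ₖ, whereas `shift c` contains all c_i. Since the
  -- k-th power starts at tᵏ, its coefficient at tⁿ is the coefficient of cᵏ at degree n - k, which
  -- the later c_i do not reach.
  bellSum-expˢ : ∀ c n k → k ℕ.≤ n → bellSum c n k ≈ expˢ (shift c) k n
  bellSum-expˢ c n k k≤n = begin
    bellSum c n k
      ≈⟨ ∑-filter-mon (λ (j : Vector ℕ m) → sumℕ (λ i → suc (toℕ i) ℕ.* j i)) n (familiesWithSum m k) _ ⟩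
    ∑ (familiesWithSum m k) (λ j → mon (product (λ i → exp (c (toℕ i)) (j i)))
                                       (sumℕ (λ i → suc (toℕ i) ℕ.* j i)) n)
      ≈⟨ monomials c m k n ⟩
    expˢ (DS.sum {m} (λ i → mon (c (toℕ i)) (suc (toℕ i)))) k n
      ≈⟨ ExpS.exp-cong (sum-mon-shift {m} (c ∘ toℕ) toℕ) k n ⟩
    expˢ (shift c≤) k n
      ≈⟨ coeff c≤ ⟩
    (c≤ ^ˢ k) (n ℕ.∸ k) * 1/n! k
      ≈⟨ *-congʳ (^-cong≤ k (n ℕ.∸ k) (λ i i≤ → truncate m c i (s≤s i≤))) ⟩
    (c ^ˢ k) (n ℕ.∸ k) * 1/n! k
      ≈⟨ coeff c ⟨
    expˢ (shift c) k n ∎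
    where
    m : ℕ
    m = suc (n ℕ.∸ k)
    c≤ : Series
    c≤ = DS.sum {m} (λ i → mon (c (toℕ i)) (toℕ i))
    coeff : ∀ a → expˢ (shift a) k n ≈ (a ^ˢ k) (n ℕ.∸ k) * 1/n! k
    coeff a = begin
      expˢ (shift a) k n                            ≈⟨ expˢ-coeff (shift a) k n ⟩
      (shift a ^ˢ k) n * 1/n! k                     ≈⟨ *-congʳ (shift-^ a k n) ⟩
      (mon 1# k ⋆ a ^ˢ k) n * 1/n! k                ≡⟨ ≡.cong (λ n → (mon 1# k ⋆ a ^ˢ k) n * 1/n! k) (ℕ.m+[n∸m]≡n k≤n) ⟨
      (mon 1# k ⋆ a ^ˢ k) (k ℕ.+ (n ℕ.∸ k)) * 1/n! k  ≈⟨ *-congʳ (mon1-⋆-+ k (a ^ˢ k) (n ℕ.∸ k)) ⟩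
      (a ^ˢ k) (n ℕ.∸ k) * 1/n! k                   ∎

  expˢ-scale : ∀ r c k n → r ^ k * expˢ (shift c) k n ≈ expˢ (shift (λ i → r * c i)) k n
  expˢ-scale r c k n = begin
    r ^ k * expˢ (shift c) k n                        ≈⟨ *-congˡ (expˢ-coeff (shift c) k n) ⟩
    r ^ k * ((shift c ^ˢ k) n * 1/n! k)               ≈⟨ *-assoc _ _ _ ⟨
    r ^ k * (shift c ^ˢ k) n * 1/n! k                 ≈⟨ *-congʳ (mon-⋆0 (r ^ k) (shift c ^ˢ k) n) ⟨
    (mon (r ^ k) 0 ⋆ shift c ^ˢ k) n * 1/n! k         ≈⟨ *-congʳ (⋆-cong (mon-^ r 0 k) (S.refl {shift c ^ˢ k}) n) ⟨
    (mon r 0 ^ˢ k ⋆ shift c ^ˢ k) n * 1/n! k          ≈⟨ *-congʳ (CES.^-distrib-* (mon r 0) (shift c) k n) ⟨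
    ((mon r 0 ⋆ shift c) ^ˢ k) n * 1/n! k             ≈⟨ *-congʳ (ES.^-congˡ k scale-shift n) ⟩
    (shift (λ i → r * c i) ^ˢ k) n * 1/n! k           ≈⟨ expˢ-coeff (shift (λ i → r * c i)) k n ⟨
    expˢ (shift (λ i → r * c i)) k n                  ∎
    where
    scale-shift : mon r 0 ⋆ shift c ≋ shift (λ i → r * c i)
    scale-shift zero    = trans (*-congˡ (zeroˡ _)) (trans (zeroʳ r) (sym (zeroˡ _)))
    scale-shift (suc n) = trans (mon-⋆0 r (shift c) (suc n))
      (trans (*-congˡ (shift-suc c n)) (sym (shift-suc (λ i → r * c i) n)))

  -- exp of the series c₀ t + c₁ t² + ⋯; the k-th power starts at tᵏ.
  exp∘shift : (ℕ → Carrier) → Series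
  exp∘shift c n = ∑< (suc n) (λ k → expˢ (shift c) k n)

  private
    expˢ-vanish : ∀ c k n → n ℕ.< k → expˢ (shift c) k n ≈ 0#
    expˢ-vanish c k n n<k = begin
      expˢ (shift c) k n              ≈⟨ expˢ-coeff (shift c) k n ⟩
      (shift c ^ˢ k) n * 1/n! k       ≈⟨ *-congʳ (trans (shift-^ c k n) (mon1-⋆-< k (c ^ˢ k) n n<k)) ⟩
      0# * 1/n! k                     ≈⟨ zeroˡ _ ⟩
      0#                              ∎

    -- Terms with k > n vanish at degree n. Giving all degrees up to N the same number of terms
    -- allows the finite sum to be a factor of a Cauchy product in `logDerivative-exp∘shift`.
    exp∘shift-extend : ∀ c N n → n ℕ.≤ N → ∑< (suc N) (λ k → expˢ (shift c) k n) ≈ exp∘shift c n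
    exp∘shift-extend c N n n≤N = begin
      ∑< (suc N) f                                   ≡⟨ ≡.cong (λ m → ∑< (suc m) f) (ℕ.m+[n∸m]≡n n≤N) ⟨
      ∑< (suc n ℕ.+ (N ℕ.∸ n)) f                     ≈⟨ ∑<-+ (suc n) (N ℕ.∸ n) f ⟩
      ∑< (suc n) f + ∑< (N ℕ.∸ n) (λ i → f (suc n ℕ.+ i))
        ≈⟨ +-congˡ (∑-0 (upTo (N ℕ.∸ n)) (λ i → expˢ-vanish c _ n (s≤s (ℕ.m≤m+n n i)))) ⟩
      ∑< (suc n) f + 0#                              ≈⟨ +-identityʳ _ ⟩
      exp∘shift c n                                  ∎
      where
      f : ℕ → Carrier
      f k = expˢ (shift c) k n

    d-^ : ∀ a k → d (a ^ˢ suc k) ≋ suc k DS.× (d a ⋆ a ^ˢ k)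
    d-^ a k = S.trans (leibniz a (a ^ˢ k)) (S.+-congˡ (step k))
      where
      open Algebra.Properties.Semiring.Mult S.semiring using () renaming (×-comm-* to ·ˢ-comm-⋆; ×-congʳ to ·ˢ-congʳ)
      step : ∀ k → a ⋆ d (a ^ˢ k) ≋ k DS.× (d a ⋆ a ^ˢ k)
      step zero    = S.trans (S.*-congˡ {a} (S.trans logDerivative-1 (⋆-zeroˡ 1ˢ)))
                             (S.trans (⋆-comm a 0ˢ) (⋆-zeroˡ a))
      step (suc k) = S.trans (S.*-congˡ {a} (d-^ a k)) (S.trans (·ˢ-comm-⋆ (suc k) a (d a ⋆ a ^ˢ k))
        (·ˢ-congʳ (suc k) (S.trans (S.sym (⋆-assoc a (d a) (a ^ˢ k)))
          (S.trans (S.*-congʳ {a ^ˢ k} (⋆-comm a (d a))) (⋆-assoc (d a) a (a ^ˢ k))))))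

    d-expˢ : ∀ a k → d (expˢ a (suc k)) ≋ d a ⋆ expˢ a k
    d-expˢ a k n = begin
      suc n · expˢ a (suc k) (suc n)                       ≈⟨ ×-congʳ (suc n) (expˢ-coeff a (suc k) (suc n)) ⟩
      suc n · ((a ^ˢ suc k) (suc n) * 1/n! (suc k))        ≈⟨ ×-assoc-* (suc n) _ _ ⟨
      d (a ^ˢ suc k) n * 1/n! (suc k)                      ≈⟨ *-congʳ (d-^ a k n) ⟩
      (suc k DS.× (d a ⋆ a ^ˢ k)) n * 1/n! (suc k)         ≡⟨ ≡.cong (_* 1/n! (suc k)) (·-coeff (suc k) (d a ⋆ a ^ˢ k) n) ⟩
      (suc k · (d a ⋆ a ^ˢ k) n) * 1/n! (suc k)            ≈⟨ trans (×-assoc-* (suc k) _ _) (sym (×-comm-* (suc k) _ _)) ⟩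
      (d a ⋆ a ^ˢ k) n * (suc k · 1/n! (suc k))            ≈⟨ *-congˡ (·-1/n! k) ⟩
      (d a ⋆ a ^ˢ k) n * 1/n! k                            ≈⟨ *-comm _ _ ⟩
      1/n! k * (d a ⋆ a ^ˢ k) n                            ≈⟨ mon-⋆0 (1/n! k) (d a ⋆ a ^ˢ k) n ⟨
      (mon (1/n! k) 0 ⋆ (d a ⋆ a ^ˢ k)) n                  ≈⟨ ⋆-comm (mon (1/n! k) 0) (d a ⋆ a ^ˢ k) n ⟩
      ((d a ⋆ a ^ˢ k) ⋆ mon (1/n! k) 0) n                  ≈⟨ ⋆-assoc (d a) (a ^ˢ k) (mon (1/n! k) 0) n ⟩
      (d a ⋆ (a ^ˢ k ⋆ mon (1/n! k) 0)) n                  ≈⟨ ⋆-cong (S.refl {d a}) (⋆-cong (S.refl {a ^ˢ k}) (1/n!-mon k)) n ⟨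
      (d a ⋆ expˢ a k) n                                   ∎

    expˢ-zero : ∀ a → expˢ a 0 ≋ 1ˢ
    expˢ-zero a = ⋆-identityˡ 1ˢ

  -- With a = `shift c`, the derivative of aᵏ⁺¹/(k+1)! is a′ aᵏ/k!, so termwise differentiation only
  -- moves the index k, and a′ has the coefficients (i+1) c_i.
  logDerivative-exp∘shift : ∀ c → IsLogDerivative (λ i → suc i · c i) (exp∘shift c)
  logDerivative-exp∘shift c n = begin
    suc n · ∑< (suc (suc n)) (λ k → e k (suc n))
      ≈⟨ ·-∑ (suc n) (upTo (suc (suc n))) _ ⟩
    ∑< (suc (suc n)) (λ k → d (e k) n)
      ≡⟨ ∑<-suc (suc n) (λ k → d (e k) n) ⟩
    d (e 0) n + ∑< (suc n) (λ k → d (e (suc k)) n)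
      ≈⟨ +-cong (trans (d-cong (expˢ-zero (shift c)) n) (trans (logDerivative-1 n) (⋆-zeroˡ 1ˢ n)))
                (∑-cong (upTo (suc n)) (λ k → d-expˢ (shift c) k n)) ⟩
    0# + ∑< (suc n) (λ k → (d (shift c) ⋆ e k) n)
      ≈⟨ +-identityˡ _ ⟩
    ∑< (suc n) (λ k → (d (shift c) ⋆ e k) n)
      ≡⟨ ∑-coeff (upTo (suc n)) (λ k → d (shift c) ⋆ e k) n ⟨
    ΣS.∑< (suc n) (λ k → d (shift c) ⋆ e k) n
      ≈⟨ ΣS.∑-*ˡ (d (shift c)) (upTo (suc n)) e n ⟨
    (d (shift c) ⋆ ΣS.∑< (suc n) e) n
      ≈⟨ ⋆-cong≤ n (λ i _ → ×-congʳ (suc i) (shift-suc c i))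
           (λ i i≤n → trans (reflexive (∑-coeff (upTo (suc n)) e i)) (exp∘shift-extend c n i i≤n)) ⟩
    ((λ i → suc i · c i) ⋆ exp∘shift c) n ∎
    where
    e : ℕ → Series
    e = expˢ (shift c)
    ·-∑ : ∀ {A : Set} m (xs : List A) f → m · ∑ xs f ≈ ∑ xs (λ x → m · f x)
    ·-∑ m []       f = ·-0 m
    ·-∑ m (x ∷ xs) f = trans (×-distrib-+ _ _ m) (+-congˡ (·-∑ m xs f))
      where open Algebra.Properties.CommutativeMonoid.Mult +-commutativeMonoid using (×-distrib-+)

  -- The term k = 0 is the series 1 and drops out for n ≥ 1, which is why the Bell sums start at k =
  -- 1. The factor rᵏ comes out of the k-th power; it will be (-1)ᵏ.
  exp∘shift-bell : ∀ r c n → 1 ℕ.≤ n →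
    exp∘shift (λ i → r * c i) n ≈ ∑< n (λ k → r ^ suc k * bellSum c n (suc k))
  exp∘shift-bell r c n@(suc _) _ = begin
    ∑< (suc n) (λ k → e k n)                        ≡⟨ ∑<-suc n (λ k → e k n) ⟩
    e 0 n + ∑< n (λ k → e (suc k) n)                ≈⟨ +-congʳ (expˢ-zero (shift (λ i → r * c i)) n) ⟩
    0# + ∑< n (λ k → e (suc k) n)                   ≈⟨ +-identityˡ _ ⟩
    ∑< n (λ k → e (suc k) n)                        ≈⟨ ∑<-cong n (λ k k<n → trans (*-congˡ (bellSum-expˢ c n (suc k) k<n)) (expˢ-scale r c (suc k) n)) ⟨
    ∑< n (λ k → r ^ suc k * bellSum c n (suc k))    ∎
    where
    e : ℕ → Series
    e = expˢ (shift (λ i → r * c i))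

  exp∘shift-zero : ∀ c → exp∘shift c 0 ≈ 1#
  exp∘shift-zero c = trans (+-identityʳ _) (expˢ-zero (shift c) 0)

-- Limits

eventually-× : ∀ {P Q : ℕ → Set} → Eventually P → Eventually Q → Eventually (λ n → P n × Q n)
eventually-× (M , hM) (N , hN) = M ℕ.⊔ N , λ n le →
  hM n (ℕ.≤-trans (ℕ.m≤m⊔n M N) le) , hN n (ℕ.≤-trans (ℕ.m≤n⊔m M N) le)

eventually-map : ∀ {P Q : ℕ → Set} → (∀ n → P n → Q n) → Eventually P → Eventually Q
eventually-map f (N , h) = N , λ n le → f n (h n le)

module ℚ-Order where
  open import Data.Rational.Base using (_≤_; _<_; _+_; _*_; _-_; -_; ∣_∣; positive; nonNegative)

  0≤*0≤ : ∀ {p q} → 0ℚ ≤ p → 0ℚ ≤ q → 0ℚ ≤ p * q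
  0≤*0≤ {p} {q} 0≤p 0≤q =
    ℚ.nonNegative⁻¹ _ {{ℚ.nonNeg*nonNeg⇒nonNeg p {{nonNegative 0≤p}} q {{nonNegative 0≤q}}}}

  0<*0< : ∀ {p q} → 0ℚ < p → 0ℚ < q → 0ℚ < p * q
  0<*0< {p} {q} 0<p 0<q = ℚ.positive⁻¹ _ {{ℚ.pos*pos⇒pos p {{positive 0<p}} q {{positive 0<q}}}}

  0≤+0≤ : ∀ {p q} → 0ℚ ≤ p → 0ℚ ≤ q → 0ℚ ≤ p + q
  0≤+0≤ 0≤p 0≤q = ℚ.≤-trans (ℚ.≤-reflexive (≡.sym (ℚ.+-identityˡ 0ℚ))) (ℚ.+-mono-≤ 0≤p 0≤q)

  0<+0≤ : ∀ {p q} → 0ℚ < p → 0ℚ ≤ q → 0ℚ < p + q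
  0<+0≤ 0<p 0≤q = ℚ.≤-<-trans (ℚ.≤-reflexive (≡.sym (ℚ.+-identityˡ 0ℚ))) (ℚ.+-mono-<-≤ 0<p 0≤q)

  ≤-by : ∀ {p q} r → 0ℚ ≤ r → q ≡ p + r → p ≤ q
  ≤-by {p} r 0≤r q≡ = ℚ.≤-trans (ℚ.≤-reflexive (≡.sym (ℚ.+-identityʳ p)))
    (ℚ.≤-trans (ℚ.+-monoʳ-≤ p 0≤r) (ℚ.≤-reflexive (≡.sym q≡)))

  0≤- : ∀ {p q} → p ≤ q → 0ℚ ≤ q - p
  0≤- {p} {q} p≤q = ℚ.≤-trans (ℚ.≤-reflexive (≡.sym (ℚ.+-inverseʳ p))) (ℚ.+-monoˡ-≤ (- p) p≤q)

  half-pos : ∀ {ε} → 0ℚ < ε → 0ℚ < ½ * ε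
  half-pos = 0<*0< (ℚ.positive⁻¹ ½)

  half+half : ∀ ε → ½ * ε + ½ * ε ≡ ε
  half+half ε = ≡.trans (≡.sym (ℚ.*-distribʳ-+ ε ½ ½)) (ℚ.*-identityˡ ε)

  divide : ∀ {B} ε → 0ℚ < B → 0ℚ < ε → ∃ λ δ → 0ℚ < δ × B * δ ≡ ε
  divide {B} ε 0<B 0<ε = 1/B * ε
    , 0<*0< (ℚ.positive⁻¹ 1/B {{ℚ.1/pos⇒pos B {{positive 0<B}}}}) 0<ε
    , ≡.trans (≡.sym (ℚ.*-assoc B 1/B ε)) (≡.trans (≡.cong (_* ε) (ℚ.*-inverseʳ B {{B≢0}})) (ℚ.*-identityˡ ε))
    where
    B≢0 : ℚ.NonZero B
    B≢0 = ℚ.pos⇒nonZero B {{positive 0<B}}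
    1/B : ℚ
    1/B = (ℚ.1/ B) {{B≢0}}

  ∣∣≤ : ∀ {p q} → p ≤ q → - p ≤ q → ∣ p ∣ ≤ q
  ∣∣≤ {p} p≤q -p≤q with ℚ.∣p∣≡p∨∣p∣≡-p p
  ... | inj₁ eq = ℚ.≤-trans (ℚ.≤-reflexive eq) p≤q
  ... | inj₂ eq = ℚ.≤-trans (ℚ.≤-reflexive eq) -p≤q

  p≤∣p∣ : ∀ p → p ≤ ∣ p ∣
  p≤∣p∣ p with ℚ.≤-total 0ℚ p
  ... | inj₁ 0≤p = ℚ.≤-reflexive (≡.sym (ℚ.0≤p⇒∣p∣≡p 0≤p))
  ... | inj₂ p≤0 = ℚ.≤-trans p≤0 (ℚ.0≤∣p∣ p)

  -p≤∣p∣ : ∀ p → - p ≤ ∣ p ∣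
  -p≤∣p∣ p = ℚ.≤-trans (p≤∣p∣ (- p)) (ℚ.≤-reflexive (ℚ.∣-p∣≡∣p∣ p))

  *-mono-≤ : ∀ {a b c d} → 0ℚ ≤ c → 0ℚ ≤ b → a ≤ b → c ≤ d → a * c ≤ b * d
  *-mono-≤ {a} {b} {c} {d} 0≤c 0≤b a≤b c≤d = ℚ.≤-trans
    (ℚ.*-monoʳ-≤-nonNeg c {{nonNegative 0≤c}} a≤b)
    (ℚ.*-monoˡ-≤-nonNeg b {{nonNegative 0≤b}} c≤d)

  product≤ : ∀ {B ε δ} p q → 0ℚ < B → B * δ ≡ ε → ∣ p ∣ ≤ B → ∣ q ∣ ≤ δ → ∣ p * q ∣ ≤ ε
  product≤ p q 0<B eq hp hq = ℚ.≤-trans (ℚ.≤-reflexive (ℚ.∣p*q∣≡∣p∣*∣q∣ p q))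
    (ℚ.≤-trans (*-mono-≤ (ℚ.0≤∣p∣ q) (ℚ.<⇒≤ 0<B) hp hq) (ℚ.≤-reflexive eq))

  0≤square : ∀ p → 0ℚ ≤ p * p
  0≤square p with ℚ.≤-total 0ℚ p
  ... | inj₁ 0≤p = 0≤*0≤ 0≤p 0≤p
  ... | inj₂ p≤0 = ℚ.≤-trans (0≤*0≤ 0≤-p 0≤-p) (ℚ.≤-reflexive (ℚS.solve 1 (λ p → ℚS.:- p ℚS.:* ℚS.:- p ℚS.:= p ℚS.:* p) ≡.refl p))
    where
    module ℚS = +-*-Solver
    0≤-p : 0ℚ ≤ - p
    0≤-p = ℚ.neg-antimono-≤ p≤0

  minimum : ∀ {p q} → 0ℚ < p → 0ℚ < q → ∃ λ r → 0ℚ < r × r ≤ p × r ≤ q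
  minimum {p} {q} 0<p 0<q with ℚ.≤-total p q
  ... | inj₁ p≤q = p , 0<p , ℚ.≤-refl , p≤q
  ... | inj₂ q≤p = q , 0<q , q≤p , ℚ.≤-refl

-- Common ground of ℝ and ℂ; the homomorphism `ι` provides a ring solver with rational constants.
record ℚ-Algebra : Set₁ where
  field
    commutativeRing : CommutativeRing 0ℓ 0ℓ
  open CommutativeRing commutativeRing public
  field
    ι     : ℚ → Carrier
    ι-0   : ι 0ℚ ≈ 0#
    ι-1   : ι 1ℚ ≈ 1#
    ι-+   : ∀ p q → ι (p ℚ.+ q) ≈ ι p + ι q
    ι-*   : ∀ p q → ι (p ℚ.* q) ≈ ι p * ι q
    ι-neg : ∀ p → ι (ℚ.- p) ≈ - ι p

  private
    ι-morphism : ℚ.+-*-rawRing -Raw-AlmostCommutative⟶ fromCommutativeRing commutativeRing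
    ι-morphism = record
      { ⟦_⟧ = ι ; +-homo = ι-+ ; *-homo = ι-* ; -‿homo = ι-neg ; 0-homo = ι-0 ; 1-homo = ι-1 }

    ι-≟ : ∀ p q → Maybe (ι p ≈ ι q)
    ι-≟ p q = Maybe.map (λ p≡q → reflexive (≡.cong ι p≡q)) (dec⇒maybe (p ℚ.≟ q))

  module Solver = Algebra.Solver.Ring ℚ.+-*-rawRing (fromCommutativeRing commutativeRing) ι-morphism ι-≟

record ArchimedeanRing : Set₁ where
  infix 4 _≤_
  field
    ℚ-algebra : ℚ-Algebra
  open ℚ-Algebra ℚ-algebra public
  field
    _≤_         : Carrier → Carrier → Set
    ∣_∣         : Carrier → Carrier
    ≤-reflexive : ∀ {x y} → x ≈ y → x ≤ y
    ≤-trans     : ∀ {x y z} → x ≤ y → y ≤ z → x ≤ z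
    ≤-antisym   : ∀ {x y} → x ≤ y → y ≤ x → x ≈ y
    +-mono-≤    : ∀ {x y z w} → x ≤ y → z ≤ w → x + z ≤ y + w
    0≤*0≤       : ∀ {x y} → 0# ≤ x → 0# ≤ y → 0# ≤ x * y
    0≤x²        : ∀ x → 0# ≤ x * x
    ∣∣-cong     : ∀ {x y} → x ≈ y → ∣ x ∣ ≈ ∣ y ∣
    ∣x+y∣≤      : ∀ x y → ∣ x + y ∣ ≤ ∣ x ∣ + ∣ y ∣
    ∣x*y∣≈      : ∀ x y → ∣ x * y ∣ ≈ ∣ x ∣ * ∣ y ∣
    x≤∣x∣       : ∀ x → x ≤ ∣ x ∣
    ∣-x∣≈       : ∀ x → ∣ - x ∣ ≈ ∣ x ∣
    ∣∣≤         : ∀ {x y} → x ≤ y → - x ≤ y → ∣ x ∣ ≤ y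
    0≤∣x∣       : ∀ x → 0# ≤ ∣ x ∣
    ι-mono      : ∀ {p q} → p ℚ.≤ q → ι p ≤ ι q
    bounded     : ∀ x → ∃ λ B → 0ℚ ℚ.< B × ∣ x ∣ ≤ ι B
    ≤-closed    : ∀ {x y} → (∀ ε → 0ℚ ℚ.< ε → x ≤ y + ι ε) → x ≤ y

-- The properties of convergence that are used in ℂ, where convergence is meant for real and
-- imaginary parts.
record LimitRing : Set₁ where
  infix 4 _⟶_
  field
    ℚ-algebra : ℚ-Algebra
  open ℚ-Algebra ℚ-algebra public
  field
    _⟶_      : (ℕ → Carrier) → Carrier → Set
    lim-cong : ∀ {s t l m} → (∀ n → s n ≈ t n) → l ≈ m → s ⟶ l → t ⟶ m
    lim-const : ∀ l → (λ _ → l) ⟶ l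
    lim-+    : ∀ {s t l m} → s ⟶ l → t ⟶ m → (λ n → s n + t n) ⟶ l + m
    lim-*    : ∀ {s t l m} → s ⟶ l → t ⟶ m → (λ n → s n * t n) ⟶ l * m
    lim-suc  : ∀ {s l} → (λ n → s (suc n)) ⟶ l → s ⟶ l
    lim-interleave : ∀ q .{{_ : ℕ.NonZero q}} {s l} →
      (∀ r → r ℕ.< q → (λ m → s (r ℕ.+ m ℕ.* q)) ⟶ l) → s ⟶ l

module Limits (A : ArchimedeanRing) where
  open ArchimedeanRing A
  open Solver
  open ℚ-Order using (half-pos; half+half; divide; minimum)

  infix 4 _⟶_
  _⟶_ : (ℕ → Carrier) → Carrier → Set
  s ⟶ l = ∀ ε → 0ℚ ℚ.< ε → Eventually λ n → ∣ s n - l ∣ ≤ ι ε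

  ≤-refl : ∀ {x} → x ≤ x
  ≤-refl = ≤-reflexive refl

  ≤-respˡ : ∀ {x y z} → x ≈ y → x ≤ z → y ≤ z
  ≤-respˡ x≈y = ≤-trans (≤-reflexive (sym x≈y))

  ≤-respʳ : ∀ {x y z} → x ≈ y → z ≤ x → z ≤ y
  ≤-respʳ x≈y z≤x = ≤-trans z≤x (≤-reflexive x≈y)

  ≤-by : ∀ {x y} z → 0# ≤ z → y ≈ x + z → x ≤ y
  ≤-by z 0≤z y≈ = ≤-respˡ (+-identityʳ _) (≤-respʳ (sym y≈) (+-mono-≤ ≤-refl 0≤z))

  0≤- : ∀ {x y} → x ≤ y → 0# ≤ y - x
  0≤- {x} x≤y = ≤-respˡ (-‿inverseʳ x) (+-mono-≤ x≤y ≤-refl)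

  0≤+0≤ : ∀ {x y} → 0# ≤ x → 0# ≤ y → 0# ≤ x + y
  0≤+0≤ 0≤x 0≤y = ≤-respˡ (+-identityˡ 0#) (+-mono-≤ 0≤x 0≤y)

  0≤ι : ∀ {p} → 0ℚ ℚ.≤ p → 0# ≤ ι p
  0≤ι 0≤p = ≤-respˡ ι-0 (ι-mono 0≤p)

  *-monoˡ-≤ : ∀ {x y z} → 0# ≤ z → x ≤ y → z * x ≤ z * y
  *-monoˡ-≤ {x} {y} {z} 0≤z x≤y = ≤-by (z * (y - x)) (0≤*0≤ 0≤z (0≤- x≤y))
    (solve 3 (λ x y z → z :* y := z :* x :+ z :* (y :- x)) refl x y z)

  *-mono-≤ : ∀ {a b c d} → 0# ≤ c → 0# ≤ b → a ≤ b → c ≤ d → a * c ≤ b * d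
  *-mono-≤ {a} {b} {c} {d} 0≤c 0≤b a≤b c≤d =
    ≤-by (c * (b - a) + b * (d - c)) (0≤+0≤ (0≤*0≤ 0≤c (0≤- a≤b)) (0≤*0≤ 0≤b (0≤- c≤d)))
      (solve 4 (λ a b c d → b :* d := a :* c :+ (c :* (b :- a) :+ b :* (d :- c))) refl a b c d)

  -x≤∣x∣ : ∀ x → - x ≤ ∣ x ∣
  -x≤∣x∣ x = ≤-respʳ (∣-x∣≈ x) (x≤∣x∣ (- x))

  ι-cancel-* : ∀ {k} → 0ℚ ℚ.< k → ∀ {x y} → ι k * x ≤ ι k * y → x ≤ y
  ι-cancel-* {k} 0<k {x} {y} kx≤ky with divide 1ℚ 0<k (ℚ.positive⁻¹ 1ℚ)
  ... | k⁻¹ , 0<k⁻¹ , eq = ≤-respˡ (cancel x) (≤-respʳ (cancel y) (*-monoˡ-≤ (0≤ι (ℚ.<⇒≤ 0<k⁻¹)) kx≤ky))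
    where
    cancel : ∀ x → ι k⁻¹ * (ι k * x) ≈ x
    cancel x = trans (solve 3 (λ a b x → a :* (b :* x) := b :* a :* x) refl (ι k⁻¹) (ι k) x)
      (trans (*-congʳ (trans (sym (ι-* k k⁻¹)) (trans (reflexive (≡.cong ι eq)) ι-1))) (*-identityˡ x))

  private
    ε-split : ∀ ε → ι (½ ℚ.* ε) + ι (½ ℚ.* ε) ≈ ι ε
    ε-split ε = trans (sym (ι-+ _ _)) (reflexive (≡.cong ι (half+half ε)))

  lim-eventually : ∀ {s t l m} → Eventually (λ n → s n ≈ t n) → l ≈ m → s ⟶ l → t ⟶ m
  lim-eventually s≈t l≈m s⟶l ε 0<ε = eventually-map
    (λ n (s≈t , h) → ≤-respˡ (∣∣-cong (+-cong s≈t (-‿cong l≈m))) h)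
    (eventually-× s≈t (s⟶l ε 0<ε))

  lim-cong : ∀ {s t l m} → (∀ n → s n ≈ t n) → l ≈ m → s ⟶ l → t ⟶ m
  lim-cong s≈t = lim-eventually (0 , λ n _ → s≈t n)

  private
    ∣0∣≤ : ∀ {x ε} → x ≈ 0# → 0ℚ ℚ.< ε → ∣ x ∣ ≤ ι ε
    ∣0∣≤ x≈0 0<ε = ∣∣≤ (≤-respˡ (sym x≈0) (0≤ι (ℚ.<⇒≤ 0<ε)))
      (≤-respˡ (trans (solve 0 (con 0ℚ := :- con 0ℚ) refl) (-‿cong (trans ι-0 (sym x≈0)))) (ι-mono (ℚ.<⇒≤ 0<ε)))

  lim-const : ∀ l → (λ _ → l) ⟶ l
  lim-const l ε 0<ε = 0 , λ _ _ → ∣0∣≤ (-‿inverseʳ l) 0<ε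

  lim-+ : ∀ {s t l m} → s ⟶ l → t ⟶ m → (λ n → s n + t n) ⟶ l + m
  lim-+ {s} {t} {l} {m} s⟶l t⟶m ε 0<ε = eventually-map
    (λ n (hs , ht) → ≤-respˡ (∣∣-cong
        (solve 4 (λ s t l m → (s :- l) :+ (t :- m) := (s :+ t) :- (l :+ m)) refl (s n) (t n) l m))
      (≤-trans (∣x+y∣≤ _ _) (≤-respʳ (ε-split ε) (+-mono-≤ hs ht))))
    (eventually-× (s⟶l _ (half-pos 0<ε)) (t⟶m _ (half-pos 0<ε)))

  lim-* : ∀ {s t l m} → s ⟶ l → t ⟶ m → (λ n → s n * t n) ⟶ l * m
  lim-* {s} {t} {l} {m} s⟶l t⟶m ε 0<ε =
    let B , 0<B , l≤B = bounded l
        C , 0<C , m≤C = bounded m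
        0<1+B = ℚ-Order.0<+0≤ (ℚ.positive⁻¹ 1ℚ) (ℚ.<⇒≤ 0<B)
        δ , 0<δ , Bδ = divide (½ ℚ.* ε) 0<1+B (half-pos 0<ε)
        η , 0<η , Cη = divide (½ ℚ.* ε) 0<C (half-pos 0<ε)
    in eventually-map
      (λ n (h₁ , hη , hδ) → ≤-respˡ (∣∣-cong
          (solve 4 (λ s t l m → s :* (t :- m) :+ m :* (s :- l) := s :* t :- l :* m) refl (s n) (t n) l m))
        (≤-trans (∣x+y∣≤ _ _) (≤-respʳ (ε-split ε) (+-mono-≤
          (estimate Bδ (0≤ι (ℚ.<⇒≤ 0<1+B)) (s≤ n l≤B h₁) hδ)
          (estimate Cη (0≤ι (ℚ.<⇒≤ 0<C)) m≤C hη)))))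
      (eventually-× (s⟶l 1ℚ (ℚ.positive⁻¹ 1ℚ)) (eventually-× (s⟶l η 0<η) (t⟶m δ 0<δ)))
    where
    estimate : ∀ {x y B δ} → B ℚ.* δ ≡ ½ ℚ.* ε → 0# ≤ ι B → ∣ x ∣ ≤ ι B → ∣ y ∣ ≤ ι δ → ∣ x * y ∣ ≤ ι (½ ℚ.* ε)
    estimate {x} {y} {B} {δ} eq 0≤B x≤B y≤δ = ≤-respˡ (sym (∣x*y∣≈ x y))
      (≤-respʳ (trans (sym (ι-* B δ)) (reflexive (≡.cong ι eq))) (*-mono-≤ (0≤∣x∣ y) 0≤B x≤B y≤δ))
    s≤ : ∀ {B} n → ∣ l ∣ ≤ ι B → ∣ s n - l ∣ ≤ ι 1ℚ → ∣ s n ∣ ≤ ι (1ℚ ℚ.+ B)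
    s≤ {B} n l≤B h = ≤-respˡ (∣∣-cong (solve 2 (λ s l → (s :- l) :+ l := s) refl (s n) l))
      (≤-trans (∣x+y∣≤ _ _) (≤-respʳ (sym (ι-+ 1ℚ B)) (+-mono-≤ h l≤B)))

  lim-neg : ∀ {s l} → s ⟶ l → (λ n → - s n) ⟶ - l
  lim-neg {s} {l} s⟶l ε 0<ε = eventually-map
    (λ n h → ≤-respˡ (trans (sym (∣-x∣≈ _)) (∣∣-cong (solve 2 (λ s l → :- (s :- l) := :- s :- :- l) refl (s n) l))) h)
    (s⟶l ε 0<ε)

  lim-≤ : ∀ {s t l m} → s ⟶ l → t ⟶ m → Eventually (λ n → s n ≤ t n) → l ≤ m
  lim-≤ {s} {t} {l} {m} s⟶l t⟶m ev = ≤-closed λ ε 0<ε →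
    let N , h = eventually-× ev (eventually-× (s⟶l _ (half-pos 0<ε)) (t⟶m _ (half-pos 0<ε)))
        s≤t , hs , ht = h N ℕ.≤-refl
        e = ι (½ ℚ.* ε)
    in ≤-respˡ (solve 2 (λ s l → s :+ (:- (s :- l)) := l) refl (s N) l)
      (≤-trans (+-mono-≤ s≤t (≤-trans (-x≤∣x∣ _) hs))
      (≤-respˡ (solve 3 (λ t m e → m :+ (t :- m) :+ e := t :+ e) refl (t N) m e)
        (≤-respʳ (trans (+-assoc m e e) (+-congˡ (ε-split ε)))
          (+-mono-≤ (+-mono-≤ ≤-refl (≤-trans (x≤∣x∣ _) ht)) ≤-refl))))

  lim-unique : ∀ {s l m} → s ⟶ l → s ⟶ m → l ≈ m
  lim-unique s⟶l s⟶m = ≤-antisym (lim-≤ s⟶l s⟶m (0 , λ _ _ → ≤-refl)) (lim-≤ s⟶m s⟶l (0 , λ _ _ → ≤-refl))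

  lim-suc : ∀ {s l} → (λ n → s (suc n)) ⟶ l → s ⟶ l
  lim-suc h ε 0<ε with h ε 0<ε
  ... | N , hN = suc N , λ { (suc n) (ℕ.s≤s le) → hN n le }

  lim-interleave : ∀ q .{{_ : ℕ.NonZero q}} {s l} →
    (∀ r → r ℕ.< q → (λ m → s (r ℕ.+ m ℕ.* q)) ⟶ l) → s ⟶ l
  -- From N₀ q on, the quotient n / q is at least N₀, the maximum of the thresholds of the q
  -- subsequences.
  lim-interleave q {s} {l} h ε 0<ε = N₀ ℕ.* q , λ n le →
    ≡.subst (λ n → ∣ s n - l ∣ ≤ ι ε) (≡.sym (ℕ.m≡m%n+[m/n]*n n q))
      (all q ℕ.≤-refl (n ℕ.% q) (ℕ.m%n<n n q) (n ℕ./ q)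
        (ℕ.≤-trans (ℕ.≤-reflexive (≡.sym (ℕ.m*n/n≡m N₀ q))) (ℕ./-monoˡ-≤ q le)))
    where
    bound : ∀ r → r ℕ.< q → ℕ
    bound r r<q = proj₁ (h r r<q ε 0<ε)
    maxBound : ∀ k → k ℕ.≤ q → ℕ
    maxBound zero        _   = 0
    maxBound (suc k) k<q = bound k k<q ℕ.⊔ maxBound k (ℕ.<⇒≤ k<q)
    N₀ : ℕ
    N₀ = maxBound q ℕ.≤-refl
    all : ∀ k (k≤q : k ℕ.≤ q) r → r ℕ.< k → ∀ m → maxBound k k≤q ℕ.≤ m → ∣ s (r ℕ.+ m ℕ.* q) - l ∣ ≤ ι ε
    all (suc k) k<q r r<1+k m le with ℕ.m≤n⇒m<n∨m≡n (ℕ.s≤s⁻¹ r<1+k)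
    ... | inj₁ r<k    = all k (ℕ.<⇒≤ k<q) r r<k m (ℕ.≤-trans (ℕ.m≤n⊔m (bound k k<q) _) le)
    ... | inj₂ ≡.refl = proj₂ (h k k<q ε 0<ε) m (ℕ.≤-trans (ℕ.m≤m⊔n (bound k k<q) _) le)

  -- The tangent inequality at h = k bounds k dₙ by Fₙ(y+k) - Fₙ(y) from above, and at h = -k it
  -- bounds it from below. For fixed k both bounds converge to increments of F, which differ from k
  -- f′ by at most k ε/2 when k is small.
  slope-limit : ∀ (F : ℚ → Carrier) f′ (Fₙ : ℚ → ℕ → Carrier) dₙ y η → 0ℚ ℚ.< η →
    (∀ ε → 0ℚ ℚ.< ε → ∃ λ δ → 0ℚ ℚ.< δ × (∀ h → ℚ.∣ h ∣ ℚ.≤ η → ℚ.∣ h ∣ ℚ.≤ δ →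
       ∣ F (y ℚ.+ h) - F y - f′ * ι h ∣ ≤ ι ε * ι ℚ.∣ h ∣)) →
    Fₙ y ⟶ F y → (∀ h → ℚ.∣ h ∣ ℚ.≤ η → Fₙ (y ℚ.+ h) ⟶ F (y ℚ.+ h)) →
    (∀ h → ℚ.∣ h ∣ ℚ.≤ η → Eventually λ n → Fₙ y n + ι h * dₙ n ≤ Fₙ (y ℚ.+ h) n) →
    dₙ ⟶ f′
  slope-limit F f′ Fₙ dₙ y η 0<η derivative Fy⟶ F⟶ tangent ε 0<ε
    with derivative (½ ℚ.* ε) (half-pos 0<ε)
  ... | δ , 0<δ , hδ with minimum 0<η 0<δ
  ... | k , 0<k , k≤η , k≤δ = eventually-map
    (λ n (up , down) → ∣∣≤
      (ι-cancel-* 0<k (≤-respʳ (ι-* k ε) up))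
      (ι-cancel-* 0<k (≤-respˡ (trans (*-congʳ (ι-neg k))
          (solve 2 (λ k x → (:- k) :* x := k :* (:- x)) refl (ι k) (dₙ n - f′))) (≤-respʳ (ι-* k ε) down))))
    (eventually-× (oneSided k (≤∣k∣ k ≡.refl)) (oneSided (ℚ.- k) (≤∣k∣ (ℚ.- k) (ℚ.∣-p∣≡∣p∣ k))))
    where
    ≤∣k∣ : ∀ h → ℚ.∣ h ∣ ≡ ℚ.∣ k ∣ → ℚ.∣ h ∣ ≡ k
    ≤∣k∣ h eq = ≡.trans eq (ℚ.0≤p⇒∣p∣≡p (ℚ.<⇒≤ 0<k))
    -- The error budget is k ε: the approximations at y and at y + h take k ε/4 each, and the
    -- derivative of F takes k ε/2.
    e : ℚ
    e = ½ ℚ.* (½ ℚ.* (k ℚ.* ε))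
    0<e : 0ℚ ℚ.< e
    0<e = half-pos (half-pos (ℚ-Order.0<*0< 0<k 0<ε))
    total : ι e + ι e + ι (½ ℚ.* ε) * ι k ≈ ι (k ℚ.* ε)
    total = trans (+-cong (sym (ι-+ e e)) (sym (ι-* (½ ℚ.* ε) k))) (trans (sym (ι-+ _ _)) (reflexive (≡.cong ι eq)))
      where
      eq : e ℚ.+ e ℚ.+ ½ ℚ.* ε ℚ.* k ≡ k ℚ.* ε
      eq = ℚS.solve 2 (λ ε k → let e = ℚS.con ½ ℚS.:* (ℚS.con ½ ℚS.:* (k ℚS.:* ε)) in
              e ℚS.:+ e ℚS.:+ ℚS.con ½ ℚS.:* ε ℚS.:* k ℚS.:= k ℚS.:* ε) ≡.refl ε k
        where module ℚS = +-*-Solver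
    oneSided : ∀ h → ℚ.∣ h ∣ ≡ k → Eventually λ n → ι h * (dₙ n - f′) ≤ ι (k ℚ.* ε)
    oneSided h ∣h∣≡k = eventually-map
      (λ n (t , lim-h , lim-0) →
        let D = F (y ℚ.+ h) - F y - f′ * ι h
            below-h = ≤-trans (x≤∣x∣ _) lim-h
            below-0 = ≤-trans (-x≤∣x∣ _) lim-0
            below-D = ≤-trans (x≤∣x∣ D) (≤-respʳ (*-congˡ (reflexive (≡.cong ι ∣h∣≡k))) (hδ h ∣h∣≤η ∣h∣≤δ))
        in ≤-respʳ total (≤-trans
          (≤-by (Fₙ (y ℚ.+ h) n - (Fₙ y n + ι h * dₙ n)) (0≤- t)
            (solve 7 (λ Fh F0 f′ h d Fnh Fn0 →
              ((Fnh :- Fh) :+ (:- (Fn0 :- F0))) :+ (Fh :- F0 :- f′ :* h)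
                := h :* (d :- f′) :+ (Fnh :- (Fn0 :+ h :* d)))
              refl (F (y ℚ.+ h)) (F y) f′ (ι h) (dₙ n) (Fₙ (y ℚ.+ h) n) (Fₙ y n)))
          (+-mono-≤ (+-mono-≤ below-h below-0) below-D)))
      (eventually-× (tangent h ∣h∣≤η) (eventually-× (F⟶ h ∣h∣≤η e 0<e) (Fy⟶ e 0<e)))
      where
      ∣h∣≤η : ℚ.∣ h ∣ ℚ.≤ η
      ∣h∣≤η = ℚ.≤-trans (ℚ.≤-reflexive ∣h∣≡k) k≤η
      ∣h∣≤δ : ℚ.∣ h ∣ ℚ.≤ δ
      ∣h∣≤δ = ℚ.≤-trans (ℚ.≤-reflexive ∣h∣≡k) k≤δ

  -- Since |u| ≤ |g u| / c, a factor bounded away from 0 may be removed from a null sequence; in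
  -- `digamma-limit` this factor is Euler's product.
  lim-cancel : ∀ {g u : ℕ → Carrier} {c} → 0ℚ ℚ.< c → Eventually (λ n → ι c ≤ g n) → (λ n → g n * u n) ⟶ 0# → u ⟶ 0#
  lim-cancel {g} {u} {c} 0<c c≤g gu⟶0 ε 0<ε = eventually-map
    (λ n (c≤ , h) → ≤-respˡ (∣∣-cong (sym (minus-0 (u n)))) (ι-cancel-* 0<c (≤-respʳ (ι-* c ε) (≤-trans
      (*-mono-≤ (0≤∣x∣ _) (0≤∣x∣ (g n)) (≤-trans c≤ (x≤∣x∣ (g n))) ≤-refl)
      (≤-respˡ (trans (∣∣-cong (minus-0 _)) (∣x*y∣≈ (g n) (u n))) h)))))
    (eventually-× c≤g (gu⟶0 (c ℚ.* ε) (ℚ-Order.0<*0< 0<c 0<ε)))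
    where
    minus-0 : ∀ x → x - 0# ≈ x
    minus-0 x = trans (+-congˡ (-‿cong (sym ι-0))) (solve 1 (λ x → x :- con 0ℚ := x) refl x)

-- The real exponential function

module Fractions where
  open ≡.≡-Reasoning

  private
    fromℚᵘ-+ : ∀ p q → ℚ.fromℚᵘ (p ℚᵘ.+ q) ≡ ℚ.fromℚᵘ p ℚ.+ ℚ.fromℚᵘ q
    fromℚᵘ-+ p q = ℚ.toℚᵘ-injective (ℚᵘ.≃-trans (ℚ.toℚᵘ-fromℚᵘ (p ℚᵘ.+ q))
      (ℚᵘ.≃-trans (ℚᵘ.+-cong (ℚᵘ.≃-sym (ℚ.toℚᵘ-fromℚᵘ p)) (ℚᵘ.≃-sym (ℚ.toℚᵘ-fromℚᵘ q)))
        (ℚᵘ.≃-sym (ℚ.toℚᵘ-homo-+ (ℚ.fromℚᵘ p) (ℚ.fromℚᵘ q)))))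

    fromℚᵘ-* : ∀ p q → ℚ.fromℚᵘ (p ℚᵘ.* q) ≡ ℚ.fromℚᵘ p ℚ.* ℚ.fromℚᵘ q
    fromℚᵘ-* p q = ℚ.toℚᵘ-injective (ℚᵘ.≃-trans (ℚ.toℚᵘ-fromℚᵘ (p ℚᵘ.* q))
      (ℚᵘ.≃-trans (ℚᵘ.*-cong (ℚᵘ.≃-sym (ℚ.toℚᵘ-fromℚᵘ p)) (ℚᵘ.≃-sym (ℚ.toℚᵘ-fromℚᵘ q)))
        (ℚᵘ.≃-sym (ℚ.toℚᵘ-homo-* (ℚ.fromℚᵘ p) (ℚ.fromℚᵘ q)))))

  fromNat : ℕ → ℚ
  fromNat n = + n / 1

  fromNat-+ : ∀ m n → fromNat (m ℕ.+ n) ≡ fromNat m ℚ.+ fromNat n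
  fromNat-+ m n = ≡.trans
    (ℚ.fromℚᵘ-cong {mkℚᵘ (+ (m ℕ.+ n)) 0} {mkℚᵘ (+ m) 0 ℚᵘ.+ mkℚᵘ (+ n) 0} (*≡* (≡.cong (ℤ._* + 1) (≡.cong₂ ℤ._+_ (≡.sym (ℤ.*-identityʳ (+ m))) (≡.sym (ℤ.*-identityʳ (+ n)))))))
    (fromℚᵘ-+ (mkℚᵘ (+ m) 0) (mkℚᵘ (+ n) 0))

  fromNat-* : ∀ m n → fromNat (m ℕ.* n) ≡ fromNat m ℚ.* fromNat n
  fromNat-* m n = ≡.trans
    (ℚ.fromℚᵘ-cong {mkℚᵘ (+ (m ℕ.* n)) 0} {mkℚᵘ (+ m) 0 ℚᵘ.* mkℚᵘ (+ n) 0} (*≡* (≡.cong (ℤ._* + 1) (ℤ.pos-* m n))))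
    (fromℚᵘ-* (mkℚᵘ (+ m) 0) (mkℚᵘ (+ n) 0))

  fromNat-suc : ∀ n → fromNat (suc n) ≡ 1ℚ ℚ.+ fromNat n
  fromNat-suc n = fromNat-+ 1 n

  0≤fromNat : ∀ n → 0ℚ ℚ.≤ fromNat n
  0≤fromNat n = ℚ.nonNegative⁻¹ _ {{ℚ.normalize-nonNeg n 1}}

  0<fromNat-suc : ∀ n → 0ℚ ℚ.< fromNat (suc n)
  0<fromNat-suc n = ℚ.positive⁻¹ _ {{ℚ.normalize-pos (suc n) 1}}

  fromNat-mono : ∀ {m n} → m ℕ.≤ n → fromNat m ℚ.≤ fromNat n
  fromNat-mono {m} {n} m≤n = ℚ-Order.≤-by (fromNat (n ℕ.∸ m)) (0≤fromNat (n ℕ.∸ m))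
    (≡.trans (≡.cong fromNat (≡.sym (ℕ.m+[n∸m]≡n m≤n))) (fromNat-+ m (n ℕ.∸ m)))

  -- The absolute value of the numerator suffices because the denominator is at least 1.
  archimedean : ∀ p → ∃ λ n → p ℚ.≤ fromNat n
  archimedean p@(ℚ.mkℚ n d _) = ℤ.∣ n ∣ , ℚ.toℚᵘ-cancel-≤ (ℚᵘ.≤-respʳ-≃
    (ℚᵘ.≃-sym (ℚ.toℚᵘ-fromℚᵘ (mkℚᵘ (+ ℤ.∣ n ∣) 0))) (*≤* (le n)))
    where
    le : ∀ n → n ℤ.* + 1 ℤ.≤ + ℤ.∣ n ∣ ℤ.* + suc d
    le (+ n)      = ≡.subst₂ ℤ._≤_ (ℤ.pos-* n 1) (ℤ.pos-* n (suc d)) (ℤ.+≤+ (ℕ.*-monoʳ-≤ n (ℕ.s≤s ℕ.z≤n)))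
    le ℤ.-[1+ n ] = ℤ.-≤+

  fromNat-*-/ : ∀ m n .{{_ : ℕ.NonZero n}} → fromNat n ℚ.* (+ m / n) ≡ fromNat m
  fromNat-*-/ m n@(suc n-1) = ≡.trans (≡.sym (fromℚᵘ-* (mkℚᵘ (+ n) 0) (mkℚᵘ (+ m) n-1)))
    (ℚ.fromℚᵘ-cong {mkℚᵘ (+ n) 0 ℚᵘ.* mkℚᵘ (+ m) n-1} {mkℚᵘ (+ m) 0} (*≡* (begin
      + n ℤ.* + m ℤ.* + 1        ≡⟨ ℤ.*-identityʳ _ ⟩
      + n ℤ.* + m                ≡⟨ ℤ.*-comm (+ n) (+ m) ⟩
      + m ℤ.* + n                ≡⟨ ≡.cong (λ k → + m ℤ.* + k) (≡.sym (ℕ.*-identityˡ n)) ⟩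
      + m ℤ.* + (1 ℕ.* n)        ∎)))

  *-cancelˡ : ∀ p {q r} → 0ℚ ℚ.< p → p ℚ.* q ≡ p ℚ.* r → q ≡ r
  *-cancelˡ p {q} {r} 0<p eq = ≡.trans (≡.sym (cancel q)) (≡.trans (≡.cong (p⁻¹ ℚ.*_) eq) (cancel r))
    where
    p⁻¹ : ℚ
    p⁻¹ = proj₁ (ℚ-Order.divide 1ℚ 0<p (ℚ.positive⁻¹ 1ℚ))
    cancel : ∀ q → p⁻¹ ℚ.* (p ℚ.* q) ≡ q
    cancel q = ≡.trans (≡.sym (ℚ.*-assoc p⁻¹ p q)) (≡.trans (≡.cong (ℚ._* q)
      (≡.trans (ℚ.*-comm p⁻¹ p) (proj₂ (proj₂ (ℚ-Order.divide 1ℚ 0<p (ℚ.positive⁻¹ 1ℚ)))))) (ℚ.*-identityˡ q))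

  abstract
    1/suc : ℕ → ℚ
    1/suc n = + 1 / suc n

    1/suc≡ : ∀ n → 1/suc n ≡ + 1 / suc n
    1/suc≡ n = ≡.refl

    0<1/suc : ∀ n → 0ℚ ℚ.< 1/suc n
    0<1/suc n = ℚ.positive⁻¹ _ {{ℚ.normalize-pos 1 (suc n)}}

    fromNat-*-1/suc : ∀ n → fromNat (suc n) ℚ.* 1/suc n ≡ 1ℚ
    fromNat-*-1/suc n = fromNat-*-/ 1 (suc n)

  1/suc≤1 : ∀ n → 1/suc n ℚ.≤ 1ℚ
  1/suc≤1 n = ℚ-Order.≤-by (fromNat n ℚ.* 1/suc n) (ℚ-Order.0≤*0≤ (0≤fromNat n) (ℚ.<⇒≤ (0<1/suc n))) (begin
    1ℚ                                   ≡⟨ fromNat-*-1/suc n ⟨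
    fromNat (suc n) ℚ.* 1/suc n          ≡⟨ ≡.cong (ℚ._* 1/suc n) (fromNat-suc n) ⟩
    (1ℚ ℚ.+ fromNat n) ℚ.* 1/suc n       ≡⟨ ℚS.solve 2 (λ m p → (ℚS.con 1ℚ ℚS.:+ m) ℚS.:* p ℚS.:= p ℚS.:+ m ℚS.:* p) ≡.refl (fromNat n) (1/suc n) ⟩
    1/suc n ℚ.+ fromNat n ℚ.* 1/suc n    ∎)
    where module ℚS = +-*-Solver

  ℚ-semiring : CommutativeSemiring _ _
  ℚ-semiring = CommutativeRing.commutativeSemiring ℚ.+-*-commutativeRing

  open RawSemiringDefs (CommutativeSemiring.rawSemiring ℚ-semiring) public using () renaming (_×_ to _·_; _^_ to _^_)

  0≤^ : ∀ {a} n → 0ℚ ℚ.≤ a → 0ℚ ℚ.≤ a ^ n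
  0≤^ zero    0≤a = ℚ.nonNegative⁻¹ 1ℚ
  0≤^ (suc n) 0≤a = ℚ-Order.0≤*0≤ 0≤a (0≤^ n 0≤a)

  ·-fromNat : ∀ n p → n · p ≡ fromNat n ℚ.* p
  ·-fromNat zero    p = ≡.sym (ℚ.*-zeroˡ p)
  ·-fromNat (suc n) p = begin
    p ℚ.+ n · p                    ≡⟨ ≡.cong (p ℚ.+_) (·-fromNat n p) ⟩
    p ℚ.+ fromNat n ℚ.* p          ≡⟨ ≡.cong (ℚ._+ fromNat n ℚ.* p) (ℚ.*-identityˡ p) ⟨
    1ℚ ℚ.* p ℚ.+ fromNat n ℚ.* p   ≡⟨ ℚ.*-distribʳ-+ p 1ℚ (fromNat n) ⟨
    (1ℚ ℚ.+ fromNat n) ℚ.* p       ≡⟨ ≡.cong (ℚ._* p) (fromNat-suc n) ⟨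
    fromNat (suc n) ℚ.* p          ∎

  ·-1/suc : ∀ n → suc n · 1/suc n ≡ 1ℚ
  ·-1/suc n = ≡.trans (·-fromNat (suc n) (1/suc n)) (fromNat-*-1/suc n)

  fromNat-*-1/fact : ∀ n → fromNat (n !) ℚ.* 1/fact n ≡ 1ℚ
  fromNat-*-1/fact n = fromNat-*-/ 1 (n !) {{ℕ._!≢0 n}}

  1/fact-suc : ∀ n → 1/suc n ℚ.* 1/fact n ≡ 1/fact (suc n)
  1/fact-suc n = *-cancelˡ (fromNat (suc n !)) (ℚ.positive⁻¹ _ {{ℚ.normalize-pos (suc n !) 1 {{_}} {{ℕ._!≢0 (suc n)}}}}) (begin
    fromNat (suc n !) ℚ.* (1/suc n ℚ.* 1/fact n)
      ≡⟨ ≡.cong (ℚ._* (1/suc n ℚ.* 1/fact n)) (fromNat-* (suc n) (n !)) ⟩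
    fromNat (suc n) ℚ.* fromNat (n !) ℚ.* (1/suc n ℚ.* 1/fact n)
      ≡⟨ ℚS.solve 4 (λ a b c d → a ℚS.:* b ℚS.:* (c ℚS.:* d) ℚS.:= a ℚS.:* c ℚS.:* (b ℚS.:* d)) ≡.refl (fromNat (suc n)) (fromNat (n !)) (1/suc n) (1/fact n) ⟩
    fromNat (suc n) ℚ.* 1/suc n ℚ.* (fromNat (n !) ℚ.* 1/fact n)
      ≡⟨ ≡.cong₂ ℚ._*_ (fromNat-*-1/suc n) (fromNat-*-1/fact n) ⟩
    1ℚ ℚ.* 1ℚ
      ≡⟨ fromNat-*-1/fact (suc n) ⟨
    fromNat (suc n !) ℚ.* 1/fact (suc n) ∎)
    where module ℚS = +-*-Solver

-- Cauchy reals as an ordered ring with absolute value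

module RealRing where
  open ℚ-Order
  open ℚ.≤-Reasoning
  module ℚS = +-*-Solver
  open ℚS using (_:+_; _:*_; _:-_; :-_; _:=_)

  pointwise : ∀ {x y} → (∀ n → seq x n ≡ seq y n) → x ≈ʳ y
  pointwise {x} {y} eq ε 0<ε = 0 , λ n _ → ℚ.≤-trans
    (ℚ.≤-reflexive (≡.cong ℚ.∣_∣ (≡.trans (≡.cong (ℚ._- seq y n) (eq n)) (ℚ.+-inverseʳ (seq y n)))))
    (ℚ.<⇒≤ 0<ε)

  ≤-pointwise : ∀ {x y} → (∀ n → seq x n ℚ.≤ seq y n) → x ≤ʳ y
  ≤-pointwise {x} {y} le ε 0<ε = 0 , λ n _ → ≤-by (seq y n ℚ.- seq x n ℚ.+ ε)
    (0≤+0≤ (0≤- (le n)) (ℚ.<⇒≤ 0<ε))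
    (ℚS.solve 3 (λ x y e → y :+ e := x :+ (y :- x :+ e)) ≡.refl (seq x n) (seq y n) ε)

  flip : ∀ p q → ℚ.∣ p ℚ.- q ∣ ≡ ℚ.∣ q ℚ.- p ∣
  flip p q = ≡.trans (≡.sym (ℚ.∣-p∣≡∣p∣ (p ℚ.- q)))
    (≡.cong ℚ.∣_∣ (ℚS.solve 2 (λ p q → :- (p :- q) := q :- p) ≡.refl p q))

  halves : ∀ {p q r ε} → r ≡ p ℚ.+ q → ℚ.∣ p ∣ ℚ.≤ ½ ℚ.* ε → ℚ.∣ q ∣ ℚ.≤ ½ ℚ.* ε → ℚ.∣ r ∣ ℚ.≤ ε
  halves {p} {q} {r} {ε} eq hp hq = begin
    ℚ.∣ r ∣                    ≡⟨ ≡.cong ℚ.∣_∣ eq ⟩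
    ℚ.∣ p ℚ.+ q ∣              ≤⟨ ℚ.∣p+q∣≤∣p∣+∣q∣ p q ⟩
    ℚ.∣ p ∣ ℚ.+ ℚ.∣ q ∣        ≤⟨ ℚ.+-mono-≤ hp hq ⟩
    ½ ℚ.* ε ℚ.+ ½ ℚ.* ε        ≡⟨ half+half ε ⟩
    ε                          ∎

  ≈-sym : ∀ {x y} → x ≈ʳ y → y ≈ʳ x
  ≈-sym {x} {y} h ε 0<ε = eventually-map (λ n → ℚ.≤-trans (ℚ.≤-reflexive (flip (seq y n) (seq x n)))) (h ε 0<ε)

  ≈-trans : ∀ {x y z} → x ≈ʳ y → y ≈ʳ z → x ≈ʳ z
  ≈-trans {x} {y} {z} h k ε 0<ε = eventually-map
    (λ n (hn , kn) → halves (ℚS.solve 3 (λ x y z → x :- z := (x :- y) :+ (y :- z)) ≡.refl (seq x n) (seq y n) (seq z n)) hn kn)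
    (eventually-× (h _ (half-pos 0<ε)) (k _ (half-pos 0<ε)))

  +-cong : ∀ {x x′ y y′} → x ≈ʳ x′ → y ≈ʳ y′ → x +ʳ y ≈ʳ x′ +ʳ y′
  +-cong {x} {x′} {y} {y′} h k ε 0<ε = eventually-map
    (λ n (hn , kn) → halves (ℚS.solve 4 (λ x x′ y y′ → (x :+ y) :- (x′ :+ y′) := (x :- x′) :+ (y :- y′)) ≡.refl
      (seq x n) (seq x′ n) (seq y n) (seq y′ n)) hn kn)
    (eventually-× (h _ (half-pos 0<ε)) (k _ (half-pos 0<ε)))

  neg-cong : ∀ {x y} → x ≈ʳ y → -ʳ x ≈ʳ -ʳ y
  neg-cong {x} {y} h ε 0<ε = eventually-map
    (λ n → ℚ.≤-trans (ℚ.≤-reflexive (≡.trans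
      (≡.cong ℚ.∣_∣ (ℚS.solve 2 (λ x y → :- x :- :- y := y :- x) ≡.refl (seq x n) (seq y n))) (flip (seq y n) (seq x n)))))
    (h ε 0<ε)

  bounded : ∀ x → ∃ λ B → 0ℚ ℚ.< B × Eventually λ n → ℚ.∣ seq x n ∣ ℚ.≤ B
  bounded x with cauchy x 1ℚ (ℚ.positive⁻¹ 1ℚ)
  ... | N , hN = 1ℚ ℚ.+ ℚ.∣ seq x N ∣ , 0<+0≤ (ℚ.positive⁻¹ 1ℚ) (ℚ.0≤∣p∣ (seq x N)) , N , λ n Nn → begin
    ℚ.∣ seq x n ∣
      ≡⟨ ≡.cong ℚ.∣_∣ (ℚS.solve 2 (λ a b → a := (a :- b) :+ b) ≡.refl (seq x n) (seq x N)) ⟩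
    ℚ.∣ (seq x n ℚ.- seq x N) ℚ.+ seq x N ∣
      ≤⟨ ℚ.∣p+q∣≤∣p∣+∣q∣ (seq x n ℚ.- seq x N) (seq x N) ⟩
    ℚ.∣ seq x n ℚ.- seq x N ∣ ℚ.+ ℚ.∣ seq x N ∣
      ≤⟨ ℚ.+-monoˡ-≤ ℚ.∣ seq x N ∣ (hN n N Nn ℕ.≤-refl) ⟩
    1ℚ ℚ.+ ℚ.∣ seq x N ∣ ∎

  *-cong : ∀ {x x′ y y′} → x ≈ʳ x′ → y ≈ʳ y′ → x *ʳ y ≈ʳ x′ *ʳ y′
  *-cong {x} {x′} {y} {y′} h k ε 0<ε =
    let B , 0<B , hB = bounded x
        C , 0<C , hC = bounded y′
        δ , 0<δ , Bδ = divide (½ ℚ.* ε) 0<B (half-pos 0<ε)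
        η , 0<η , Cη = divide (½ ℚ.* ε) 0<C (half-pos 0<ε)
    in eventually-map
      (λ n ((xB , yC) , (hn , kn)) → halves
        (ℚS.solve 4 (λ x x′ y y′ → x :* y :- x′ :* y′ := x :* (y :- y′) :+ y′ :* (x :- x′)) ≡.refl
          (seq x n) (seq x′ n) (seq y n) (seq y′ n))
        (product≤ (seq x n) (seq y n ℚ.- seq y′ n) 0<B Bδ xB kn)
        (product≤ (seq y′ n) (seq x n ℚ.- seq x′ n) 0<C Cη yC hn))
      (eventually-× (eventually-× hB hC) (eventually-× (h η 0<η) (k δ 0<δ)))

  commutativeRing : CommutativeRing 0ℓ 0ℓ
  commutativeRing = record
    { Carrier = ℝ ; _≈_ = _≈ʳ_ ; _+_ = _+ʳ_ ; _*_ = _*ʳ_ ; -_ = -ʳ_ ; 0# = 0ʳ ; 1# = 1ʳ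
    ; isCommutativeRing = record
      { isRing = record
        { +-isAbelianGroup = record
          { isGroup = record
            { isMonoid = record
              { isSemigroup = record
                { isMagma = record
                  { isEquivalence = record
                    { refl = λ {x} → pointwise {x} {x} λ n → ≡.refl
                    ; sym = λ {x} {y} → ≈-sym {x} {y}
                    ; trans = λ {x} {y} {z} → ≈-trans {x} {y} {z} }
                  ; ∙-cong = λ {x} {x′} {y} {y′} → +-cong {x} {x′} {y} {y′} }
                ; assoc = λ x y z → pointwise {x +ʳ y +ʳ z} {x +ʳ (y +ʳ z)} λ n → ℚ.+-assoc (seq x n) (seq y n) (seq z n) }
              ; identity = (λ x → pointwise {0ʳ +ʳ x} {x} λ n → ℚ.+-identityˡ (seq x n))
                         , (λ x → pointwise {x +ʳ 0ʳ} {x} λ n → ℚ.+-identityʳ (seq x n)) }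
            ; inverse = (λ x → pointwise { -ʳ x +ʳ x} {0ʳ} λ n → ℚ.+-inverseˡ (seq x n))
                      , (λ x → pointwise {x +ʳ -ʳ x} {0ʳ} λ n → ℚ.+-inverseʳ (seq x n))
            ; ⁻¹-cong = λ {x} {y} → neg-cong {x} {y} }
          ; comm = λ x y → pointwise {x +ʳ y} {y +ʳ x} λ n → ℚ.+-comm (seq x n) (seq y n) }
        ; *-cong = λ {x} {x′} {y} {y′} → *-cong {x} {x′} {y} {y′}
        ; *-assoc = λ x y z → pointwise {x *ʳ y *ʳ z} {x *ʳ (y *ʳ z)} λ n → ℚ.*-assoc (seq x n) (seq y n) (seq z n)
        ; *-identity = (λ x → pointwise {1ʳ *ʳ x} {x} λ n → ℚ.*-identityˡ (seq x n))
                     , (λ x → pointwise {x *ʳ 1ʳ} {x} λ n → ℚ.*-identityʳ (seq x n))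
        ; distrib = (λ x y z → pointwise {x *ʳ (y +ʳ z)} {x *ʳ y +ʳ x *ʳ z} λ n → ℚ.*-distribˡ-+ (seq x n) (seq y n) (seq z n))
                  , (λ x y z → pointwise {(y +ʳ z) *ʳ x} {y *ʳ x +ʳ z *ʳ x} λ n → ℚ.*-distribʳ-+ (seq x n) (seq y n) (seq z n)) }
      ; *-comm = λ x y → pointwise {x *ʳ y} {y *ʳ x} λ n → ℚ.*-comm (seq x n) (seq y n) } }

  ≤-reflexive : ∀ {x y} → x ≈ʳ y → x ≤ʳ y
  ≤-reflexive {x} {y} h ε 0<ε = eventually-map
    (λ n hn → ≤-by (ε ℚ.- (seq x n ℚ.- seq y n)) (0≤- (ℚ.≤-trans (p≤∣p∣ _) hn))
      (ℚS.solve 3 (λ x y e → y :+ e := x :+ (e :- (x :- y))) ≡.refl (seq x n) (seq y n) ε)) (h ε 0<ε)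

  ≤-trans : ∀ {x y z} → x ≤ʳ y → y ≤ʳ z → x ≤ʳ z
  ≤-trans {x} {y} {z} h k ε 0<ε = eventually-map
    (λ n (hn , kn) → begin
      seq x n                                  ≤⟨ hn ⟩
      seq y n ℚ.+ ½ ℚ.* ε                      ≤⟨ ℚ.+-monoˡ-≤ (½ ℚ.* ε) kn ⟩
      seq z n ℚ.+ ½ ℚ.* ε ℚ.+ ½ ℚ.* ε          ≡⟨ ℚ.+-assoc (seq z n) _ _ ⟩
      seq z n ℚ.+ (½ ℚ.* ε ℚ.+ ½ ℚ.* ε)        ≡⟨ ≡.cong (seq z n ℚ.+_) (half+half ε) ⟩
      seq z n ℚ.+ ε                            ∎)
    (eventually-× (h _ (half-pos 0<ε)) (k _ (half-pos 0<ε)))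

  ≤-antisym : ∀ {x y} → x ≤ʳ y → y ≤ʳ x → x ≈ʳ y
  ≤-antisym {x} {y} h k ε 0<ε = eventually-map
    (λ n (hn , kn) → ∣∣≤
      (≤-by (seq y n ℚ.+ ε ℚ.- seq x n) (0≤- hn)
        (ℚS.solve 3 (λ x y e → e := (x :- y) :+ (y :+ e :- x)) ≡.refl (seq x n) (seq y n) ε))
      (≤-by (seq x n ℚ.+ ε ℚ.- seq y n) (0≤- kn)
        (ℚS.solve 3 (λ x y e → e := :- (x :- y) :+ (x :+ e :- y)) ≡.refl (seq x n) (seq y n) ε)))
    (eventually-× (h ε 0<ε) (k ε 0<ε))

  +-mono-≤ : ∀ {x y z w} → x ≤ʳ y → z ≤ʳ w → x +ʳ z ≤ʳ y +ʳ w
  +-mono-≤ {x} {y} {z} {w} h k ε 0<ε = eventually-map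
    (λ n (hn , kn) → begin
      seq x n ℚ.+ seq z n                                  ≤⟨ ℚ.+-mono-≤ hn kn ⟩
      (seq y n ℚ.+ ½ ℚ.* ε) ℚ.+ (seq w n ℚ.+ ½ ℚ.* ε)
        ≡⟨ ℚS.solve 3 (λ y w e → (y :+ ℚS.con ½ :* e) :+ (w :+ ℚS.con ½ :* e) := y :+ w :+ e) ≡.refl (seq y n) (seq w n) ε ⟩
      seq y n ℚ.+ seq w n ℚ.+ ε                            ∎)
    (eventually-× (h _ (half-pos 0<ε)) (k _ (half-pos 0<ε)))

  -- The terms of a nonnegative real may be negative, but eventually not below -ε/2, and then |p| -
  -- p = -2p ≤ ε. This lets `0≤*0≤ʳ` replace the factors by absolute values, whose terms are
  -- nonnegative.
  0≤⇒≈∣∣ : ∀ {x} → 0ʳ ≤ʳ x → ∣ x ∣ʳ ≈ʳ x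
  0≤⇒≈∣∣ {x} h ε 0<ε = eventually-map (λ n hn → estimate (seq x n) hn) (h _ (half-pos 0<ε))
    where
    estimate : ∀ p → 0ℚ ℚ.≤ p ℚ.+ ½ ℚ.* ε → ℚ.∣ ℚ.∣ p ∣ ℚ.- p ∣ ℚ.≤ ε
    estimate p hp with ℚ.∣p∣≡p∨∣p∣≡-p p
    ... | inj₁ eq = ℚ.≤-trans (ℚ.≤-reflexive (≡.cong ℚ.∣_∣ (≡.trans (≡.cong (ℚ._- p) eq) (ℚ.+-inverseʳ p)))) (ℚ.<⇒≤ 0<ε)
    ... | inj₂ eq = ∣∣≤
      (≤-by (2p+ε) (0≤+0≤ hp hp) (≡.trans
        (ℚS.solve 2 (λ p e → e := :- p :- p :+ (p :+ ℚS.con ½ :* e :+ (p :+ ℚS.con ½ :* e))) ≡.refl p ε)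
        (≡.cong (λ t → t ℚ.- p ℚ.+ 2p+ε) (≡.sym eq))))
      (≤-by (ℚ.∣ p ∣ ℚ.- p ℚ.+ ε) (0≤+0≤ (0≤- (p≤∣p∣ p)) (ℚ.<⇒≤ 0<ε))
        (ℚS.solve 3 (λ a p e → e := :- (a :- p) :+ (a :- p :+ e)) ≡.refl ℚ.∣ p ∣ p ε))
      where
      2p+ε : ℚ
      2p+ε = p ℚ.+ ½ ℚ.* ε ℚ.+ (p ℚ.+ ½ ℚ.* ε)

  ∣∣-cong : ∀ {x y} → x ≈ʳ y → ∣ x ∣ʳ ≈ʳ ∣ y ∣ʳ
  ∣∣-cong {x} {y} h ε 0<ε = eventually-map
    (λ n hn → ∣∣≤
      (≤-by (ε ℚ.- (ℚ.∣ seq x n ∣ ℚ.- ℚ.∣ seq y n ∣)) (0≤- (ℚ.≤-trans (triangle (seq x n) (seq y n)) hn))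
        (split (ℚ.∣ seq x n ∣ ℚ.- ℚ.∣ seq y n ∣)))
      (≤-by (ε ℚ.- ℚ.- (ℚ.∣ seq x n ∣ ℚ.- ℚ.∣ seq y n ∣))
        (0≤- (ℚ.≤-trans (ℚ.≤-reflexive (ℚS.solve 2 (λ a b → :- (a :- b) := b :- a) ≡.refl ℚ.∣ seq x n ∣ ℚ.∣ seq y n ∣))
               (ℚ.≤-trans (triangle (seq y n) (seq x n)) (ℚ.≤-trans (ℚ.≤-reflexive (flip (seq y n) (seq x n))) hn))))
        (split (ℚ.- (ℚ.∣ seq x n ∣ ℚ.- ℚ.∣ seq y n ∣)))))
    (h ε 0<ε)
    where
    split : ∀ p → ε ≡ p ℚ.+ (ε ℚ.- p)
    split p = ℚS.solve 2 (λ p e → e := p :+ (e :- p)) ≡.refl p ε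
    triangle : ∀ p q → ℚ.∣ p ∣ ℚ.- ℚ.∣ q ∣ ℚ.≤ ℚ.∣ p ℚ.- q ∣
    triangle p q = ≤-by (ℚ.∣ p ℚ.- q ∣ ℚ.+ ℚ.∣ q ∣ ℚ.- ℚ.∣ p ∣)
      (0≤- (ℚ.≤-trans (ℚ.≤-reflexive (≡.cong ℚ.∣_∣ (ℚS.solve 2 (λ p q → p := (p :- q) :+ q) ≡.refl p q))) (ℚ.∣p+q∣≤∣p∣+∣q∣ (p ℚ.- q) q)))
      (ℚS.solve 3 (λ a b c → c := (a :- b) :+ (c :+ b :- a)) ≡.refl ℚ.∣ p ∣ ℚ.∣ q ∣ ℚ.∣ p ℚ.- q ∣)

  0≤*0≤ʳ : ∀ {x y} → 0ʳ ≤ʳ x → 0ʳ ≤ʳ y → 0ʳ ≤ʳ x *ʳ y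
  0≤*0≤ʳ {x} {y} h k = ≤-trans {0ʳ} {∣ x ∣ʳ *ʳ ∣ y ∣ʳ} {x *ʳ y}
    (≤-pointwise {0ʳ} {∣ x ∣ʳ *ʳ ∣ y ∣ʳ} λ n → 0≤*0≤ (ℚ.0≤∣p∣ (seq x n)) (ℚ.0≤∣p∣ (seq y n)))
    (≤-reflexive {∣ x ∣ʳ *ʳ ∣ y ∣ʳ} {x *ʳ y} (*-cong {∣ x ∣ʳ} {x} {∣ y ∣ʳ} {y} (0≤⇒≈∣∣ {x} h) (0≤⇒≈∣∣ {y} k)))

  ∣∣-least : ∀ {x y} → x ≤ʳ y → -ʳ x ≤ʳ y → ∣ x ∣ʳ ≤ʳ y
  ∣∣-least {x} {y} h k ε 0<ε = eventually-map (λ n (hn , kn) → ∣∣≤ hn kn) (eventually-× (h ε 0<ε) (k ε 0<ε))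

  ≤-closed : ∀ {x y} → (∀ ε → 0ℚ ℚ.< ε → x ≤ʳ y +ʳ fromℚ ε) → x ≤ʳ y
  ≤-closed {x} {y} h ε 0<ε = eventually-map
    (λ n hn → ℚ.≤-trans hn (ℚ.≤-reflexive
      (≡.trans (ℚ.+-assoc (seq y n) _ _) (≡.cong (seq y n ℚ.+_) (half+half ε)))))
    (h _ (half-pos 0<ε) _ (half-pos 0<ε))

  ℚ-algebra : ℚ-Algebra
  ℚ-algebra = record
    { commutativeRing = commutativeRing
    ; ι = fromℚ
    ; ι-0 = pointwise {0ʳ} {0ʳ} λ n → ≡.refl
    ; ι-1 = pointwise {1ʳ} {1ʳ} λ n → ≡.refl
    ; ι-+ = λ p q → pointwise {fromℚ (p ℚ.+ q)} {fromℚ p +ʳ fromℚ q} λ n → ≡.refl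
    ; ι-* = λ p q → pointwise {fromℚ (p ℚ.* q)} {fromℚ p *ʳ fromℚ q} λ n → ≡.refl
    ; ι-neg = λ p → pointwise {fromℚ (ℚ.- p)} { -ʳ fromℚ p} λ n → ≡.refl
    }

  archimedeanRing : ArchimedeanRing
  archimedeanRing = record
    { ℚ-algebra = ℚ-algebra
    ; _≤_ = _≤ʳ_ ; ∣_∣ = ∣_∣ʳ
    ; ≤-reflexive = λ {x} {y} → ≤-reflexive {x} {y}
    ; ≤-trans = λ {x} {y} {z} → ≤-trans {x} {y} {z}
    ; ≤-antisym = λ {x} {y} → ≤-antisym {x} {y}
    ; +-mono-≤ = λ {x} {y} {z} {w} → +-mono-≤ {x} {y} {z} {w}
    ; 0≤*0≤ = λ {x} {y} → 0≤*0≤ʳ {x} {y}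
    ; 0≤x² = λ x → ≤-pointwise {0ʳ} {x *ʳ x} λ n → 0≤square (seq x n)
    ; ∣∣-cong = λ {x} {y} → ∣∣-cong {x} {y}
    ; ∣x+y∣≤ = λ x y → ≤-pointwise {∣ x +ʳ y ∣ʳ} {∣ x ∣ʳ +ʳ ∣ y ∣ʳ} λ n → ℚ.∣p+q∣≤∣p∣+∣q∣ (seq x n) (seq y n)
    ; ∣x*y∣≈ = λ x y → pointwise {∣ x *ʳ y ∣ʳ} {∣ x ∣ʳ *ʳ ∣ y ∣ʳ} λ n → ℚ.∣p*q∣≡∣p∣*∣q∣ (seq x n) (seq y n)
    ; x≤∣x∣ = λ x → ≤-pointwise {x} {∣ x ∣ʳ} λ n → p≤∣p∣ (seq x n)
    ; ∣-x∣≈ = λ x → pointwise {∣ -ʳ x ∣ʳ} {∣ x ∣ʳ} λ n → ℚ.∣-p∣≡∣p∣ (seq x n)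
    ; ∣∣≤ = λ {x} {y} → ∣∣-least {x} {y}
    ; 0≤∣x∣ = λ x → ≤-pointwise {0ʳ} {∣ x ∣ʳ} λ n → ℚ.0≤∣p∣ (seq x n)
    ; ι-mono = λ {p} {q} p≤q → ≤-pointwise {fromℚ p} {fromℚ q} λ n → p≤q
    ; bounded = λ x → let B , 0<B , N , hB = bounded x in B , 0<B , λ ε 0<ε → N , λ n Nn →
        ℚ.≤-trans (hB n Nn) (≤-by ε (ℚ.<⇒≤ 0<ε) ≡.refl)
    ; ≤-closed = λ {x} {y} → ≤-closed {x} {y}
    }

-- Partial sums of the exponential series at rational arguments

module ExponentialSums where
  open Fractions
  open ℚ-Order
  open Sums ℚ-semiring public using (∑<; ∑<-suc; ∑<-last)
  open PowerSeries ℚ-semiring using (Series; tail; _⋆_)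
  open Exponential ℚ-semiring 1/suc ·-1/suc public using (exp; 1/n!; exp-+)
  open Algebra.Properties.Semiring.Exp (CommutativeSemiring.semiring ℚ-semiring) using (^-homo-*)
  open ℚ.≤-Reasoning
  private module ℚS = +-*-Solver
  open ℚS using (_:+_; _:*_; _:-_; :-_; _:=_; con)

  1/n!≡ : ∀ n → 1/n! n ≡ 1/fact n
  1/n!≡ zero    = ≡.refl
  1/n!≡ (suc n) = ≡.trans (≡.cong (1/suc n ℚ.*_) (1/n!≡ n)) (1/fact-suc n)

  ∑<-nonneg : ∀ n {f} → (∀ i → 0ℚ ℚ.≤ f i) → 0ℚ ℚ.≤ ∑< n f
  ∑<-nonneg zero    0≤f = ℚ.≤-refl
  ∑<-nonneg (suc n) {f} 0≤f = ℚ.≤-trans (0≤+0≤ (0≤f 0) (∑<-nonneg n (0≤f ∘ suc))) (ℚ.≤-reflexive (≡.sym (∑<-suc n f)))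

  ∑<-monoˡ : ∀ {m n f} → m ℕ.≤ n → (∀ i → 0ℚ ℚ.≤ f i) → ∑< m f ℚ.≤ ∑< n f
  ∑<-monoˡ {n = n} ℕ.z≤n 0≤f = ∑<-nonneg n 0≤f
  ∑<-monoˡ {suc m} {suc n} {f} (ℕ.s≤s m≤n) 0≤f = begin
    ∑< (suc m) f                 ≡⟨ ∑<-suc m f ⟩
    f 0 ℚ.+ ∑< m (f ∘ suc)       ≤⟨ ℚ.+-monoʳ-≤ (f 0) (∑<-monoˡ m≤n (0≤f ∘ suc)) ⟩
    f 0 ℚ.+ ∑< n (f ∘ suc)       ≡⟨ ∑<-suc n f ⟨
    ∑< (suc n) f                 ∎

  ∑<-difference : ∀ {m n} (f g : ℕ → ℚ) → m ℕ.≤ n → (∀ i → ℚ.∣ f i ∣ ℚ.≤ g i) →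
    ℚ.∣ ∑< n f ℚ.- ∑< m f ∣ ℚ.≤ ∑< n g ℚ.- ∑< m g
  ∑<-difference {_} {zero} f g ℕ.z≤n f≤g = ℚ.≤-refl
  ∑<-difference {_} {suc n} f g ℕ.z≤n f≤g = begin
    ℚ.∣ ∑< (suc n) f ℚ.- 0ℚ ∣
      ≡⟨ ≡.cong ℚ.∣_∣ (≡.trans (≡.cong (ℚ._- 0ℚ) (∑<-suc n f)) (ℚ.+-assoc (f 0) _ _)) ⟩
    ℚ.∣ f 0 ℚ.+ (∑< n (f ∘ suc) ℚ.- 0ℚ) ∣
      ≤⟨ ℚ.∣p+q∣≤∣p∣+∣q∣ (f 0) _ ⟩
    ℚ.∣ f 0 ∣ ℚ.+ ℚ.∣ ∑< n (f ∘ suc) ℚ.- 0ℚ ∣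
      ≤⟨ ℚ.+-mono-≤ (f≤g 0) (∑<-difference {0} {n} (f ∘ suc) (g ∘ suc) ℕ.z≤n (f≤g ∘ suc)) ⟩
    g 0 ℚ.+ (∑< n (g ∘ suc) ℚ.- 0ℚ)
      ≡⟨ ≡.trans (≡.cong (ℚ._- 0ℚ) (∑<-suc n g)) (ℚ.+-assoc (g 0) _ _) ⟨
    ∑< (suc n) g ℚ.- 0ℚ ∎
  ∑<-difference {suc m} {suc n} f g (ℕ.s≤s m≤n) f≤g = begin
    ℚ.∣ ∑< (suc n) f ℚ.- ∑< (suc m) f ∣
      ≡⟨ ≡.cong ℚ.∣_∣ (cancel f) ⟩
    ℚ.∣ ∑< n (f ∘ suc) ℚ.- ∑< m (f ∘ suc) ∣
      ≤⟨ ∑<-difference (f ∘ suc) (g ∘ suc) m≤n (f≤g ∘ suc) ⟩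
    ∑< n (g ∘ suc) ℚ.- ∑< m (g ∘ suc)
      ≡⟨ cancel g ⟨
    ∑< (suc n) g ℚ.- ∑< (suc m) g ∎
    where
    cancel : ∀ f → ∑< (suc n) f ℚ.- ∑< (suc m) f ≡ ∑< n (f ∘ suc) ℚ.- ∑< m (f ∘ suc)
    cancel f = ≡.trans (≡.cong₂ ℚ._-_ (∑<-suc n f) (∑<-suc m f))
      (ℚS.solve 3 (λ a b c → (a :+ b) :- (a :+ c) := b :- c) ≡.refl (f 0) _ _)

  private
    ∑<-⋆ : ∀ n (a b : Series) → ∑< (suc n) (a ⋆ b) ≡ a 0 ℚ.* ∑< (suc n) b ℚ.+ ∑< n (tail a ⋆ b)
    ∑<-⋆ n a b = begin-equality
      ∑< (suc n) (a ⋆ b)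
        ≡⟨ ∑<-suc n (a ⋆ b) ⟩
      a 0 ℚ.* b 0 ℚ.+ ∑< n (λ i → a 0 ℚ.* b (suc i) ℚ.+ (tail a ⋆ b) i)
        ≡⟨ ≡.cong (a 0 ℚ.* b 0 ℚ.+_) (∑-+ (upTo n) (λ i → a 0 ℚ.* b (suc i)) (tail a ⋆ b)) ⟩
      a 0 ℚ.* b 0 ℚ.+ (∑< n (λ i → a 0 ℚ.* b (suc i)) ℚ.+ ∑< n (tail a ⋆ b))
        ≡⟨ ≡.cong (λ t → a 0 ℚ.* b 0 ℚ.+ (t ℚ.+ ∑< n (tail a ⋆ b))) (∑-*ˡ (a 0) (upTo n) (b ∘ suc)) ⟨
      a 0 ℚ.* b 0 ℚ.+ (a 0 ℚ.* ∑< n (b ∘ suc) ℚ.+ ∑< n (tail a ⋆ b))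
        ≡⟨ ℚS.solve 4 (λ a b c d → a :* b :+ (a :* c :+ d) := a :* (b :+ c) :+ d) ≡.refl (a 0) (b 0) _ _ ⟩
      a 0 ℚ.* (b 0 ℚ.+ ∑< n (b ∘ suc)) ℚ.+ ∑< n (tail a ⋆ b)
        ≡⟨ ≡.cong (λ t → a 0 ℚ.* t ℚ.+ ∑< n (tail a ⋆ b)) (∑<-suc n b) ⟨
      a 0 ℚ.* ∑< (suc n) b ℚ.+ ∑< n (tail a ⋆ b) ∎
      where open Sums ℚ-semiring using (∑-+; ∑-*ˡ)

    -- The terms aᵢ bⱼ with i < n, j < m outside the triangle i + j < n.
    excess : ℕ → ℕ → Series → Series → ℚ
    excess n m a b = ∑< n a ℚ.* ∑< m b ℚ.- ∑< n (a ⋆ b)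

    excess-suc : ∀ n m a b → excess (suc n) m a b ≡ a 0 ℚ.* (∑< m b ℚ.- ∑< (suc n) b) ℚ.+ excess n m (tail a) b
    excess-suc n m a b = ≡.trans (≡.cong₂ (λ s t → s ℚ.* ∑< m b ℚ.- t) (∑<-suc n a) (∑<-⋆ n a b))
      (ℚS.solve 5 (λ a₀ sa sb sb′ t → (a₀ :+ sa) :* sb :- (a₀ :* sb′ :+ t) := a₀ :* (sb :- sb′) :+ (sa :* sb :- t))
        ≡.refl (a 0) (∑< n (a ∘ suc)) (∑< m b) (∑< (suc n) b) (∑< n (tail a ⋆ b)))

    -- The excess is a sum of products aᵢ bⱼ with coefficient 1, so termwise majorants majorise it.
    excess-≤ : ∀ n m {a b ā b̄} → n ℕ.≤ m → (∀ i → ℚ.∣ a i ∣ ℚ.≤ ā i) → (∀ i → ℚ.∣ b i ∣ ℚ.≤ b̄ i) →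
               ℚ.∣ excess n m a b ∣ ℚ.≤ excess n m ā b̄
    excess-≤ zero    m {a} {b} {ā} {b̄} n≤m a≤ b≤ = ℚ.≤-reflexive (≡.trans
      (≡.cong (λ t → ℚ.∣ t ℚ.- 0ℚ ∣) (ℚ.*-zeroˡ (∑< m b))) (≡.cong (ℚ._- 0ℚ) (≡.sym (ℚ.*-zeroˡ (∑< m b̄)))))
    excess-≤ (suc n) m {a} {b} {ā} {b̄} n<m a≤ b≤ = begin
      ℚ.∣ excess (suc n) m a b ∣
        ≡⟨ ≡.cong ℚ.∣_∣ (excess-suc n m a b) ⟩
      ℚ.∣ a 0 ℚ.* (∑< m b ℚ.- ∑< (suc n) b) ℚ.+ excess n m (tail a) b ∣
        ≤⟨ ℚ.∣p+q∣≤∣p∣+∣q∣ (a 0 ℚ.* (∑< m b ℚ.- ∑< (suc n) b)) _ ⟩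
      ℚ.∣ a 0 ℚ.* (∑< m b ℚ.- ∑< (suc n) b) ∣ ℚ.+ ℚ.∣ excess n m (tail a) b ∣
        ≤⟨ ℚ.+-mono-≤
             (ℚ.≤-trans (ℚ.≤-reflexive (ℚ.∣p*q∣≡∣p∣*∣q∣ (a 0) _))
               (*-mono-≤ (ℚ.0≤∣p∣ (∑< m b ℚ.- ∑< (suc n) b)) (ℚ.≤-trans (ℚ.0≤∣p∣ (a 0)) (a≤ 0)) (a≤ 0) (∑<-difference b b̄ n<m b≤)))
             (excess-≤ n m (ℕ.<⇒≤ n<m) (a≤ ∘ suc) b≤) ⟩
      ā 0 ℚ.* (∑< m b̄ ℚ.- ∑< (suc n) b̄) ℚ.+ excess n m (tail ā) b̄
        ≡⟨ excess-suc n m ā b̄ ⟨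
      excess (suc n) m ā b̄ ∎

    -- The rectangle i < n, j < m lies in the triangle i + j < n + m, and all terms are nonnegative.
    product≤⋆ : ∀ n m {a b} → (∀ i → 0ℚ ℚ.≤ a i) → (∀ i → 0ℚ ℚ.≤ b i) →
                ∑< n a ℚ.* ∑< m b ℚ.≤ ∑< (n ℕ.+ m) (a ⋆ b)
    product≤⋆ zero    m {a} {b} 0≤a 0≤b = ℚ.≤-trans (ℚ.≤-reflexive (ℚ.*-zeroˡ (∑< m b))) (∑<-nonneg m (⋆-nonneg 0≤a))
      where
      ⋆-nonneg : ∀ {a} → (∀ i → 0ℚ ℚ.≤ a i) → ∀ i → 0ℚ ℚ.≤ (a ⋆ b) i
      ⋆-nonneg 0≤a zero    = 0≤*0≤ (0≤a 0) (0≤b 0)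
      ⋆-nonneg 0≤a (suc i) = 0≤+0≤ (0≤*0≤ (0≤a 0) (0≤b (suc i))) (⋆-nonneg (0≤a ∘ suc) i)
    product≤⋆ (suc n) m {a} {b} 0≤a 0≤b = begin
      ∑< (suc n) a ℚ.* ∑< m b
        ≡⟨ ≡.trans (≡.cong (ℚ._* ∑< m b) (∑<-suc n a)) (ℚ.*-distribʳ-+ (∑< m b) (a 0) (∑< n (a ∘ suc))) ⟩
      a 0 ℚ.* ∑< m b ℚ.+ ∑< n (a ∘ suc) ℚ.* ∑< m b
        ≤⟨ ℚ.+-mono-≤ (ℚ.*-monoˡ-≤-nonNeg (a 0) {{ℚ.nonNegative (0≤a 0)}} (∑<-monoˡ {m} {suc n ℕ.+ m} (ℕ.m≤n+m m (suc n)) 0≤b))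
                      (product≤⋆ n m (0≤a ∘ suc) 0≤b) ⟩
      a 0 ℚ.* ∑< (suc n ℕ.+ m) b ℚ.+ ∑< (n ℕ.+ m) (tail a ⋆ b)
        ≡⟨ ∑<-⋆ (n ℕ.+ m) a b ⟨
      ∑< (suc n ℕ.+ m) (a ⋆ b) ∎

  E : ℕ → ℚ → ℚ
  E n a = ∑< n (exp a)

  private
    0≤1/n! : ∀ n → 0ℚ ℚ.≤ 1/n! n
    0≤1/n! zero    = ℚ.nonNegative⁻¹ 1ℚ
    0≤1/n! (suc n) = 0≤*0≤ (ℚ.<⇒≤ (0<1/suc n)) (0≤1/n! n)

    ∣^∣≤ : ∀ {a B} n → ℚ.∣ a ∣ ℚ.≤ B → ℚ.∣ a ^ n ∣ ℚ.≤ B ^ n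
    ∣^∣≤ zero    a≤B = ℚ.≤-refl
    ∣^∣≤ {a} {B} (suc n) a≤B = ℚ.≤-trans (ℚ.≤-reflexive (ℚ.∣p*q∣≡∣p∣*∣q∣ a (a ^ n)))
      (*-mono-≤ (ℚ.0≤∣p∣ (a ^ n)) (ℚ.≤-trans (ℚ.0≤∣p∣ a) a≤B) a≤B (∣^∣≤ n a≤B))

    ∣exp∣≤ : ∀ {a B} → ℚ.∣ a ∣ ℚ.≤ B → ∀ n → ℚ.∣ exp a n ∣ ℚ.≤ exp B n
    ∣exp∣≤ {a} {B} a≤B n = ℚ.≤-trans
      (ℚ.≤-reflexive (≡.trans (ℚ.∣p*q∣≡∣p∣*∣q∣ (a ^ n) (1/n! n)) (≡.cong (ℚ.∣ a ^ n ∣ ℚ.*_) (ℚ.0≤p⇒∣p∣≡p (0≤1/n! n)))))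
      (ℚ.*-monoʳ-≤-nonNeg (1/n! n) {{ℚ.nonNegative (0≤1/n! n)}} (∣^∣≤ n a≤B))

    0≤exp : ∀ {B} → 0ℚ ℚ.≤ B → ∀ n → 0ℚ ℚ.≤ exp B n
    0≤exp 0≤B n = 0≤*0≤ (0≤^ n 0≤B) (0≤1/n! n)

  E-tail : ∀ {a B m n} → ℚ.∣ a ∣ ℚ.≤ B → m ℕ.≤ n → ℚ.∣ E n a ℚ.- E m a ∣ ℚ.≤ E n B ℚ.- E m B
  E-tail {a} {B} a≤B m≤n = ∑<-difference (exp a) (exp B) m≤n (∣exp∣≤ a≤B)

  -- The terms of the square i, j < n outside the triangle i + j < n are majorised by those for B
  -- and B. There the square lies within the triangle of size 2n, and the sums over both triangles
  -- are partial sums for 2B; so the error is a tail of the series at 2B.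
  E-+ : ∀ {a b B} n → ℚ.∣ a ∣ ℚ.≤ B → ℚ.∣ b ∣ ℚ.≤ B →
        ℚ.∣ E n a ℚ.* E n b ℚ.- E n (a ℚ.+ b) ∣ ℚ.≤ E (n ℕ.+ n) (B ℚ.+ B) ℚ.- E n (B ℚ.+ B)
  E-+ {a} {b} {B} n a≤B b≤B = begin
    ℚ.∣ E n a ℚ.* E n b ℚ.- E n (a ℚ.+ b) ∣       ≡⟨ ≡.cong (λ t → ℚ.∣ E n a ℚ.* E n b ℚ.- t ∣) (E-⋆ n a b) ⟨
    ℚ.∣ excess n n (exp a) (exp b) ∣              ≤⟨ excess-≤ n n ℕ.≤-refl (∣exp∣≤ a≤B) (∣exp∣≤ b≤B) ⟩
    excess n n (exp B) (exp B)                    ≤⟨ ℚ.+-monoˡ-≤ (ℚ.- ∑< n (exp B ⋆ exp B)) (product≤⋆ n n (0≤exp 0≤B) (0≤exp 0≤B)) ⟩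
    ∑< (n ℕ.+ n) (exp B ⋆ exp B) ℚ.- ∑< n (exp B ⋆ exp B)  ≡⟨ ≡.cong₂ ℚ._-_ (E-⋆ (n ℕ.+ n) B B) (E-⋆ n B B) ⟩
    E (n ℕ.+ n) (B ℚ.+ B) ℚ.- E n (B ℚ.+ B)       ∎
    where
    0≤B : 0ℚ ℚ.≤ B
    0≤B = ℚ.≤-trans (ℚ.0≤∣p∣ a) a≤B
    E-⋆ : ∀ n a b → ∑< n (exp a ⋆ exp b) ≡ E n (a ℚ.+ b)
    E-⋆ n a b = Sums.∑-cong ℚ-semiring (upTo n) (exp-+ a b)

  private
    exp-suc : ∀ B k → fromNat (suc k) ℚ.* exp B (suc k) ≡ B ℚ.* exp B k
    exp-suc B k = ≡.trans
      (ℚS.solve 5 (λ n b p i f → n :* (b :* p :* (i :* f)) := n :* i :* (b :* (p :* f))) ≡.refl (fromNat (suc k)) B (B ^ k) (1/suc k) (1/n! k))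
      (≡.trans (≡.cong (ℚ._* (B ℚ.* exp B k)) (fromNat-*-1/suc k)) (ℚ.*-identityˡ _))

  module _ {B} (0≤B : 0ℚ ℚ.≤ B) where
    private
      -- From this index on, the terms of the series at least halve.
      m₀ : ℕ
      m₀ = proj₁ (archimedean (B ℚ.+ B))

      2B≤ : ∀ {k} → m₀ ℕ.≤ k → B ℚ.+ B ℚ.≤ fromNat (suc k)
      2B≤ {k} le = ℚ.≤-trans (proj₂ (archimedean (B ℚ.+ B))) (fromNat-mono (ℕ.m≤n⇒m≤1+n le))

      u : ℕ → ℚ
      u = exp B

      halving : ∀ {k} → m₀ ℕ.≤ k → u (suc k) ℚ.+ u (suc k) ℚ.≤ u k
      halving {k} le = ℚ.*-cancelˡ-≤-pos (fromNat (suc k)) {{ℚ.positive (0<fromNat-suc k)}} (begin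
        fromNat (suc k) ℚ.* (u (suc k) ℚ.+ u (suc k))
          ≡⟨ ≡.trans (ℚ.*-distribˡ-+ (fromNat (suc k)) (u (suc k)) (u (suc k))) (≡.cong₂ ℚ._+_ (exp-suc B k) (exp-suc B k)) ⟩
        B ℚ.* u k ℚ.+ B ℚ.* u k
          ≡⟨ ℚ.*-distribʳ-+ (u k) B B ⟨
        (B ℚ.+ B) ℚ.* u k
          ≤⟨ ℚ.*-monoʳ-≤-nonNeg (u k) {{ℚ.nonNegative (0≤exp 0≤B k)}} (2B≤ le) ⟩
        fromNat (suc k) ℚ.* u k ∎)

      decreasing : ∀ j → u (j ℕ.+ m₀) ℚ.≤ u m₀
      decreasing zero    = ℚ.≤-refl
      decreasing (suc j) = ℚ.≤-trans (ℚ.≤-trans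
        (≤-by (u (suc j ℕ.+ m₀)) (0≤exp 0≤B (suc j ℕ.+ m₀)) ≡.refl) (halving (ℕ.m≤n+m m₀ j))) (decreasing j)

      -- From m₀ on, E + 2u does not increase: the new term u m is paid for by the drop from 2 u m
      -- to 2 u (m+1) ≤ u m. This bounds every tail by twice its first term.
      potential : ∀ {k} j → m₀ ℕ.≤ k → E (j ℕ.+ k) B ℚ.+ (u (j ℕ.+ k) ℚ.+ u (j ℕ.+ k)) ℚ.≤ E k B ℚ.+ (u k ℚ.+ u k)
      potential zero    le = ℚ.≤-refl
      potential {k} (suc j) le = begin
        E (suc m) B ℚ.+ (u (suc m) ℚ.+ u (suc m))      ≤⟨ ℚ.+-monoʳ-≤ (E (suc m) B) (halving (ℕ.≤-trans le (ℕ.m≤n+m k j))) ⟩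
        E (suc m) B ℚ.+ u m                            ≡⟨ ≡.cong (ℚ._+ u m) (∑<-last m u) ⟩
        E m B ℚ.+ u m ℚ.+ u m                          ≡⟨ ℚ.+-assoc (E m B) (u m) (u m) ⟩
        E m B ℚ.+ (u m ℚ.+ u m)                        ≤⟨ potential j le ⟩
        E k B ℚ.+ (u k ℚ.+ u k)                        ∎
        where
        m : ℕ
        m = j ℕ.+ k

      tail≤ : ∀ {k n} → m₀ ℕ.≤ k → k ℕ.≤ n → E n B ℚ.- E k B ℚ.≤ u k ℚ.+ u k
      tail≤ {k} {n} le k≤n = ≤-by ((E k B ℚ.+ (u k ℚ.+ u k)) ℚ.- (E n B ℚ.+ (u n ℚ.+ u n)) ℚ.+ (u n ℚ.+ u n))
        (0≤+0≤ (0≤- (≡.subst (λ m → E m B ℚ.+ (u m ℚ.+ u m) ℚ.≤ E k B ℚ.+ (u k ℚ.+ u k)) (ℕ.m∸n+n≡m k≤n) (potential (n ℕ.∸ k) le)))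
               (0≤+0≤ (0≤exp 0≤B n) (0≤exp 0≤B n)))
        (ℚS.solve 4 (λ a b c d → c := (b :- a) :+ ((a :+ c) :- (b :+ d) :+ d)) ≡.refl (E k B) (E n B) (u k ℚ.+ u k) (u n ℚ.+ u n))

    -- The tail from k+1 is at most 2 u(k+1) = 2 B u(k)/(k+1) ≤ C/(k+1), where C = 2 B u(m₀),
    -- because u does not exceed u(m₀) after m₀. The choice of N makes C ≤ N ε.
    E-tail-null : ∀ ε → 0ℚ ℚ.< ε → Eventually λ k → ∀ n → k ℕ.≤ n → E n B ℚ.- E k B ℚ.≤ ε
    E-tail-null ε 0<ε = suc (m₀ ℕ.+ N) , small
      where
      C : ℚ
      C = B ℚ.* u m₀ ℚ.+ B ℚ.* u m₀
      ε⁻¹ : ∃ λ δ → 0ℚ ℚ.< δ × ε ℚ.* δ ≡ 1ℚ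
      ε⁻¹ = divide 1ℚ 0<ε (ℚ.positive⁻¹ 1ℚ)
      N : ℕ
      N = proj₁ (archimedean (proj₁ ε⁻¹ ℚ.* C))
      C≤ : C ℚ.≤ fromNat N ℚ.* ε
      C≤ = begin
        C                                   ≡⟨ ≡.trans (≡.cong (ℚ._* C) (proj₂ (proj₂ ε⁻¹))) (ℚ.*-identityˡ C) ⟨
        ε ℚ.* proj₁ ε⁻¹ ℚ.* C               ≡⟨ ≡.trans (ℚ.*-assoc ε (proj₁ ε⁻¹) C) (ℚ.*-comm ε _) ⟩
        proj₁ ε⁻¹ ℚ.* C ℚ.* ε               ≤⟨ ℚ.*-monoʳ-≤-nonNeg ε {{ℚ.nonNegative (ℚ.<⇒≤ 0<ε)}} (proj₂ (archimedean (proj₁ ε⁻¹ ℚ.* C))) ⟩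
        fromNat N ℚ.* ε                     ∎
      B*u≤ : ∀ k → m₀ ℕ.≤ k → B ℚ.* u k ℚ.≤ B ℚ.* u m₀
      B*u≤ k le = ℚ.*-monoˡ-≤-nonNeg B {{ℚ.nonNegative 0≤B}}
        (≡.subst (λ k → u k ℚ.≤ u m₀) (ℕ.m∸n+n≡m le) (decreasing (k ℕ.∸ m₀)))
      small : ∀ k → suc (m₀ ℕ.+ N) ℕ.≤ k → ∀ n → k ℕ.≤ n → E n B ℚ.- E k B ℚ.≤ ε
      small (suc k) (ℕ.s≤s le) n k<n = ℚ.≤-trans
        (tail≤ (ℕ.≤-trans (ℕ.m≤m+n m₀ N) (ℕ.m≤n⇒m≤1+n le)) k<n)
        (ℚ.*-cancelˡ-≤-pos (fromNat (suc k)) {{ℚ.positive (0<fromNat-suc k)}} (begin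
          fromNat (suc k) ℚ.* (u (suc k) ℚ.+ u (suc k))
            ≡⟨ ≡.trans (ℚ.*-distribˡ-+ (fromNat (suc k)) (u (suc k)) (u (suc k))) (≡.cong₂ ℚ._+_ (exp-suc B k) (exp-suc B k)) ⟩
          B ℚ.* u k ℚ.+ B ℚ.* u k
            ≤⟨ ℚ.+-mono-≤ (B*u≤ k (ℕ.≤-trans (ℕ.m≤m+n m₀ N) le)) (B*u≤ k (ℕ.≤-trans (ℕ.m≤m+n m₀ N) le)) ⟩
          C
            ≤⟨ C≤ ⟩
          fromNat N ℚ.* ε
            ≤⟨ ℚ.*-monoʳ-≤-nonNeg ε {{ℚ.nonNegative (ℚ.<⇒≤ 0<ε)}} (fromNat-mono (ℕ.≤-trans (ℕ.m≤n+m N m₀) (ℕ.m≤n⇒m≤1+n le))) ⟩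
          fromNat (suc k) ℚ.* ε ∎))

    E-bounded : ∃ λ C → 0ℚ ℚ.< C × ∀ n → E n B ℚ.≤ C
    E-bounded = fromTail (E-tail-null 1ℚ (ℚ.positive⁻¹ 1ℚ))
      where
      fromTail : (Eventually λ k → ∀ n → k ℕ.≤ n → E n B ℚ.- E k B ℚ.≤ 1ℚ) → ∃ λ C → 0ℚ ℚ.< C × ∀ n → E n B ℚ.≤ C
      fromTail (K , hK) = 1ℚ ℚ.+ E K B , 0<+0≤ (ℚ.positive⁻¹ 1ℚ) (∑<-nonneg K (0≤exp 0≤B)) , bound
        where
        bound : ∀ n → E n B ℚ.≤ 1ℚ ℚ.+ E K B
        bound n = [ above , below ]′ (ℕ.≤-total K n)
          where
          above : K ℕ.≤ n → E n B ℚ.≤ 1ℚ ℚ.+ E K B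
          above K≤n = ≤-by (1ℚ ℚ.- (E n B ℚ.- E K B)) (0≤- (hK K ℕ.≤-refl n K≤n))
            (ℚS.solve 2 (λ a b → con 1ℚ :+ a := b :+ (con 1ℚ :- (b :- a))) ≡.refl (E K B) (E n B))
          below : n ℕ.≤ K → E n B ℚ.≤ 1ℚ ℚ.+ E K B
          below n≤K = ℚ.≤-trans (∑<-monoˡ n≤K (0≤exp 0≤B))
            (≤-by 1ℚ (ℚ.nonNegative⁻¹ 1ℚ) (ℚ.+-comm 1ℚ (E K B)))

  private
    ^-lipschitz : ∀ {a b B} → ℚ.∣ a ∣ ℚ.≤ B → ℚ.∣ b ∣ ℚ.≤ B → ∀ k →
      ℚ.∣ a ^ suc k ℚ.- b ^ suc k ∣ ℚ.≤ fromNat (suc k) ℚ.* (ℚ.∣ a ℚ.- b ∣ ℚ.* B ^ k)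
    ^-lipschitz {a} {b} {B} a≤B b≤B zero = ℚ.≤-reflexive (≡.trans
      (≡.cong ℚ.∣_∣ (ℚS.solve 2 (λ a b → a :* con 1ℚ :- b :* con 1ℚ := a :- b) ≡.refl a b))
      (ℚS.solve 1 (λ d → d := con 1ℚ :* (d :* con 1ℚ)) ≡.refl ℚ.∣ a ℚ.- b ∣))
    ^-lipschitz {a} {b} {B} a≤B b≤B (suc k) = begin
      ℚ.∣ a ℚ.* a ^ suc k ℚ.- b ℚ.* b ^ suc k ∣
        ≡⟨ ≡.cong ℚ.∣_∣ (ℚS.solve 4 (λ a b p q → a :* p :- b :* q := a :* (p :- q) :+ (a :- b) :* q) ≡.refl a b (a ^ suc k) (b ^ suc k)) ⟩
      ℚ.∣ a ℚ.* (a ^ suc k ℚ.- b ^ suc k) ℚ.+ (a ℚ.- b) ℚ.* b ^ suc k ∣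
        ≤⟨ ℚ.∣p+q∣≤∣p∣+∣q∣ (a ℚ.* (a ^ suc k ℚ.- b ^ suc k)) ((a ℚ.- b) ℚ.* b ^ suc k) ⟩
      ℚ.∣ a ℚ.* (a ^ suc k ℚ.- b ^ suc k) ∣ ℚ.+ ℚ.∣ (a ℚ.- b) ℚ.* b ^ suc k ∣
        ≡⟨ ≡.cong₂ ℚ._+_ (ℚ.∣p*q∣≡∣p∣*∣q∣ a (a ^ suc k ℚ.- b ^ suc k)) (ℚ.∣p*q∣≡∣p∣*∣q∣ (a ℚ.- b) (b ^ suc k)) ⟩
      ℚ.∣ a ∣ ℚ.* ℚ.∣ a ^ suc k ℚ.- b ^ suc k ∣ ℚ.+ ℚ.∣ a ℚ.- b ∣ ℚ.* ℚ.∣ b ^ suc k ∣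
        ≤⟨ ℚ.+-mono-≤
             (*-mono-≤ (ℚ.0≤∣p∣ (a ^ suc k ℚ.- b ^ suc k)) (ℚ.≤-trans (ℚ.0≤∣p∣ a) a≤B) a≤B (^-lipschitz a≤B b≤B k))
             (ℚ.*-monoˡ-≤-nonNeg ℚ.∣ a ℚ.- b ∣ {{ℚ.∣-∣-nonNeg (a ℚ.- b)}} (∣^∣≤ (suc k) b≤B)) ⟩
      B ℚ.* (fromNat (suc k) ℚ.* (ℚ.∣ a ℚ.- b ∣ ℚ.* B ^ k)) ℚ.+ ℚ.∣ a ℚ.- b ∣ ℚ.* B ^ suc k
        ≡⟨ ℚS.solve 4 (λ B n d p → B :* (n :* (d :* p)) :+ d :* (B :* p) := (con 1ℚ :+ n) :* (d :* (B :* p))) ≡.refl B (fromNat (suc k)) ℚ.∣ a ℚ.- b ∣ (B ^ k) ⟩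
      (1ℚ ℚ.+ fromNat (suc k)) ℚ.* (ℚ.∣ a ℚ.- b ∣ ℚ.* B ^ suc k)
        ≡⟨ ≡.cong (ℚ._* (ℚ.∣ a ℚ.- b ∣ ℚ.* B ^ suc k)) (fromNat-suc (suc k)) ⟨
      fromNat (suc (suc k)) ℚ.* (ℚ.∣ a ℚ.- b ∣ ℚ.* B ^ suc k) ∎

    -- The factor k+1 in the Lipschitz bound for the power k+1 cancels against (k+1)!, leaving the
    -- k-th term at B. Summation therefore gives the Lipschitz constant E(B).
    exp-lipschitz : ∀ {a b B} → ℚ.∣ a ∣ ℚ.≤ B → ℚ.∣ b ∣ ℚ.≤ B → ∀ k →
      ℚ.∣ exp a (suc k) ℚ.- exp b (suc k) ∣ ℚ.≤ ℚ.∣ a ℚ.- b ∣ ℚ.* exp B k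
    exp-lipschitz {a} {b} {B} a≤B b≤B k = begin
      ℚ.∣ exp a (suc k) ℚ.- exp b (suc k) ∣
        ≡⟨ ≡.cong ℚ.∣_∣ (ℚS.solve 3 (λ p q f → p :* f :- q :* f := (p :- q) :* f) ≡.refl (a ^ suc k) (b ^ suc k) f) ⟩
      ℚ.∣ (a ^ suc k ℚ.- b ^ suc k) ℚ.* f ∣
        ≡⟨ ≡.trans (ℚ.∣p*q∣≡∣p∣*∣q∣ (a ^ suc k ℚ.- b ^ suc k) f) (≡.cong (ℚ.∣ a ^ suc k ℚ.- b ^ suc k ∣ ℚ.*_) (ℚ.0≤p⇒∣p∣≡p (0≤1/n! (suc k)))) ⟩
      ℚ.∣ a ^ suc k ℚ.- b ^ suc k ∣ ℚ.* f
        ≤⟨ ℚ.*-monoʳ-≤-nonNeg f {{ℚ.nonNegative (0≤1/n! (suc k))}} (^-lipschitz a≤B b≤B k) ⟩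
      fromNat (suc k) ℚ.* (ℚ.∣ a ℚ.- b ∣ ℚ.* B ^ k) ℚ.* (1/suc k ℚ.* 1/n! k)
        ≡⟨ ℚS.solve 5 (λ n d p i f → n :* (d :* p) :* (i :* f) := n :* i :* (d :* (p :* f))) ≡.refl (fromNat (suc k)) ℚ.∣ a ℚ.- b ∣ (B ^ k) (1/suc k) (1/n! k) ⟩
      fromNat (suc k) ℚ.* 1/suc k ℚ.* (ℚ.∣ a ℚ.- b ∣ ℚ.* exp B k)
        ≡⟨ ≡.trans (≡.cong (ℚ._* (ℚ.∣ a ℚ.- b ∣ ℚ.* exp B k)) (fromNat-*-1/suc k)) (ℚ.*-identityˡ _) ⟩
      ℚ.∣ a ℚ.- b ∣ ℚ.* exp B k ∎
      where
      f : ℚ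
      f = 1/n! (suc k)

  E-lipschitz : ∀ {a b B} n → ℚ.∣ a ∣ ℚ.≤ B → ℚ.∣ b ∣ ℚ.≤ B → ℚ.∣ E n a ℚ.- E n b ∣ ℚ.≤ ℚ.∣ a ℚ.- b ∣ ℚ.* E n B
  E-lipschitz {a} {b} {B} zero    a≤B b≤B = ℚ.≤-reflexive (≡.sym (ℚ.*-zeroʳ ℚ.∣ a ℚ.- b ∣))
  E-lipschitz {a} {b} {B} (suc n) a≤B b≤B = begin
    ℚ.∣ E (suc n) a ℚ.- E (suc n) b ∣
      ≡⟨ ≡.cong ℚ.∣_∣ (≡.cong₂ ℚ._-_ (∑<-suc n (exp a)) (∑<-suc n (exp b))) ⟩
    ℚ.∣ (1ℚ ℚ.* 1ℚ ℚ.+ ∑< n (exp a ∘ suc)) ℚ.- (1ℚ ℚ.* 1ℚ ℚ.+ ∑< n (exp b ∘ suc)) ∣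
      ≡⟨ ≡.cong ℚ.∣_∣ (ℚS.solve 2 (λ s t → (con 1ℚ :+ s) :- (con 1ℚ :+ t) := s :- t) ≡.refl (∑< n (exp a ∘ suc)) (∑< n (exp b ∘ suc))) ⟩
    ℚ.∣ ∑< n (exp a ∘ suc) ℚ.- ∑< n (exp b ∘ suc) ∣
      ≤⟨ termwise n ⟩
    ∑< n (λ k → D ℚ.* exp B k)
      ≡⟨ Sums.∑-*ˡ ℚ-semiring D (upTo n) (exp B) ⟨
    D ℚ.* E n B
      ≤⟨ ℚ.*-monoˡ-≤-nonNeg D {{ℚ.∣-∣-nonNeg (a ℚ.- b)}} (∑<-monoˡ (ℕ.n≤1+n n) (0≤exp (ℚ.≤-trans (ℚ.0≤∣p∣ a) a≤B))) ⟩
    D ℚ.* E (suc n) B ∎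
    where
    D : ℚ
    D = ℚ.∣ a ℚ.- b ∣
    termwise : ∀ n → ℚ.∣ ∑< n (exp a ∘ suc) ℚ.- ∑< n (exp b ∘ suc) ∣ ℚ.≤ ∑< n (λ k → D ℚ.* exp B k)
    termwise zero    = ℚ.≤-refl
    termwise (suc n) = begin
      ℚ.∣ ∑< (suc n) (exp a ∘ suc) ℚ.- ∑< (suc n) (exp b ∘ suc) ∣
        ≡⟨ ≡.cong ℚ.∣_∣ (≡.trans (≡.cong₂ ℚ._-_ (∑<-last n (exp a ∘ suc)) (∑<-last n (exp b ∘ suc)))
             (ℚS.solve 4 (λ s x t y → (s :+ x) :- (t :+ y) := (s :- t) :+ (x :- y)) ≡.refl (∑< n (exp a ∘ suc)) (exp a (suc n)) (∑< n (exp b ∘ suc)) (exp b (suc n)))) ⟩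
      ℚ.∣ (∑< n (exp a ∘ suc) ℚ.- ∑< n (exp b ∘ suc)) ℚ.+ (exp a (suc n) ℚ.- exp b (suc n)) ∣
        ≤⟨ ℚ.∣p+q∣≤∣p∣+∣q∣ (∑< n (exp a ∘ suc) ℚ.- ∑< n (exp b ∘ suc)) (exp a (suc n) ℚ.- exp b (suc n)) ⟩
      ℚ.∣ ∑< n (exp a ∘ suc) ℚ.- ∑< n (exp b ∘ suc) ∣ ℚ.+ ℚ.∣ exp a (suc n) ℚ.- exp b (suc n) ∣
        ≤⟨ ℚ.+-mono-≤ (termwise n) (exp-lipschitz a≤B b≤B n) ⟩
      ∑< n (λ k → D ℚ.* exp B k) ℚ.+ D ℚ.* exp B n
        ≡⟨ ∑<-last n (λ k → D ℚ.* exp B k) ⟨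
      ∑< (suc n) (λ k → D ℚ.* exp B k) ∎

  private
    -- Consecutive terms pair to aᵐ/m! (1 + a/(m+1)), nonnegative for even m.
    0≤pair : ∀ {a} j → ℚ.∣ a ∣ ℚ.≤ 1ℚ → 0ℚ ℚ.≤ exp a (j ℕ.+ j) ℚ.+ exp a (suc (j ℕ.+ j))
    0≤even : ∀ {a} j → 0ℚ ℚ.≤ exp a (j ℕ.+ j)
    0≤even {a} j = 0≤*0≤ (ℚ.≤-trans (0≤square (a ^ j)) (ℚ.≤-reflexive (≡.sym (^-homo-* a j j)))) (0≤1/n! (j ℕ.+ j))
    0≤pair {a} j a≤1 = ℚ.≤-trans (0≤*0≤ (0≤even {a} j) 0≤1+a/m)
      (ℚ.≤-reflexive (ℚS.solve 4 (λ a p i f → p :* f :* (con 1ℚ :+ a :* i) := p :* f :+ a :* p :* (i :* f)) ≡.refl a (a ^ m) (1/suc m) (1/n! m)))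
      where
      m : ℕ
      m = j ℕ.+ j
      ∣a/m∣≤1 : ℚ.∣ a ℚ.* 1/suc m ∣ ℚ.≤ 1ℚ
      ∣a/m∣≤1 = begin
        ℚ.∣ a ℚ.* 1/suc m ∣          ≡⟨ ℚ.∣p*q∣≡∣p∣*∣q∣ a (1/suc m) ⟩
        ℚ.∣ a ∣ ℚ.* ℚ.∣ 1/suc m ∣    ≡⟨ ≡.cong (ℚ.∣ a ∣ ℚ.*_) (ℚ.0≤p⇒∣p∣≡p (ℚ.<⇒≤ (0<1/suc m))) ⟩
        ℚ.∣ a ∣ ℚ.* 1/suc m          ≤⟨ *-mono-≤ (ℚ.<⇒≤ (0<1/suc m)) (ℚ.nonNegative⁻¹ 1ℚ) a≤1 (1/suc≤1 m) ⟩
        1ℚ ℚ.* 1ℚ                    ≡⟨⟩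
        1ℚ                           ∎
      0≤1+a/m : 0ℚ ℚ.≤ 1ℚ ℚ.+ a ℚ.* 1/suc m
      0≤1+a/m = ℚ.≤-trans (0≤- (ℚ.≤-trans (-p≤∣p∣ (a ℚ.* 1/suc m)) ∣a/m∣≤1))
        (ℚ.≤-reflexive (ℚS.solve 1 (λ t → con 1ℚ :- :- t := con 1ℚ :+ t) ≡.refl (a ℚ.* 1/suc m)))

    1+a≤E-even : ∀ {a} j → ℚ.∣ a ∣ ℚ.≤ 1ℚ → 1ℚ ℚ.+ a ℚ.≤ E (suc j ℕ.+ suc j) a
    1+a≤E-even {a} zero    a≤1 = ℚ.≤-reflexive
      (≡.trans
      (ℚS.solve 1 (λ a → con 1ℚ :+ a := con 1ℚ :* con 1ℚ :+ (a :* con 1ℚ :* (con 1ℚ :* con 1ℚ) :+ con 0ℚ)) ≡.refl a)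
      (≡.cong (λ i → 1ℚ ℚ.* 1ℚ ℚ.+ (a ℚ.* 1ℚ ℚ.* (i ℚ.* 1ℚ) ℚ.+ 0ℚ)) (≡.sym (1/suc≡ 0))))
    1+a≤E-even {a} (suc j) a≤1 = begin
      1ℚ ℚ.+ a                                                      ≤⟨ 1+a≤E-even j a≤1 ⟩
      E m a                                                         ≤⟨ ≤-by _ (0≤pair (suc j) a≤1) ≡.refl ⟩
      E m a ℚ.+ (exp a m ℚ.+ exp a (suc m))                         ≡⟨ ℚ.+-assoc (E m a) _ _ ⟨
      E m a ℚ.+ exp a m ℚ.+ exp a (suc m)                           ≡⟨ ≡.cong (ℚ._+ exp a (suc m)) (∑<-last m (exp a)) ⟨
      E (suc m) a ℚ.+ exp a (suc m)                                 ≡⟨ ∑<-last (suc m) (exp a) ⟨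
      E (suc (suc m)) a                                             ≡⟨ ≡.cong (λ k → E (suc k) a) (ℕ.+-suc (suc j) (suc j)) ⟨
      E (suc (suc j) ℕ.+ suc (suc j)) a                             ∎
      where
      m : ℕ
      m = suc j ℕ.+ suc j

  private
    parity : ∀ n → ∃ λ j → n ≡ j ℕ.+ j ⊎ n ≡ suc (j ℕ.+ j)
    parity zero    = 0 , inj₁ ≡.refl
    parity (suc n) with parity n
    ... | j , inj₁ eq = j , inj₂ (≡.cong suc eq)
    ... | j , inj₂ eq = suc j , inj₁ (≡.trans (≡.cong suc eq) (≡.cong suc (≡.sym (ℕ.+-suc j j))))

  -- An even number of terms consists of 1 + a and nonnegative pairs; an odd number adds a term with
  -- an even power of a.
  1+a≤E : ∀ {a} n → 2 ℕ.≤ n → ℚ.∣ a ∣ ℚ.≤ 1ℚ → 1ℚ ℚ.+ a ℚ.≤ E n a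
  1+a≤E {a} n 2≤n a≤1 = byParity n 2≤n (parity n)
    where
    byParity : ∀ n → 2 ℕ.≤ n → (∃ λ j → n ≡ j ℕ.+ j ⊎ n ≡ suc (j ℕ.+ j)) → 1ℚ ℚ.+ a ℚ.≤ E n a
    byParity n 2≤n        (suc j , inj₁ ≡.refl) = 1+a≤E-even j a≤1
    byParity n 2≤n        (suc j , inj₂ ≡.refl) = ℚ.≤-trans (1+a≤E-even j a≤1)
      (≤-by (exp a (suc j ℕ.+ suc j)) (0≤even {a} (suc j)) (∑<-last (suc j ℕ.+ suc j) (exp a)))
    byParity n ()         (zero , inj₁ ≡.refl)
    byParity n (ℕ.s≤s ()) (zero , inj₂ ≡.refl)

-- The exponential function on Cauchy reals

module RealExponential where
  open Fractions using (_^_)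
  open ℚ-Order
  open ExponentialSums
  open RealRing using (bounded; flip; halves; pointwise)
  open ℚ.≤-Reasoning
  private
    module ℚS = +-*-Solver
    open ℚS using (_:+_; _:*_; _:-_; :-_; _:=_; con)

    E-close : ∀ {a b B C δ ε} → ℚ.∣ a ∣ ℚ.≤ B → ℚ.∣ b ∣ ℚ.≤ B → 0ℚ ℚ.≤ δ → (∀ n → E n B ℚ.≤ C) → C ℚ.* δ ≡ ε →
              ℚ.∣ a ℚ.- b ∣ ℚ.≤ δ → ∀ n → ℚ.∣ E n a ℚ.- E n b ∣ ℚ.≤ ε
    E-close {a} {b} {B} {C} {δ} {ε} a≤B b≤B 0≤δ E≤C eq ab n = begin
      ℚ.∣ E n a ℚ.- E n b ∣        ≤⟨ E-lipschitz n a≤B b≤B ⟩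
      ℚ.∣ a ℚ.- b ∣ ℚ.* E n B      ≤⟨ ℚ.*-monoˡ-≤-nonNeg ℚ.∣ a ℚ.- b ∣ {{ℚ.∣-∣-nonNeg (a ℚ.- b)}} (E≤C n) ⟩
      ℚ.∣ a ℚ.- b ∣ ℚ.* C          ≤⟨ ℚ.*-monoʳ-≤-nonNeg C {{ℚ.nonNegative 0≤C}} ab ⟩
      δ ℚ.* C                      ≡⟨ ≡.trans (ℚ.*-comm δ C) eq ⟩
      ε                            ∎
      where
      0≤C : 0ℚ ℚ.≤ C
      0≤C = E≤C 0

  -- A diagonal sequence: the n-th partial sum at the n-th approximation. It is Cauchy by comparison
  -- of E m x_m and E n x_n with E m x_n: the Lipschitz bound covers the change of argument, the
  -- tail bound the change of length.
  expʳ : ℝ → ℝ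
  seq (expʳ x) n = E n (seq x n)
  cauchy (expʳ x) ε 0<ε =
    let B , 0<B , K , hK = bounded x
        C , 0<C , E≤C = E-bounded (ℚ.<⇒≤ 0<B)
        δ , 0<δ , Cδ = divide (½ ℚ.* ε) 0<C (half-pos 0<ε)
        N , hN = E-tail-null (ℚ.<⇒≤ 0<B) (½ ℚ.* ε) (half-pos 0<ε)
        M , hM = cauchy x δ 0<δ
        J , hJ = eventually-× {λ n → ℚ.∣ seq x n ∣ ℚ.≤ B} (K , hK)
                 (eventually-× {λ k → ∀ n → k ℕ.≤ n → E n B ℚ.- E k B ℚ.≤ ½ ℚ.* ε} {λ n → M ℕ.≤ n} (N , hN) (M , λ n le → le))
        ordered : ∀ m n → J ℕ.≤ m → J ℕ.≤ n → m ℕ.≤ n → ℚ.∣ E m (seq x m) ℚ.- E n (seq x n) ∣ ℚ.≤ ε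
        ordered m n Jm Jn m≤n = halves {E m (seq x m) ℚ.- E m (seq x n)} {E m (seq x n) ℚ.- E n (seq x n)}
          (ℚS.solve 3 (λ a b c → a :- c := (a :- b) :+ (b :- c)) ≡.refl (E m (seq x m)) (E m (seq x n)) (E n (seq x n)))
          (E-close (proj₁ (hJ m Jm)) (proj₁ (hJ n Jn)) (ℚ.<⇒≤ 0<δ) E≤C Cδ
            (hM m n (proj₂ (proj₂ (hJ m Jm))) (proj₂ (proj₂ (hJ n Jn)))) m)
          (ℚ.≤-trans (ℚ.≤-reflexive (flip (E m (seq x n)) (E n (seq x n))))
            (ℚ.≤-trans (E-tail (proj₁ (hJ n Jn)) m≤n) (proj₁ (proj₂ (hJ m Jm)) n m≤n)))
    in J , λ m n Jm Jn → [ ordered m n Jm Jn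
                         , (λ n≤m → ℚ.≤-trans (ℚ.≤-reflexive (flip (E m (seq x m)) (E n (seq x n)))) (ordered n m Jn Jm n≤m))
                         ]′ (ℕ.≤-total m n)

  expʳ-cong : ∀ {x y} → x ≈ʳ y → expʳ x ≈ʳ expʳ y
  expʳ-cong {x} {y} x≈y ε 0<ε =
    let A , 0<A , hA = bounded x
        B , 0<B , hB = bounded y
        C , 0<C , E≤C = E-bounded (ℚ.<⇒≤ (0<+0≤ 0<A (ℚ.<⇒≤ 0<B)))
        δ , 0<δ , Cδ = divide ε 0<C 0<ε
    in eventually-map
      (λ n (xA , yB , xy) → E-close
        (ℚ.≤-trans xA (≤-by B (ℚ.<⇒≤ 0<B) ≡.refl)) (ℚ.≤-trans yB (≤-by A (ℚ.<⇒≤ 0<A) (ℚ.+-comm A B)))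
        (ℚ.<⇒≤ 0<δ) E≤C Cδ xy n)
      (eventually-× hA (eventually-× hB (x≈y δ 0<δ)))

  expʳ-+ : ∀ x y → expʳ (x +ʳ y) ≈ʳ expʳ x *ʳ expʳ y
  expʳ-+ x y ε 0<ε =
    let A , 0<A , hA = bounded x
        B , 0<B , hB = bounded y
        M = A ℚ.+ B
        0≤M = ℚ.<⇒≤ (0<+0≤ 0<A (ℚ.<⇒≤ 0<B))
    in eventually-map
      (λ n (xA , yB , tail) → ℚ.≤-trans (ℚ.≤-reflexive (flip (E n (seq x n ℚ.+ seq y n)) (E n (seq x n) ℚ.* E n (seq y n))))
        (ℚ.≤-trans (E-+ {B = M} n (ℚ.≤-trans xA (≤-by B (ℚ.<⇒≤ 0<B) ≡.refl)) (ℚ.≤-trans yB (≤-by A (ℚ.<⇒≤ 0<A) (ℚ.+-comm A B))))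
          (tail (n ℕ.+ n) (ℕ.m≤m+n n n))))
      (eventually-× hA (eventually-× hB (E-tail-null (0≤+0≤ 0≤M 0≤M) ε 0<ε)))

  1+x≤expʳ : ∀ x → ∣ x ∣ʳ ≤ʳ fromℚ ½ → 1ʳ +ʳ x ≤ʳ expʳ x
  1+x≤expʳ x x≤½ ε 0<ε = eventually-map
    (λ n (2≤n , xn) → ℚ.≤-trans (1+a≤E n 2≤n xn) (≤-by ε (ℚ.<⇒≤ 0<ε) ≡.refl))
    -- |x| ≤ ½ holds for the terms up to a slack, here ½, which gives |x_n| ≤ 1 as `1+a≤E` requires;
    -- from n = 2 on, the partial sum contains the linear term.
    (eventually-× (2 , λ n le → le) (x≤½ ½ (ℚ.positive⁻¹ ½)))

  private
    seq-^ : ∀ x k n → seq (x Opsʳ.^ k) n ≡ seq x n ^ k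
    seq-^ x zero    n = ≡.refl
    seq-^ x (suc k) n = ≡.cong (seq x n ℚ.*_) (seq-^ x k n)

    seq-∑ : ∀ n ks (f : ℕ → ℝ) (g : ℕ → ℚ) → (∀ k → seq (f k) n ≡ g k) →
      seq (Opsʳ.∑ ks f) n ≡ Sums.∑ Fractions.ℚ-semiring ks g
    seq-∑ n []       f g f≡g = ≡.refl
    seq-∑ n (k ∷ ks) f g f≡g = ≡.cong₂ ℚ._+_ (f≡g k) (seq-∑ n ks f g f≡g)

    partialSum : ℝ → ℕ → ℝ
    partialSum x N = Opsʳ.∑ (upTo N) λ k → x Opsʳ.^ k *ʳ fromℚ (1/fact k)

    seq-partialSum : ∀ x N n → seq (partialSum x N) n ≡ E N (seq x n)
    seq-partialSum x N n = seq-∑ n (upTo N) (λ k → x Opsʳ.^ k *ʳ fromℚ (1/fact k)) (exp (seq x n)) λ k → ≡.cong₂ ℚ._*_ (seq-^ x k n) (≡.sym (1/n!≡ k))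

  partialSum⟶expʳ : ∀ x → partialSum x ⟶ʳ expʳ x
  partialSum⟶expʳ x ε 0<ε =
    let B , 0<B , K , hK = bounded x
    in eventually-map
      (λ N tail η 0<η → K ℕ.⊔ N , λ n le → begin
        ℚ.∣ seq (partialSum x N) n ℚ.- E n (seq x n) ∣
          ≡⟨ ≡.trans (≡.cong (λ t → ℚ.∣ t ℚ.- E n (seq x n) ∣) (seq-partialSum x N n)) (flip (E N (seq x n)) (E n (seq x n))) ⟩
        ℚ.∣ E n (seq x n) ℚ.- E N (seq x n) ∣
          ≤⟨ E-tail (hK n (ℕ.≤-trans (ℕ.m≤m⊔n K N) le)) (ℕ.≤-trans (ℕ.m≤n⊔m K N) le) ⟩
        E n B ℚ.- E N B
          ≤⟨ tail n (ℕ.≤-trans (ℕ.m≤n⊔m K N) le) ⟩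
        ε
          ≤⟨ ≤-by η (ℚ.<⇒≤ 0<η) ≡.refl ⟩
        ε ℚ.+ η ∎)
      (E-tail-null (ℚ.<⇒≤ 0<B) ε 0<ε)

  isExp⇒≈ : ∀ {x y} → IsExp x y → y ≈ʳ expʳ x
  isExp⇒≈ {x} {y} h = Limits.lim-unique RealRing.archimedeanRing {partialSum x} {y} {expʳ x} h (partialSum⟶expʳ x)

-- The inequality 1 + x ≤ exp x for all x

module ExponentialBound (A : ArchimedeanRing) where
  open ArchimedeanRing A
  open Limits A
  open Solver

  -- The facts about exp that the treatment of Γ starts from; nonnegativity, exp 0 = 1 and
  -- injectivity are derived from them.
  record IsExponential (exp : Carrier → Carrier) : Set where
    field
      exp-cong : ∀ {x y} → x ≈ y → exp x ≈ exp y
      exp-+    : ∀ x y → exp (x + y) ≈ exp x * exp y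
      1+x≤exp  : ∀ x → 1# + x ≤ exp x

  module _ (exp : Carrier → Carrier) (exp-cong : ∀ {x y} → x ≈ y → exp x ≈ exp y)
    (exp-+ : ∀ x y → exp (x + y) ≈ exp x * exp y)
    (small : ∀ x → ∣ x ∣ ≤ ι ½ → 1# + x ≤ exp x) where

    private
      radius : ℕ → ℚ
      radius zero    = ½
      radius (suc k) = radius k ℚ.+ radius k

      ½≤radius : ∀ k → ½ ℚ.≤ radius k
      ½≤radius zero    = ℚ.≤-refl
      ½≤radius (suc k) = ℚ.≤-trans (½≤radius k)
        (ℚ-Order.≤-by (radius k) (ℚ.≤-trans (ℚ.nonNegative⁻¹ ½) (½≤radius k)) ≡.refl)

      radius-unbounded : ∀ k → ½ ℚ.* Fractions.fromNat k ℚ.≤ radius k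
      radius-unbounded zero    = ℚ.nonNegative⁻¹ ½
      radius-unbounded (suc k) = ℚ.≤-trans
        (ℚ.≤-reflexive (≡.trans (≡.cong (½ ℚ.*_) (Fractions.fromNat-suc k)) (ℚ.*-distribˡ-+ ½ 1ℚ (Fractions.fromNat k))))
        (ℚ.+-mono-≤ (½≤radius k) (radius-unbounded k))

      -- t² ≥ 2t − 1 lets the bound pass from x/2 to x.
      within : ∀ k x → ∣ x ∣ ≤ ι (radius k) → ι 1ℚ + x ≤ exp x
      within zero    x x≤ = ≤-respˡ (+-congʳ (sym ι-1)) (small x x≤)
      within (suc k) x x≤ = ≤-respʳ (trans (sym (exp-+ y y)) (exp-cong y+y))
        (≤-by ((t - ι 1ℚ) * (t - ι 1ℚ) + ((t - (ι 1ℚ + y)) + (t - (ι 1ℚ + y))))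
          (0≤+0≤ (0≤x² _) (0≤+0≤ (0≤- 1+y≤t) (0≤- 1+y≤t)))
          (trans (solve 2 (λ y t → t :* t := con 1ℚ :+ (y :+ y)
              :+ ((t :- con 1ℚ) :* (t :- con 1ℚ) :+ ((t :- (con 1ℚ :+ y)) :+ (t :- (con 1ℚ :+ y))))) refl y t)
            (+-congʳ (+-congˡ y+y))))
        where
        y t : Carrier
        y = ι ½ * x
        t = exp y
        y+y : y + y ≈ x
        y+y = trans (solve 1 (λ x → con ½ :* x :+ con ½ :* x := con 1ℚ :* x) refl x) (trans (*-congʳ ι-1) (*-identityˡ x))
        half≤ : ∀ {z} → z ≤ ι (radius (suc k)) → ι ½ * z ≤ ι (radius k)
        half≤ z≤ = ≤-respʳ (trans (sym (ι-* ½ _)) (reflexive (≡.cong ι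
            (≡.trans (ℚ.*-distribˡ-+ ½ (radius k) (radius k)) (ℚ-Order.half+half (radius k))))))
          (*-monoˡ-≤ (0≤ι (ℚ.nonNegative⁻¹ ½)) z≤)
        1+y≤t : ι 1ℚ + y ≤ t
        1+y≤t = within k y (∣∣≤ (half≤ (≤-trans (x≤∣x∣ x) x≤))
          (≤-respˡ (solve 1 (λ x → con ½ :* (:- x) := :- (con ½ :* x)) refl x) (half≤ (≤-trans (-x≤∣x∣ x) x≤))))

    exponential-bound : ∀ x → 1# + x ≤ exp x
    exponential-bound x with bounded x
    ... | B , 0<B , x≤B = ≤-respˡ (+-congʳ ι-1) (within k x (≤-trans x≤B (ι-mono (ℚ.≤-trans B≤ (radius-unbounded k)))))
      where
      k : ℕ
      k = proj₁ (Fractions.archimedean (B ℚ.+ B))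
      B≤ : B ℚ.≤ ½ ℚ.* Fractions.fromNat k
      B≤ = ℚ.≤-trans (ℚ.≤-reflexive (≡.sym (≡.trans (ℚ.*-distribˡ-+ ½ B B) (ℚ-Order.half+half B))))
        (ℚ.*-monoˡ-≤-nonNeg ½ (proj₂ (Fractions.archimedean (B ℚ.+ B))))

    isExponential : IsExponential exp
    isExponential = record { exp-cong = exp-cong ; exp-+ = exp-+ ; 1+x≤exp = exponential-bound }

-- Euler's limit for Γ

module Reciprocals where
  open Fractions
  open ℚ-Order
  open Sums ℚ-semiring public using (∑; ∑<)
  open ℚ.≤-Reasoning
  private
    module ℚS = +-*-Solver
    open ℚS using (_:+_; _:*_; _:-_; :-_; _:=_; con)

  *-invℚ : ∀ {p} → 0ℚ ℚ.< p → p ℚ.* invℚ p ≡ 1ℚ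
  *-invℚ {p} 0<p with p ℚ.≟ 0ℚ
  ... | yes p≡0 = contradiction (≡.sym p≡0) (ℚ.<⇒≢ 0<p)
  ... | no  p≢0 = ℚ.*-inverseʳ p {{ℚ.≢-nonZero p≢0}}

  invℚ-unique : ∀ {p q} → 0ℚ ℚ.< p → p ℚ.* q ≡ 1ℚ → invℚ p ≡ q
  invℚ-unique {p} 0<p pq = *-cancelˡ p 0<p (≡.trans (*-invℚ 0<p) (≡.sym pq))

  0<invℚ : ∀ {p} → 0ℚ ℚ.< p → 0ℚ ℚ.< invℚ p
  0<invℚ {p} 0<p = let q , 0<q , pq = divide 1ℚ 0<p (ℚ.positive⁻¹ 1ℚ) in
    ≡.subst (0ℚ ℚ.<_) (≡.sym (invℚ-unique 0<p pq)) 0<q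

  r : ℚ → ℕ → ℚ
  r y i = invℚ (y ℚ.+ fromNat i)

  module _ {y} (0<y : 0ℚ ℚ.< y) where

    0<y+i : ∀ i → 0ℚ ℚ.< y ℚ.+ fromNat i
    0<y+i i = 0<+0≤ 0<y (0≤fromNat i)

    0<r : ∀ i → 0ℚ ℚ.< r y i
    0<r i = 0<invℚ (0<y+i i)

    *-r : ∀ i → (y ℚ.+ fromNat i) ℚ.* r y i ≡ 1ℚ
    *-r i = *-invℚ (0<y+i i)

  -- The difference of the reciprocals in multiplicative form: the factor 1 + (z - y)/(y + i) is
  -- what 1 + u ≤ exp u is applied to in `∏-≤`.
  r-difference : ∀ {y z} → 0ℚ ℚ.< y → 0ℚ ℚ.< z → ∀ i → r y i ≡ r z i ℚ.* (1ℚ ℚ.+ (z ℚ.- y) ℚ.* r y i)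
  r-difference {y} {z} 0<y 0<z i = begin-equality
    a                                      ≡⟨ ℚ.*-identityˡ a ⟨
    1ℚ ℚ.* a                               ≡⟨ ≡.cong (ℚ._* a) (*-r 0<z i) ⟨
    (z ℚ.+ fromNat i) ℚ.* b ℚ.* a          ≡⟨ ℚS.solve 5 (λ a b y z n → (z :+ n) :* b :* a := b :* ((y :+ n) :* a :+ (z :- y) :* a)) ≡.refl a b y z (fromNat i) ⟩
    b ℚ.* ((y ℚ.+ fromNat i) ℚ.* a ℚ.+ (z ℚ.- y) ℚ.* a)
                                           ≡⟨ ≡.cong (λ t → b ℚ.* (t ℚ.+ (z ℚ.- y) ℚ.* a)) (*-r 0<y i) ⟩
    b ℚ.* (1ℚ ℚ.+ (z ℚ.- y) ℚ.* a)         ∎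
    where
    a b : ℚ
    a = r y i
    b = r z i

  -- The graph of x ↦ (x + i)⁻ᵏ lies above its tangent at y.
  r^-tangent : ∀ {y z} → 0ℚ ℚ.< y → 0ℚ ℚ.< z → ∀ i k →
    r y i ^ k ℚ.+ (z ℚ.- y) ℚ.* (ℚ.- fromNat k ℚ.* r y i ^ suc k) ℚ.≤ r z i ^ k
  r^-tangent {y} {z} 0<y 0<z i zero = ℚ.≤-reflexive
    (ℚS.solve 2 (λ h a → con 1ℚ :+ h :* (:- con 0ℚ :* a) := con 1ℚ) ≡.refl (z ℚ.- y) (r y i ^ 1))
  r^-tangent {y} {z} 0<y 0<z i (suc k) = ≤-by
    -- The gap is b times the gap for k, plus (k+1) h² aᵏ⁺² b, the second-order remainder that
    -- appears when a is replaced once by b (1 + h a).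
    (b ℚ.* (b ^ k ℚ.- (a ^ k ℚ.+ h ℚ.* (ℚ.- K ℚ.* a ^ suc k))) ℚ.+ a ^ k ℚ.* ((1ℚ ℚ.+ K) ℚ.* (h ℚ.* a ℚ.* (h ℚ.* a) ℚ.* b)))
    (0≤+0≤ (0≤*0≤ (ℚ.<⇒≤ (0<r 0<z i)) (0≤- (r^-tangent 0<y 0<z i k)))
           (0≤*0≤ (0≤^ k (ℚ.<⇒≤ (0<r 0<y i))) (0≤*0≤ (0≤+0≤ (ℚ.nonNegative⁻¹ 1ℚ) (0≤fromNat k))
             (0≤*0≤ (0≤square (h ℚ.* a)) (ℚ.<⇒≤ (0<r 0<z i))))))
    (begin-equality
      b ℚ.* b ^ k
        ≡⟨ ℚS.solve 6 (λ a b h K p q → b :* q :=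
             ((b :* (con 1ℚ :+ h :* a)) :* p :+ h :* (:- (con 1ℚ :+ K) :* ((b :* (con 1ℚ :+ h :* a)) :* (a :* p))))
             :+ (b :* (q :- (p :+ h :* (:- K :* (a :* p)))) :+ p :* ((con 1ℚ :+ K) :* (h :* a :* (h :* a) :* b))))
             ≡.refl a b h K (a ^ k) (b ^ k) ⟩
      (c ℚ.* a ^ k ℚ.+ h ℚ.* (ℚ.- (1ℚ ℚ.+ K) ℚ.* (c ℚ.* (a ℚ.* a ^ k)))) ℚ.+ rest
        ≡⟨ ≡.cong₂ (λ c K′ → (c ℚ.* a ^ k ℚ.+ h ℚ.* (ℚ.- K′ ℚ.* (c ℚ.* (a ℚ.* a ^ k)))) ℚ.+ rest)
             (≡.sym (r-difference 0<y 0<z i)) (≡.sym (fromNat-suc k)) ⟩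
      (a ℚ.* a ^ k ℚ.+ h ℚ.* (ℚ.- fromNat (suc k) ℚ.* (a ℚ.* (a ℚ.* a ^ k)))) ℚ.+ rest ∎)
    where
    a b c h K rest : ℚ
    a = r y i
    b = r z i
    h = z ℚ.- y
    K = fromNat k
    c = b ℚ.* (1ℚ ℚ.+ h ℚ.* a)
    rest = b ℚ.* (b ^ k ℚ.- (a ^ k ℚ.+ h ℚ.* (ℚ.- K ℚ.* a ^ suc k))) ℚ.+ a ^ k ℚ.* ((1ℚ ℚ.+ K) ℚ.* (h ℚ.* a ℚ.* (h ℚ.* a) ℚ.* b))

  p : ℕ → ℕ → ℚ → ℚ
  p k n y = ∑< (suc n) (λ i → r y i ^ k)

  p-tangent : ∀ {y z} → 0ℚ ℚ.< y → 0ℚ ℚ.< z → ∀ k n →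
    p k n y ℚ.+ (z ℚ.- y) ℚ.* (ℚ.- fromNat k ℚ.* p (suc k) n y) ℚ.≤ p k n z
  p-tangent {y} {z} 0<y 0<z k n = go (upTo (suc n))
    where
    go : ∀ is → ∑ is (λ i → r y i ^ k) ℚ.+ (z ℚ.- y) ℚ.* (ℚ.- fromNat k ℚ.* ∑ is (λ i → r y i ^ suc k))
                ℚ.≤ ∑ is (λ i → r z i ^ k)
    go []       = ℚ.≤-reflexive (ℚS.solve 2 (λ h k → con 0ℚ :+ h :* (:- k :* con 0ℚ) := con 0ℚ) ≡.refl (z ℚ.- y) (fromNat k))
    go (i ∷ is) = ℚ.≤-trans (ℚ.≤-reflexive
      (ℚS.solve 6 (λ a s h k b t → (a :+ s) :+ h :* (:- k :* (b :+ t)) := (a :+ h :* (:- k :* b)) :+ (s :+ h :* (:- k :* t))) ≡.refl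
        (r y i ^ k) (∑ is (λ i → r y i ^ k)) (z ℚ.- y) (fromNat k) (r y i ^ suc k) (∑ is (λ i → r y i ^ suc k))))
      (ℚ.+-mono-≤ (r^-tangent 0<y 0<z i k) (go is))

  P : ℕ → ℚ → ℚ
  P n y = List.foldr (λ i s → r y i ℚ.* s) 1ℚ (upTo (suc n))

  -- The open unit interval contains all points j/q; its upper end supplies the lower bound `½≤G`.
  InUnit : ℚ → Set
  InUnit y = 0ℚ ℚ.< y × y ℚ.< 1ℚ

  neighbourhood : ∀ {y} → InUnit y → ∃ λ η → 0ℚ ℚ.< η × (∀ h → ℚ.∣ h ∣ ℚ.≤ η → InUnit (y ℚ.+ h))
  neighbourhood {y} (0<y , y<1) =
    let m , 0<m , m≤y , m≤1-y = minimum 0<y 0<1-y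
    in ½ ℚ.* m , half-pos 0<m , λ h h≤ →
      let ½m<m = ℚ.<-≤-trans (ℚ.<-respˡ-≡ (ℚ.+-identityʳ (½ ℚ.* m)) (ℚ.+-monoʳ-< (½ ℚ.* m) (half-pos 0<m))) (ℚ.≤-reflexive (half+half m))
          ∣h∣<m = ℚ.≤-<-trans h≤ ½m<m
      in ℚ.<-respˡ-≡ (ℚ.+-inverseʳ y) (ℚ.+-monoʳ-< y (ℚ.<-≤-trans
           (ℚ.neg-antimono-< (ℚ.≤-<-trans (-p≤∣p∣ h) (ℚ.<-≤-trans ∣h∣<m m≤y))) (ℚ.≤-reflexive (ℚS.solve 1 (λ h → :- :- h := h) ≡.refl h))))
       , ℚ.<-respʳ-≡ (ℚS.solve 1 (λ y → y :+ (con 1ℚ :- y) := con 1ℚ) ≡.refl y) (ℚ.+-monoʳ-< y (ℚ.≤-<-trans (p≤∣p∣ h) (ℚ.<-≤-trans ∣h∣<m m≤1-y)))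
    where
    0<1-y : 0ℚ ℚ.< 1ℚ ℚ.- y
    0<1-y = ℚ.<-respˡ-≡ (ℚ.+-inverseʳ y) (ℚ.+-monoˡ-< (ℚ.- y) y<1)

  P-suc : ∀ n y → P (suc n) y ≡ P n y ℚ.* r y (suc n)
  P-suc n y = ≡.trans (≡.cong (List.foldr (λ i s → r y i ℚ.* s) 1ℚ) (≡.sym (upTo-∷ʳ (suc n)))) (go (upTo (suc n)))
    where
    go : ∀ is → List.foldr (λ i s → r y i ℚ.* s) 1ℚ (is List.∷ʳ suc n) ≡ List.foldr (λ i s → r y i ℚ.* s) 1ℚ is ℚ.* r y (suc n)
    go []       = ℚ.*-comm (r y (suc n)) 1ℚ
    go (i ∷ is) = ≡.trans (≡.cong (r y i ℚ.*_) (go is)) (≡.sym (ℚ.*-assoc (r y i) _ _))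

  fromNat-suc-*-r : ∀ i → fromNat (suc i) ℚ.* r 1ℚ i ≡ 1ℚ
  fromNat-suc-*-r i = ≡.trans (≡.cong (ℚ._* r 1ℚ i) (fromNat-suc i)) (*-r (ℚ.positive⁻¹ 1ℚ) i)

  P-factorial : ∀ n → fromNat (suc n !) ℚ.* P n 1ℚ ≡ 1ℚ
  P-factorial zero    = ≡.refl
  P-factorial (suc n) = begin-equality
    fromNat (suc (suc n) !) ℚ.* P (suc n) 1ℚ
      ≡⟨ ≡.cong₂ ℚ._*_ (fromNat-* (suc (suc n)) (suc n !)) (P-suc n 1ℚ) ⟩
    fromNat (suc (suc n)) ℚ.* fromNat (suc n !) ℚ.* (P n 1ℚ ℚ.* r 1ℚ (suc n))
      ≡⟨ ℚS.solve 4 (λ a b c d → a :* b :* (c :* d) := (b :* c) :* (a :* d)) ≡.refl (fromNat (suc (suc n))) (fromNat (suc n !)) (P n 1ℚ) (r 1ℚ (suc n)) ⟩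
    (fromNat (suc n !) ℚ.* P n 1ℚ) ℚ.* (fromNat (suc (suc n)) ℚ.* r 1ℚ (suc n))
      ≡⟨ ≡.cong₂ ℚ._*_ (P-factorial n) (fromNat-suc-*-r (suc n)) ⟩
    1ℚ ∎

  -- n! n P n 1 = n / (n + 1)
  ½≤n!nP : ∀ n → 1 ℕ.≤ n → ½ ℚ.≤ fromNat (n !) ℚ.* fromNat n ℚ.* P n 1ℚ
  ½≤n!nP n@(suc m) _ = ≤-by (½ ℚ.* (fromNat (n !) ℚ.* fromNat m ℚ.* P n 1ℚ))
    (0≤*0≤ (ℚ.nonNegative⁻¹ ½) (0≤*0≤ (0≤*0≤ (0≤fromNat (n !)) (0≤fromNat m)) (0≤P n)))
    (begin-equality
      A ℚ.* fromNat n ℚ.* P n 1ℚ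
        ≡⟨ ≡.cong (λ t → A ℚ.* t ℚ.* P n 1ℚ) (fromNat-suc m) ⟩
      A ℚ.* (1ℚ ℚ.+ fromNat m) ℚ.* P n 1ℚ
        ≡⟨ ℚS.solve 3 (λ a m p → a :* (con 1ℚ :+ m) :* p := con ½ :* ((con 1ℚ :+ (con 1ℚ :+ m)) :* a :* p) :+ con ½ :* (a :* m :* p)) ≡.refl A (fromNat m) (P n 1ℚ) ⟩
      ½ ℚ.* ((1ℚ ℚ.+ (1ℚ ℚ.+ fromNat m)) ℚ.* A ℚ.* P n 1ℚ) ℚ.+ ½ ℚ.* (A ℚ.* fromNat m ℚ.* P n 1ℚ)
        ≡⟨ ≡.cong (λ t → ½ ℚ.* (t ℚ.* P n 1ℚ) ℚ.+ ½ ℚ.* (A ℚ.* fromNat m ℚ.* P n 1ℚ))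
             (≡.trans (≡.cong (ℚ._* A) (≡.trans (≡.cong (1ℚ ℚ.+_) (≡.sym (fromNat-suc m))) (≡.sym (fromNat-suc n)))) (≡.sym (fromNat-* (suc n) (n !)))) ⟩
      ½ ℚ.* (fromNat (suc n !) ℚ.* P n 1ℚ) ℚ.+ ½ ℚ.* (A ℚ.* fromNat m ℚ.* P n 1ℚ)
        ≡⟨ ≡.cong (λ t → ½ ℚ.* t ℚ.+ ½ ℚ.* (A ℚ.* fromNat m ℚ.* P n 1ℚ)) (P-factorial n) ⟩
      ½ ℚ.+ ½ ℚ.* (A ℚ.* fromNat m ℚ.* P n 1ℚ) ∎)
    where
    A : ℚ
    A = fromNat (n !)
    0≤P : ∀ n → 0ℚ ℚ.≤ P n 1ℚ
    0≤P n = go (upTo (suc n))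
      where
      go : ∀ is → 0ℚ ℚ.≤ List.foldr (λ i s → r 1ℚ i ℚ.* s) 1ℚ is
      go []       = ℚ.nonNegative⁻¹ 1ℚ
      go (i ∷ is) = 0≤*0≤ (ℚ.<⇒≤ (0<r (ℚ.positive⁻¹ 1ℚ) i)) (go is)

module GammaCoefficients where
  -- (−1)^{j+1} / j!
  coefficient : ℕ → ℚ
  coefficient zero    = ℚ.- 1ℚ
  coefficient (suc j) = ℚ.- Fractions.1/suc j ℚ.* coefficient j

  sign : ℕ → ℚ
  sign i = (ℚ.- 1ℚ) Fractions.^ i

  -- The sign (-1)ⁱ from the logarithmic derivative of ∏ (1 + t χ(k)/k) meets (-1)ⁱ⁺¹/i! from the
  -- polygamma limit. The result -1/i! is the coefficient in the logarithmic derivative of the Bell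
  -- exponential.
  sign-coefficient : ∀ i → sign i ℚ.* coefficient i ≡ ℚ.- 1/fact i
  sign-coefficient zero    = ≡.refl
  sign-coefficient (suc i) = ≡.trans
    (ℚS.solve 3 (λ s i c → (ℚS.:- ℚS.con 1ℚ) ℚS.:* s ℚS.:* (ℚS.:- i ℚS.:* c) ℚS.:= i ℚS.:* (s ℚS.:* c)) ≡.refl (sign i) (Fractions.1/suc i) (coefficient i))
    (≡.trans (≡.cong (Fractions.1/suc i ℚ.*_) (sign-coefficient i))
      (≡.trans (≡.sym (ℚ.neg-distribʳ-* (Fractions.1/suc i) (1/fact i))) (≡.cong ℚ.-_ (Fractions.1/fact-suc i))))
    where module ℚS = +-*-Solver

-- Digamma and polygamma values as limits

module GammaLimits (A : ArchimedeanRing) (exp : ArchimedeanRing.Carrier A → ArchimedeanRing.Carrier A)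
  (isExponential : ExponentialBound.IsExponential A exp) where
  open ArchimedeanRing A
  open Limits A
  open ExponentialBound.IsExponential isExponential
  open Reciprocals using (r; 0<r; r-difference; p; P; p-tangent; InUnit; neighbourhood)
  open Fractions using (fromNat)
  open GammaCoefficients
  open Solver

  0≤exp : ∀ x → 0# ≤ exp x
  0≤exp x = ≤-respʳ (trans (sym (exp-+ y y)) (exp-cong y+y)) (0≤x² (exp y))
    where
    y : Carrier
    y = ι ½ * x
    y+y : y + y ≈ x
    y+y = trans (solve 1 (λ x → con ½ :* x :+ con ½ :* x := con 1ℚ :* x) refl x) (trans (*-congʳ ι-1) (*-identityˡ x))

  -- Put e = exp 0. From e² = e follows 1 - e = (e - 1)² ≥ 0, and 1 ≤ e is the tangent inequality at
  -- 0; no cancellation of e is involved.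
  exp-0 : exp 0# ≈ 1#
  exp-0 = trans (≤-antisym (≤-by ((e - ι 1ℚ) * (e - ι 1ℚ)) (0≤x² _)
      (trans (solve 1 (λ e → con 1ℚ := e :+ (e :+ (con 1ℚ :- e :- e))) refl e)
        (+-congˡ (trans (+-congʳ (sym e*e)) (solve 1 (λ e → e :* e :+ (con 1ℚ :- e :- e) := (e :- con 1ℚ) :* (e :- con 1ℚ)) refl e)))))
    (≤-respˡ (trans (+-identityʳ 1#) (sym ι-1)) (1+x≤exp 0#))) ι-1
    where
    e : Carrier
    e = exp 0#
    e*e : e * e ≈ e
    e*e = trans (sym (exp-+ 0# 0#)) (exp-cong (+-identityˡ 0#))

  -- 1 + (a - b) ≤ exp (a - b) = exp a exp (-b) ≤ exp b exp (-b) = 1.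
  exp-cancel-≤ : ∀ {a b} → exp a ≤ exp b → a ≤ b
  exp-cancel-≤ {a} {b} ea≤eb = ≤-by (1# - (1# + (a - b)))
    (0≤- (≤-trans (1+x≤exp (a - b)) (≤-respˡ (sym (exp-+ a (- b))) (≤-respʳ
      (trans (sym (exp-+ b (- b))) (trans (exp-cong (-‿inverseʳ b)) exp-0))
      (*-mono-≤ (0≤exp (- b)) (0≤exp b) ea≤eb ≤-refl)))))
    (solve 3 (λ a b o → b := a :+ (o :- (o :+ (a :- b)))) refl a b 1#)

  exp-injective : ∀ {a b} → exp a ≈ exp b → a ≈ b
  exp-injective ea≈eb = ≤-antisym (exp-cancel-≤ (≤-reflexive ea≈eb)) (exp-cancel-≤ (≤-reflexive (sym ea≈eb)))

  -- n + 2 is the telescoping product of 1 + 1/i over 1 ≤ i ≤ n+1, and each factor is at most exp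
  -- (1/i).
  n+2≤exp-p : ∀ n → ι (fromNat (suc (suc n))) ≤ exp (ι (p 1 n 1ℚ))
  n+2≤exp-p n = go (suc n)
    where
    module ℚS = +-*-Solver
    s : ℕ → ℚ
    s m = Reciprocals.∑< m (λ i → r 1ℚ i Fractions.^ 1)
    go : ∀ m → ι (fromNat (suc m)) ≤ exp (ι (s m))
    go zero    = ≤-reflexive (trans ι-1 (trans (sym exp-0) (exp-cong (sym ι-0))))
    go (suc m) = ≤-respʳ (trans (sym (exp-+ _ _)) (exp-cong (trans (sym (ι-+ _ _))
        (reflexive (≡.cong ι (≡.trans (≡.cong (s m ℚ.+_) (≡.sym (ℚ.*-identityʳ (r 1ℚ m)))) (≡.sym (Sums.∑<-last Fractions.ℚ-semiring m (λ i → r 1ℚ i Fractions.^ 1)))))))))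
      (≤-trans (≤-reflexive (trans (reflexive (≡.cong ι factorise)) (trans (ι-* _ _) (*-congˡ (trans (ι-+ _ _) (+-congʳ ι-1))))))
        (*-mono-≤ (≤-respʳ (trans (ι-+ _ _) (+-congʳ ι-1)) (0≤ι (ℚ-Order.0≤+0≤ (ℚ.nonNegative⁻¹ 1ℚ) (ℚ.<⇒≤ (0<r (ℚ.positive⁻¹ 1ℚ) m)))))
          (0≤exp _) (go m) (1+x≤exp _)))
      where
      factorise : fromNat (suc (suc m)) ≡ fromNat (suc m) ℚ.* (1ℚ ℚ.+ r 1ℚ m)
      factorise = ≡.trans (Fractions.fromNat-suc (suc m)) (≡.trans
        (≡.cong (ℚ._+ fromNat (suc m)) (≡.sym (Reciprocals.fromNat-suc-*-r m)))
        (ℚS.solve 2 (λ n r → n ℚS.:* r ℚS.:+ n ℚS.:= n ℚS.:* (ℚS.con 1ℚ ℚS.:+ r)) ≡.refl (fromNat (suc m)) (r 1ℚ m)))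

  module _ (L : ℕ → Carrier) where

    -- Γ(y) = lim G n y, where L n stands for log n.
    G : ℕ → ℚ → Carrier
    G n y = ι (fromNat (n !)) * exp (ι y * L n) * ι (P n y)

    -- The logarithmic derivative of y ↦ `G n y`, namely log n - Σ 1/(y+i) over 0 ≤ i ≤ n.
    s : ℕ → ℚ → Carrier
    s n y = L n - ι (p 1 n y)

    private
      ∏ : List ℕ → ℚ → ℚ
      ∏ is y = List.foldr (λ i s → r y i ℚ.* s) 1ℚ is

      0≤∏ : ∀ {y} → 0ℚ ℚ.< y → ∀ is → 0ℚ ℚ.≤ ∏ is y
      0≤∏ 0<y []       = ℚ.nonNegative⁻¹ 1ℚ
      0≤∏ 0<y (i ∷ is) = ℚ-Order.0≤*0≤ (ℚ.<⇒≤ (0<r 0<y i)) (0≤∏ 0<y is)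

      -- Factor by factor, `r-difference` and 1 + u ≤ exp u for u = (z - y)/(y + i).
      ∏-≤ : ∀ {y z} → 0ℚ ℚ.< y → 0ℚ ℚ.< z → ∀ is →
        ι (∏ is y) ≤ ι (∏ is z) * exp (ι ((z ℚ.- y) ℚ.* Reciprocals.∑ is (λ i → r y i Fractions.^ 1)))
      ∏-≤ {y} {z} 0<y 0<z [] = ≤-reflexive (sym (trans (*-congˡ (trans (exp-cong
          (trans (reflexive (≡.cong ι (ℚ.*-zeroʳ (z ℚ.- y)))) ι-0)) exp-0)) (*-identityʳ _)))
      ∏-≤ {y} {z} 0<y 0<z (i ∷ is) =
        ≤-respˡ (sym (ι-* _ _)) (≤-respʳ rearrange (*-mono-≤ (0≤ι (0≤∏ 0<y is))
          (0≤*0≤ (0≤ι (ℚ.<⇒≤ (0<r 0<z i))) (0≤exp _)) term (∏-≤ 0<y 0<z is)))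
        where
        h S : ℚ
        h = z ℚ.- y
        S = Reciprocals.∑ is (λ i → r y i Fractions.^ 1)
        term : ι (r y i) ≤ ι (r z i) * exp (ι (h ℚ.* r y i Fractions.^ 1))
        term = ≤-respˡ (trans (*-congˡ (trans (+-cong (sym ι-1) (reflexive (≡.cong (λ t → ι (h ℚ.* t)) (ℚ.*-identityʳ (r y i))))) (sym (ι-+ _ _))))
            (trans (sym (ι-* _ _)) (reflexive (≡.cong ι (≡.sym (r-difference 0<y 0<z i))))))
          (*-monoˡ-≤ (0≤ι (ℚ.<⇒≤ (0<r 0<z i))) (1+x≤exp _))
        rearrange : ι (r z i) * exp (ι (h ℚ.* r y i Fractions.^ 1)) * (ι (∏ is z) * exp (ι (h ℚ.* S)))
                    ≈ ι (∏ (i ∷ is) z) * exp (ι (h ℚ.* (r y i Fractions.^ 1 ℚ.+ S)))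
        rearrange = trans (solve 4 (λ a b c d → a :* b :* (c :* d) := (a :* c) :* (b :* d)) refl _ _ _ _)
          (*-cong (sym (ι-* _ _)) (trans (sym (exp-+ _ _)) (exp-cong (trans (sym (ι-+ _ _))
            (reflexive (≡.cong ι (≡.sym (ℚ.*-distribˡ-+ h _ S))))))))

    -- With h = z - y, log-convexity of Euler's product gives G n z ≥ G n y exp (h s n y) by `∏-≤`,
    -- and exp u ≥ 1 + u makes this linear in h.
    G-tangent : ∀ {y z} → 0ℚ ℚ.< y → 0ℚ ℚ.< z → ∀ n → G n y + ι (z ℚ.- y) * (G n y * s n y) ≤ G n z
    G-tangent {y} {z} 0<y 0<z n =
      ≤-respˡ (trans (solve 5 (λ X V o h s → X :* (V :* (o :+ h :* s)) := X :* V :* o :+ h :* (X :* V :* s)) refl X V 1# (ι h) (s n y))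
                (+-congʳ (*-identityʳ _)))
      (≤-respʳ (trans (solve 5 (λ F E U E₁ E₂ → F :* E :* (U :* E₁ :* E₂) := F :* (E :* (E₁ :* E₂)) :* U) refl
                  (ι (fromNat (n !))) (exp (ι y * L n)) (ι (P n z)) (exp (ι (h ℚ.* p 1 n y))) W)
                (*-congʳ (*-congˡ (trans (*-congˡ (sym (exp-+ _ _))) (trans (sym (exp-+ _ _)) (exp-cong exponent))))))
        (*-monoˡ-≤ 0≤X (≤-trans (*-monoˡ-≤ (0≤ι (0≤∏ 0<y (upTo (suc n)))) (1+x≤exp _))
          (*-mono-≤ (0≤exp _) 0≤U (∏-≤ 0<y 0<z (upTo (suc n))) ≤-refl))))
      where
      h : ℚ
      h = z ℚ.- y
      X V W : Carrier
      X = ι (fromNat (n !)) * exp (ι y * L n)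
      V = ι (P n y)
      W = exp (ι h * s n y)
      0≤X : 0# ≤ X
      0≤X = 0≤*0≤ (0≤ι (Fractions.0≤fromNat (n !))) (0≤exp _)
      0≤U : 0# ≤ ι (P n z) * exp (ι (h ℚ.* p 1 n y))
      0≤U = 0≤*0≤ (0≤ι (0≤∏ 0<z (upTo (suc n)))) (0≤exp _)
      exponent : ι y * L n + (ι (h ℚ.* p 1 n y) + ι h * s n y) ≈ ι z * L n
      exponent = trans (+-congˡ (+-congʳ (ι-* h _)))
        (trans (solve 4 (λ y L h q → y :* L :+ (h :* q :+ h :* (L :- q)) := (y :+ h) :* L) refl (ι y) (L n) (ι h) (ι (p 1 n y)))
          (*-congʳ (trans (sym (ι-+ y h)) (reflexive (≡.cong ι (ℚS.solve 2 (λ y z → y ℚS.:+ (z ℚS.:- y) ℚS.:= z) ≡.refl y z))))))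
        where module ℚS = +-*-Solver

    module _ (exp-L : ∀ n → 1 ℕ.≤ n → exp (L n) ≈ ι (fromNat n)) where

      private
        0<1 : 0ℚ ℚ.< 1ℚ
        0<1 = ℚ.positive⁻¹ 1ℚ

        L≤p : ∀ n → 1 ℕ.≤ n → L n ≤ ι (p 1 n 1ℚ)
        L≤p n 1≤n = exp-cancel-≤ (≤-respˡ (sym (exp-L n 1≤n))
          (≤-trans (ι-mono (Fractions.fromNat-mono (ℕ.≤-trans (ℕ.n≤1+n n) (ℕ.n≤1+n (suc n))))) (n+2≤exp-p n)))

        ½≤G1 : ∀ n → 1 ℕ.≤ n → ι ½ ≤ G n 1ℚ
        ½≤G1 n 1≤n = ≤-respʳ (trans (ι-* _ _) (*-congʳ (trans (ι-* _ _) (*-congˡ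
            (trans (sym (exp-L n 1≤n)) (exp-cong (sym (trans (*-congʳ ι-1) (*-identityˡ _)))))))))
          (ι-mono (Reciprocals.½≤n!nP n 1≤n))

      -- The slope of G n at 1 is G n 1 times log n - (1 + ½ + ⋯ + 1/(n+1)), which is at most 0. As
      -- the graph lies above the tangent at 1, G n y ≥ G n 1 for y < 1.
      ½≤G : ∀ {y} → InUnit y → ∀ n → 1 ℕ.≤ n → ι ½ ≤ G n y
      ½≤G {y} (0<y , y<1) n 1≤n = ≤-trans (½≤G1 n 1≤n) (≤-trans
        (≤-by (ι (1ℚ ℚ.- y) * (G n 1ℚ * (ι (p 1 n 1ℚ) - L n)))
          (0≤*0≤ (0≤ι (ℚ-Order.0≤- (ℚ.<⇒≤ y<1)))
            (0≤*0≤ (≤-trans (0≤ι (ℚ.nonNegative⁻¹ ½)) (½≤G1 n 1≤n)) (0≤- (L≤p n 1≤n))))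
          (trans (+-congˡ (*-congʳ (trans (reflexive (≡.cong ι (ℚS.solve 1 (λ y → y ℚS.:- ℚS.con 1ℚ ℚS.:= ℚS.:- (ℚS.con 1ℚ ℚS.:- y)) ≡.refl y))) (ι-neg _))))
            (solve 4 (λ g h L q → g :+ (:- h) :* (g :* (L :- q)) := g :+ h :* (g :* (q :- L))) refl (G n 1ℚ) (ι (1ℚ ℚ.- y)) (L n) (ι (p 1 n 1ℚ)))))
        (G-tangent 0<1 0<y n))
        where module ℚS = +-*-Solver

  -- F′ is the derivative of F along rational displacements inside (0, 1).
  Derivative : (F F′ : ℚ → Carrier) → Set
  Derivative F F′ = ∀ {y} → InUnit y → ∀ ε → 0ℚ ℚ.< ε → ∃ λ δ → 0ℚ ℚ.< δ × (∀ h → InUnit (y ℚ.+ h) → ℚ.∣ h ∣ ℚ.≤ δ →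
    ∣ F (y ℚ.+ h) - F y - F′ y * ι h ∣ ≤ ι ε * ι ℚ.∣ h ∣)

  derivative-*ˡ : ∀ c {F F′} → Derivative F F′ → Derivative (λ y → c * F y) (λ y → c * F′ y)
  derivative-*ˡ c {F} {F′} der {y} u ε 0<ε =
    let B , 0<B , c≤B = bounded c
        ε′ , 0<ε′ , Bε′ = ℚ-Order.divide ε 0<B 0<ε
        δ , 0<δ , hδ = der u ε′ 0<ε′
    in δ , 0<δ , λ h uh h≤ → ≤-respˡ
      (trans (sym (∣x*y∣≈ c _)) (∣∣-cong (solve 5 (λ c a b d h → c :* (a :- b :- d :* h) := c :* a :- c :* b :- c :* d :* h) refl c _ _ _ (ι h))))
      (≤-respʳ (trans (sym (*-assoc _ _ _)) (*-congʳ (trans (sym (ι-* B ε′)) (reflexive (≡.cong ι Bε′)))))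
        (*-mono-≤ (0≤∣x∣ _) (0≤ι (ℚ.<⇒≤ 0<B)) c≤B (hδ h uh h≤)))

  convex-slopes : ∀ {F F′} → Derivative F F′ → ∀ (Fₙ : ℚ → ℕ → Carrier) dₙ {y} → InUnit y →
    (∀ {z} → InUnit z → Fₙ z ⟶ F z) →
    (∀ {z} → InUnit z → ∀ n → Fₙ y n + ι (z ℚ.- y) * dₙ n ≤ Fₙ z n) → dₙ ⟶ F′ y
  convex-slopes {F} {F′} der Fₙ dₙ {y} u F⟶ tangent =
    let η , 0<η , near = neighbourhood u
    in slope-limit F (F′ y) Fₙ dₙ y η 0<η
      (λ ε 0<ε → let δ , 0<δ , hδ = der u ε 0<ε in δ , 0<δ , λ h h≤η h≤δ → hδ h (near h h≤η) h≤δ)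
      (F⟶ u) (λ h h≤η → F⟶ (near h h≤η))
      (λ h h≤η → 0 , λ n _ → ≡.subst (λ k → Fₙ y n + ι k * dₙ n ≤ Fₙ (y ℚ.+ h) n)
        (ℚS.solve 2 (λ y h → (y ℚS.:+ h) ℚS.:- y ℚS.:= h) ≡.refl y h) (tangent (near h h≤η) n))
    where module ℚS = +-*-Solver

  module _ (L : ℕ → Carrier) (exp-L : ∀ n → 1 ℕ.≤ n → exp (L n) ≈ ι (fromNat n))
    (Γ : ℚ → Carrier) (G⟶Γ : ∀ {y} → InUnit y → (λ n → G L n y) ⟶ Γ y)
    (ψ : ℕ → ℚ → Carrier) (digamma : Derivative Γ (λ y → ψ 0 y * Γ y))
    (polygamma : ∀ j → Derivative (ψ j) (ψ (suc j))) where

    -- The slopes G n s n converge to ψ₀ Γ, and so does G n ψ₀. Their difference G n (s n - ψ₀) is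
    -- null and G n ≥ ½, so s n → ψ₀ and Γ never has to be inverted.
    digamma-limit : ∀ {y} → InUnit y → (λ n → s L n y) ⟶ ψ 0 y
    digamma-limit {y} u = lim-cong {t = λ n → s L n y}
        (λ n → solve 2 (λ s p → (s :- p) :+ p := s) refl (s L n y) (ψ 0 y)) (+-identityˡ (ψ 0 y))
        (lim-+ (lim-cancel (ℚ.positive⁻¹ ½) (1 , λ n 1≤n → ½≤G L exp-L u n 1≤n) difference) (lim-const (ψ 0 y)))
      where
      slopes : (λ n → G L n y * s L n y) ⟶ ψ 0 y * Γ y
      slopes = convex-slopes digamma (λ z n → G L n z) (λ n → G L n y * s L n y) u G⟶Γ
        (λ {z} uz n → G-tangent L (proj₁ u) (proj₁ uz) n)
      difference : (λ n → G L n y * (s L n y - ψ 0 y)) ⟶ 0#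
      difference = lim-cong
        (λ n → solve 3 (λ g s p → g :* s :+ :- (p :* g) := g :* (s :- p)) refl (G L n y) (s L n y) (ψ 0 y))
        (-‿inverseʳ (ψ 0 y * Γ y))
        (lim-+ slopes (lim-neg (lim-* (lim-const (ψ 0 y)) (G⟶Γ u))))

    private
      -- The part of Σ 1/(y+i)ʲ⁺¹ that diverges with n.
      divergence : ℕ → ℕ → Carrier
      divergence zero    n = L n
      divergence (suc j) n = 0#

    -- Induction on j: the sums of (y+i)⁻ʲ⁻¹ lie above their tangents, whose slopes are -(j+1) times
    -- the sums of (y+i)⁻ʲ⁻²; hence the factor -1/(j+1). The divergent log n does not depend on y
    -- and disappears from the slopes.
    polygamma-limit : ∀ j {y} → InUnit y → (λ n → ι (p (suc j) n y) - divergence j n) ⟶ ι (coefficient j) * ψ j y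
    polygamma-limit zero {y} u = lim-cong
      (λ n → solve 2 (λ L q → :- (L :- q) := q :- L) refl (L n) (ι (p 1 n y)))
      (trans (solve 1 (λ ψ → :- ψ := (:- con 1ℚ) :* ψ) refl (ψ 0 y)) (*-congʳ (sym (ι-neg 1ℚ))))
      (lim-neg (digamma-limit u))
    polygamma-limit (suc j) {y} u = lim-cong
      (λ n → trans (trans (sym (ι-* _ _)) (reflexive (≡.cong ι (≡.trans
          (ℚS.solve 3 (λ i k q → ℚS.:- i ℚS.:* (ℚS.:- k ℚS.:* q) ℚS.:= k ℚS.:* i ℚS.:* q) ≡.refl (Fractions.1/suc j) (fromNat (suc j)) (p (suc (suc j)) n y))
          (≡.trans (≡.cong (ℚ._* p (suc (suc j)) n y) (Fractions.fromNat-*-1/suc j)) (ℚ.*-identityˡ _))))))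
        (sym (trans (+-congˡ (-‿cong (sym ι-0))) (solve 1 (λ x → x :- con 0ℚ := x) refl _))))
      (trans (sym (*-assoc _ _ _)) (*-congʳ (sym (ι-* _ _))))
      (lim-* (lim-const (ι (ℚ.- Fractions.1/suc j)))
        (convex-slopes (derivative-*ˡ (ι (coefficient j)) (polygamma j))
          (λ z n → ι (p (suc j) n z) - divergence j n) (λ n → ι (ℚ.- fromNat (suc j) ℚ.* p (suc (suc j)) n y)) u
          (polygamma-limit j)
          (λ {z} uz n → ≤-respˡ
            (trans (+-congʳ (trans (ι-+ _ _) (+-congˡ (ι-* _ _))))
              (solve 3 (λ q t c → q :+ t :- c := q :- c :+ t) refl (ι (p (suc j) n y)) _ (divergence j n)))
            (+-mono-≤ (ι-mono (p-tangent (proj₁ u) (proj₁ uz) (suc j) n)) ≤-refl))))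
      where module ℚS = +-*-Solver

    powerSum-limit : ∀ j {y} → InUnit y → (λ n → ι (p (suc (suc j)) n y)) ⟶ ι (coefficient (suc j)) * ψ (suc j) y
    powerSum-limit j {y} u = lim-cong
      (λ n → trans (+-congˡ (-‿cong (sym ι-0))) (solve 1 (λ x → x :- con 0ℚ := x) refl _))
      refl (polygamma-limit (suc j) u)

    harmonicSum-limit : ∀ {y} → InUnit y → (λ n → ι (p 1 n y) - L n) ⟶ ι (coefficient 0) * ψ 0 y
    harmonicSum-limit = polygamma-limit 0

-- Generating series of the truncated sums

module Scalars (Q : ℚ-Algebra) where
  open ℚ-Algebra Q hiding (zero)
  open RawSemiringDefs (CommutativeSemiring.rawSemiring commutativeSemiring) using () renaming (_×_ to _·_; _^_ to _^_)

  ·-ι : ∀ n p → n · ι p ≈ ι (n Fractions.· p)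
  ·-ι zero    p = sym ι-0
  ·-ι (suc n) p = trans (+-congˡ (·-ι n p)) (sym (ι-+ p _))

  ·-ι-1/suc : ∀ n → suc n · ι (Fractions.1/suc n) ≈ 1#
  ·-ι-1/suc n = trans (·-ι (suc n) _) (trans (reflexive (≡.cong ι (Fractions.·-1/suc n))) ι-1)

module SeriesLimits (C : LimitRing) where
  open LimitRing C hiding (zero)
  open RawSemiringDefs (CommutativeSemiring.rawSemiring commutativeSemiring) using (product; sum) renaming (_×_ to _·_; _^_ to _^_)
  open Algebra.Properties.Semiring.Exp semiring using (^-congˡ)
  open Algebra.Properties.CommutativeSemiring.Exp commutativeSemiring using (^-distrib-*)
  open Sums commutativeSemiring
  open PowerSeries commutativeSemiring
  open NatSolver commutativeSemiring
  open SetoidReasoning setoid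

  open Scalars ℚ-algebra using (·-ι-1/suc)
  open Exponential commutativeSemiring (λ n → ι (Fractions.1/suc n)) ·-ι-1/suc public using (1/suc-*-·)

  ι-^ : ∀ p k → ι p ^ k ≈ ι (p Fractions.^ k)
  ι-^ p zero    = sym ι-1
  ι-^ p (suc k) = trans (*-congˡ (ι-^ p k)) (sym (ι-* p _))

  ι-∑ : ∀ {A : Set} (xs : List A) f → ι (Reciprocals.∑ xs f) ≈ ∑ xs (ι ∘ f)
  ι-∑ []       f = ι-0
  ι-∑ (x ∷ xs) f = trans (ι-+ _ _) (+-congˡ (ι-∑ xs f))

  lim-^ : ∀ {s l} k → s ⟶ l → (λ n → s n ^ k) ⟶ l ^ k
  lim-^ zero    s⟶l = lim-const 1#
  lim-^ (suc k) s⟶l = lim-* s⟶l (lim-^ k s⟶l)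

  lim-∑< : ∀ N {s : ℕ → ℕ → Carrier} {l : ℕ → Carrier} → (∀ i → i ℕ.< N → s i ⟶ l i) → (λ n → ∑< N (λ i → s i n)) ⟶ ∑< N l
  lim-∑< zero    h = lim-const 0#
  lim-∑< (suc N) {s} {l} h = lim-cong (λ n → sym (∑<-last N (λ i → s i n))) (sym (∑<-last N l))
    (lim-+ (lim-∑< N (λ i i<N → h i (ℕ.m≤n⇒m≤1+n i<N))) (h N ℕ.≤-refl))

  lim-⋆ : ∀ n {a b : ℕ → Series} {a∞ b∞ : Series} → (∀ i → i ℕ.≤ n → (λ N → a N i) ⟶ a∞ i) → (∀ i → i ℕ.≤ n → (λ N → b N i) ⟶ b∞ i) →
    (λ N → (a N ⋆ b N) n) ⟶ (a∞ ⋆ b∞) n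
  lim-⋆ zero    a⟶ b⟶ = lim-* (a⟶ 0 ℕ.z≤n) (b⟶ 0 ℕ.z≤n)
  lim-⋆ (suc n) a⟶ b⟶ = lim-+ (lim-* (a⟶ 0 ℕ.z≤n) (b⟶ (suc n) ℕ.≤-refl))
    (lim-⋆ n (λ i i≤n → a⟶ (suc i) (ℕ.s≤s i≤n)) (λ i i≤n → b⟶ i (ℕ.m≤n⇒m≤1+n i≤n)))

  -- The recursion e_{i+1} = (β ⋆ e)_i / (i+1) is passed to the limit degree by degree; as in
  -- `logDerivative-unique≤`, a bound carries the strong induction.
  logDerivative-limit : ∀ {e β : ℕ → Series} {e∞ β∞ : Series} →
    (∀ N → IsLogDerivative (β N) (e N)) → IsLogDerivative β∞ e∞ →
    (∀ i → (λ N → β N i) ⟶ β∞ i) → (λ N → e N 0) ⟶ e∞ 0 → ∀ n → (λ N → e N n) ⟶ e∞ n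
  logDerivative-limit {e} {β} {e∞} {β∞} he he∞ β⟶ e₀⟶ n = upTo≤ n n ℕ.≤-refl
    where
    upTo≤ : ∀ n i → i ℕ.≤ n → (λ N → e N i) ⟶ e∞ i
    upTo≤ n       zero    i≤n         = e₀⟶
    upTo≤ (suc n) (suc i) (ℕ.s≤s i≤n) = lim-cong
      (λ N → trans (*-congˡ (sym (he N i))) (1/suc-*-· i (e N (suc i))))
      (trans (*-congˡ (sym (he∞ i))) (1/suc-*-· i (e∞ (suc i))))
      (lim-* (lim-const (ι (Fractions.1/suc i)))
        (lim-⋆ i (λ k _ → β⟶ k) (λ k k≤i → upTo≤ n k (ℕ.≤-trans k≤i i≤n))))

  ∑<-blocks : ∀ q M (c : ℕ → Carrier) → ∑< (M ℕ.* q) c ≈ ∑< M (λ m → ∑< q (λ r → c (m ℕ.* q ℕ.+ r)))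
  ∑<-blocks q zero    c = refl
  ∑<-blocks q (suc M) c = begin
    ∑< (q ℕ.+ M ℕ.* q) c
      ≈⟨ ∑<-+ q (M ℕ.* q) c ⟩
    ∑< q c + ∑< (M ℕ.* q) (λ i → c (q ℕ.+ i))
      ≈⟨ +-congˡ (∑<-blocks q M (λ i → c (q ℕ.+ i))) ⟩
    ∑< q c + ∑< M (λ m → ∑< q (λ r → c (q ℕ.+ (m ℕ.* q ℕ.+ r))))
      ≈⟨ +-congˡ (∑-cong (upTo M) λ m → ∑-cong (upTo q) λ r → reflexive (≡.cong c (≡.sym (ℕ.+-assoc q (m ℕ.* q) r)))) ⟩
    ∑< q c + ∑< M (λ m → ∑< q (λ r → c (suc m ℕ.* q ℕ.+ r)))
      ≡⟨ ∑<-suc M (λ m → ∑< q (λ r → c (m ℕ.* q ℕ.+ r))) ⟨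
    ∑< (suc M) (λ m → ∑< q (λ r → c (m ℕ.* q ℕ.+ r))) ∎

  -- Up to N = m q + r there are m full blocks and r < q further terms, which tend to 0. The full
  -- blocks are counted from one, to match sums over 0 ≤ m ≤ n in Euler's formula.
  lim-blocks : ∀ q .{{_ : ℕ.NonZero q}} (c : ℕ → Carrier) {l} →
    (λ n → ∑< (suc n ℕ.* q) c) ⟶ l → (∀ r → r ℕ.< q → (λ m → c (m ℕ.* q ℕ.+ r)) ⟶ 0#) →
    (λ N → ∑< N c) ⟶ l
  lim-blocks q c {l} full⟶ c⟶0 = lim-interleave q λ r r<q → lim-cong
      (λ m → trans (sym (∑<-+ (m ℕ.* q) r c)) (reflexive (≡.cong (λ N → ∑< N c) (ℕ.+-comm (m ℕ.* q) r))))
      (trans (+-congˡ (∑-0 (upTo r) (λ _ → refl))) (+-identityʳ l))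
      (lim-+ (lim-suc full⟶) (lim-∑< r {l = λ _ → 0#} (λ i i<r → c⟶0 i (ℕ.<-trans i<r r<q))))

  sum-lookup : ∀ {A : Set} (xs : List A) f → sum (λ j → f (lookup xs j)) ≡ ∑ xs f
  sum-lookup []       f = ≡.refl
  sum-lookup (x ∷ xs) f = ≡.cong (λ t → f x + t) (sum-lookup xs f)

  ∑-interval : ∀ N (f : ℕ⁺ → Carrier) → ∑ (interval N) f ≈ ∑< N (λ i → f (suc i , _))
  ∑-interval N f = ∑-map _ (upTo N) f

  ∑-Φ : ∀ q (f : ℕ⁺ → Carrier) → (∀ j → gcd (proj₁ j) q ≢ 1 → f j ≈ 0#) →
    ∑ (Φ q) f ≈ ∑< (q ℕ.∸ 1) (λ i → f (suc i , _))
  ∑-Φ q f vanish = trans (∑-filter coprime? (interval (q ℕ.∸ 1)) f)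
    (trans (∑-cong (interval (q ℕ.∸ 1)) restrict) (∑-interval (q ℕ.∸ 1) f))
    where
    coprime? : ∀ j → _
    coprime? j = gcd (proj₁ j) q ℕ.≟ 1
    restrict : ∀ j → (if does (coprime? j) then f j else 0#) ≈ f j
    restrict j = go (coprime? j)
      where
      go : ∀ d → (if does d then f j else 0#) ≈ f j
      go (yes _) = refl
      go (no ¬p) = sym (vanish j ¬p)

-- Power sums of χ(k)/k, split by residues modulo q

module CharacterSeries (C : LimitRing) (q′ : ℕ) (χ : ℕ → LimitRing.Carrier C) where
  open LimitRing C hiding (zero)
  open RawSemiringDefs (CommutativeSemiring.rawSemiring commutativeSemiring) using (product; sum) renaming (_×_ to _·_; _^_ to _^_)
  open Algebra.Properties.Semiring.Exp semiring using (^-congˡ)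
  open Algebra.Properties.CommutativeSemiring.Exp commutativeSemiring using (^-distrib-*)
  open Algebra.Properties.Ring ring using (-1*x≈-x)
  open Sums commutativeSemiring
  open PowerSeries commutativeSemiring
  open SeriesLimits C
  open Reciprocals using (r; p)
  open GammaCoefficients
  open Fractions using (fromNat)
  open NatSolver commutativeSemiring
  open SetoidReasoning setoid
  private
    module DS = RawSemiringDefs (CommutativeSemiring.rawSemiring seriesSemiring)

  q : ℕ
  q = suc q′

  summand : ℕ⁺ → Carrier
  summand (k , k≢0) = χ k * ι ((+ 1 / k) {{k≢0}})

  y : ℕ⁺ → ℚ
  y (j , _) = + j / q

  0<y : ∀ i → 0ℚ ℚ.< y (suc i , _)
  0<y i = ℚ.positive⁻¹ _ {{ℚ.normalize-pos (suc i) q}}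

  private
    j⁺ : ℕ → ℕ⁺
    j⁺ i = suc i , _

    -- k = m q + i + 1 equals q (y + m) with y = (i+1)/q, so a residue class yields the reciprocals
    -- 1/(y + m) up to the factor 1/q.
    1/k : ∀ m i → + 1 / suc (m ℕ.* q ℕ.+ i) ≡ (+ 1 / q) ℚ.* r (y (j⁺ i)) m
    1/k m i = ≡.trans (≡.sym (≡.trans (≡.sym (ℚ.*-assoc 1/q Q k⁻¹)) (≡.trans (≡.cong (ℚ._* k⁻¹)
        (≡.trans (ℚ.*-comm 1/q Q) (Fractions.fromNat-*-/ 1 q))) (ℚ.*-identityˡ k⁻¹))))
      (≡.cong (1/q ℚ.*_) (≡.sym (Reciprocals.invℚ-unique (Reciprocals.0<y+i (0<y i) m) inverse)))
      where
      k⁻¹ Q 1/q : ℚ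
      k⁻¹ = + 1 / suc (m ℕ.* q ℕ.+ i)
      Q = fromNat q
      1/q = + 1 / q
      inverse : (y (j⁺ i) ℚ.+ fromNat m) ℚ.* (Q ℚ.* k⁻¹) ≡ 1ℚ
      inverse = ≡.trans
        (ℚS.solve 4 (λ y m Q k → (y ℚS.:+ m) ℚS.:* (Q ℚS.:* k) ℚS.:= (Q ℚS.:* y ℚS.:+ m ℚS.:* Q) ℚS.:* k) ≡.refl (y (j⁺ i)) (fromNat m) Q k⁻¹)
        (≡.trans (≡.cong (ℚ._* k⁻¹) (≡.trans
            (≡.cong₂ ℚ._+_ (Fractions.fromNat-*-/ (suc i) q) (≡.sym (Fractions.fromNat-* m q)))
            (≡.trans (≡.sym (Fractions.fromNat-+ (suc i) (m ℕ.* q))) (≡.cong fromNat (≡.cong suc (ℕ.+-comm i (m ℕ.* q)))))))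
          (Fractions.fromNat-*-/ 1 (suc (m ℕ.* q ℕ.+ i))))
        where module ℚS = +-*-Solver

    w : ℕ → Carrier
    w i = χ (suc i) * ι (+ 1 / q)

    neg-^ : ∀ x i → (- x) ^ i ≈ ι (sign i) * x ^ i
    neg-^ x i = begin
      (- x) ^ i               ≈⟨ ^-congˡ i (trans (sym (-1*x≈-x x)) (*-congʳ (trans (-‿cong (sym ι-1)) (sym (ι-neg 1ℚ))))) ⟩
      (ι (ℚ.- 1ℚ) * x) ^ i    ≈⟨ ^-distrib-* (ι (ℚ.- 1ℚ)) x i ⟩
      ι (ℚ.- 1ℚ) ^ i * x ^ i  ≈⟨ *-congʳ (ι-^ (ℚ.- 1ℚ) i) ⟩
      ι (sign i) * x ^ i      ∎

  module _
    (χ-periodic : ∀ n → χ (n ℕ.+ q) ≈ χ n)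
    (χ-vanish : ∀ n → gcd n q ≢ 1 → χ n ≈ 0#)
    (χ-q : χ q ≈ 0#)
    (χ-sum : ∑< q′ (λ i → χ (suc i)) ≈ 0#)
    (r-null : ∀ {y} → 0ℚ ℚ.< y → (λ m → ι (r y m)) ⟶ 0#)
    (L : ℕ → Carrier) (Ψ : ℕ → ℕ⁺ → Carrier)
    (harmonicSum-limit : ∀ i → i ℕ.< q′ →
      (λ n → ι (p 1 n (y (suc i , _))) - L n) ⟶ ι (coefficient 0) * Ψ 0 (suc i , _))
    (powerSum-limit : ∀ k i → i ℕ.< q′ →
      (λ n → ι (p (suc (suc k)) n (y (suc i , _)))) ⟶ ι (coefficient (suc k)) * Ψ (suc k) (suc i , _))
    (g : ℕ⁺ → Series) (g₀ : ∀ j → g j 0 ≈ 1#)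
    (logDerivative-g : ∀ j → IsLogDerivative (λ k → χ (proj₁ j) ^ suc k * (ι (ℚ.- 1/fact k) * Ψ k j)) (g j)) where

    private
      χ-block : ∀ m i → χ (suc (m ℕ.* q ℕ.+ i)) ≈ χ (suc i)
      χ-block zero    i = refl
      χ-block (suc m) i = begin
        χ (suc (q ℕ.+ m ℕ.* q ℕ.+ i))    ≡⟨ ≡.cong (χ ∘ suc) (≡.trans (ℕ.+-assoc q (m ℕ.* q) i) (ℕ.+-comm q _)) ⟩
        χ (suc (m ℕ.* q ℕ.+ i) ℕ.+ q)    ≈⟨ χ-periodic (suc (m ℕ.* q ℕ.+ i)) ⟩
        χ (suc (m ℕ.* q ℕ.+ i))          ≈⟨ χ-block m i ⟩
        χ (suc i)                        ∎

      summand-block : ∀ m i → summand (suc (m ℕ.* q ℕ.+ i) , _) ≈ w i * ι (r (y (j⁺ i)) m)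
      summand-block m i = trans (*-cong (χ-block m i) (trans (reflexive (≡.cong ι (1/k m i))) (ι-* _ _))) (sym (*-assoc _ _ _))

      c : ℕ → ℕ → Carrier
      c k i = summand (suc i , _) ^ suc k

      w-last : ∀ k → w q′ ^ suc k ≈ 0#
      w-last k = trans (*-congʳ (trans (*-congʳ χ-q) (zeroˡ _))) (zeroˡ _)

      full-block : ∀ k n → ∑< (suc n ℕ.* q) (c k) ≈ ∑< q′ (λ i → w i ^ suc k * ι (p (suc k) n (y (j⁺ i))))
      full-block k n = begin
        ∑< (suc n ℕ.* q) (c k)
          ≈⟨ ∑<-blocks q (suc n) (c k) ⟩
        ∑< (suc n) (λ m → ∑< q (λ i → c k (m ℕ.* q ℕ.+ i)))
          ≈⟨ ∑-swap (upTo (suc n)) (upTo q) _ ⟩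
        ∑< q (λ i → ∑< (suc n) (λ m → c k (m ℕ.* q ℕ.+ i)))
          ≈⟨ ∑-cong (upTo q) (λ i → trans (∑-cong (upTo (suc n)) λ m → trans (^-congˡ (suc k) (summand-block m i))
               (trans (^-distrib-* (w i) _ (suc k)) (*-congˡ (ι-^ _ (suc k))))) (sym (∑-*ˡ (w i ^ suc k) (upTo (suc n)) _))) ⟩
        ∑< q (λ i → w i ^ suc k * ∑< (suc n) (λ m → ι (r (y (j⁺ i)) m Fractions.^ suc k)))
          ≈⟨ ∑-cong (upTo q) (λ i → *-congˡ (ι-∑ (upTo (suc n)) _)) ⟨
        ∑< q (λ i → w i ^ suc k * ι (p (suc k) n (y (j⁺ i))))
          ≈⟨ ∑<-last q′ _ ⟩
        -- Index q′ stands for the multiples of q, where χ vanishes; dropping it leaves only points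
        -- y < 1.
        ∑< q′ (λ i → w i ^ suc k * ι (p (suc k) n (y (j⁺ i)))) + w q′ ^ suc k * ι (p (suc k) n (y (j⁺ q′)))
          ≈⟨ +-congˡ (trans (*-congʳ (w-last k)) (zeroˡ _)) ⟩
        ∑< q′ (λ i → w i ^ suc k * ι (p (suc k) n (y (j⁺ i)))) + 0#
          ≈⟨ +-identityʳ _ ⟩
        ∑< q′ (λ i → w i ^ suc k * ι (p (suc k) n (y (j⁺ i)))) ∎

      -- The divergent parts L n cancel because the values of χ sum to zero.
      renormalise : ∀ n → ∑< q′ (λ i → w i ^ 1 * ι (p 1 n (y (j⁺ i)))) ≈ ∑< q′ (λ i → w i ^ 1 * (ι (p 1 n (y (j⁺ i))) - L n))
      renormalise n = begin
        ∑< q′ (λ i → w i ^ 1 * ι (p 1 n (y (j⁺ i))))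
          ≈⟨ +-identityʳ _ ⟨
        ∑< q′ (λ i → w i ^ 1 * ι (p 1 n (y (j⁺ i)))) + 0#
          ≈⟨ +-congˡ (trans (*-congˡ χ-sum) (zeroʳ _)) ⟨
        ∑< q′ (λ i → w i ^ 1 * ι (p 1 n (y (j⁺ i)))) + ι (+ 1 / q) * (- L n) * ∑< q′ (λ i → χ (suc i))
          ≈⟨ +-congˡ (∑-*ˡ _ (upTo q′) _) ⟩
        ∑< q′ (λ i → w i ^ 1 * ι (p 1 n (y (j⁺ i)))) + ∑< q′ (λ i → ι (+ 1 / q) * (- L n) * χ (suc i))
          ≈⟨ ∑-+ (upTo q′) _ _ ⟨
        ∑< q′ (λ i → w i ^ 1 * ι (p 1 n (y (j⁺ i))) + ι (+ 1 / q) * (- L n) * χ (suc i))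
          ≈⟨ ∑-cong (upTo q′) (λ i → solve 4 (λ x u s l → x :* u :* con 1 :* s :+ u :* l :* x := x :* u :* con 1 :* (s :+ l)) refl (χ (suc i)) (ι (+ 1 / q)) (ι (p 1 n (y (j⁺ i)))) (- L n)) ⟩
        ∑< q′ (λ i → w i ^ 1 * (ι (p 1 n (y (j⁺ i))) - L n)) ∎

      limitSum : ℕ → Carrier
      limitSum k = ∑< q′ (λ i → w i ^ suc k * (ι (coefficient k) * Ψ k (j⁺ i)))

      full-limit : ∀ k → (λ n → ∑< (suc n ℕ.* q) (c k)) ⟶ limitSum k
      full-limit zero    = lim-cong (λ n → sym (trans (full-block 0 n) (renormalise n))) refl
        (lim-∑< q′ λ i i<q′ → lim-* (lim-const _) (harmonicSum-limit i i<q′))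
      full-limit (suc k) = lim-cong (λ n → sym (full-block (suc k) n)) refl
        (lim-∑< q′ λ i i<q′ → lim-* (lim-const _) (powerSum-limit k i i<q′))

      powerSums-limit : ∀ k → (λ N → ∑< N (c k)) ⟶ limitSum k
      powerSums-limit k = lim-blocks q (c k) (full-limit k) λ i _ → lim-cong
        (λ m → sym (^-congˡ (suc k) (summand-block m i)))
        (trans (*-congʳ (zeroʳ (w i))) (zeroˡ _))
        (lim-^ (suc k) (lim-* (lim-const (w i)) (r-null (0<y i))))

      β : ℕ → Series
      β N k = ∑ (interval N) (λ x → (- summand x) ^ k * summand x)

      β-limit : ∀ k → (λ N → β N k) ⟶ ι (sign k) * limitSum k
      β-limit k = lim-cong
        (λ N → sym (begin
          ∑ (interval N) (λ x → (- summand x) ^ k * summand x)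
            ≈⟨ ∑-interval N _ ⟩
          ∑< N (λ i → (- summand (j⁺ i)) ^ k * summand (j⁺ i))
            ≈⟨ ∑-cong (upTo N) (λ i → trans (*-congʳ (neg-^ (summand (j⁺ i)) k)) (trans (*-assoc _ _ _) (*-congˡ (*-comm _ _)))) ⟩
          ∑< N (λ i → ι (sign k) * c k i)
            ≈⟨ ∑-*ˡ (ι (sign k)) (upTo N) (c k) ⟨
          ι (sign k) * ∑< N (c k) ∎))
        refl (lim-* (lim-const (ι (sign k))) (powerSums-limit k))

      G : Series
      G = ⨂ (λ j → g (lookup (Φ q) j))

      G₀ : G 0 ≈ 1#
      G₀ = go (lookup (Φ q))
        where
        go : ∀ {m} (js : Fin m → ℕ⁺) → ⨂ (λ j → g (js j)) 0 ≈ 1#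
        go {zero}  js = refl
        go {suc m} js = trans (*-cong (g₀ _) (go (js ∘ Fin.suc))) (*-identityˡ 1#)

      δ : ℕ⁺ → Series
      δ j k = χ (proj₁ j) ^ suc k * (ι (ℚ.- 1/fact k) * Ψ k j)

      sum-coeff : ∀ {m} (a : Fin m → Series) k → DS.sum a k ≡ sum (λ j → a j k)
      sum-coeff {zero}  a k = ≡.refl
      sum-coeff {suc m} a k = ≡.cong (λ t → a Fin.zero k + t) (sum-coeff (a ∘ Fin.suc) k)

      u : Carrier
      u = ι (+ 1 / q)

      -- The substitution of t/q for t in the product of the g_j. Residues not coprime to q
      -- contribute 0, so the sum over Φ becomes the sum over all nonzero residues.
      logDerivative-G : IsLogDerivative (λ k → ι (sign k) * limitSum k) (λ n → u ^ n * G n)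
      logDerivative-G = logDerivative-cong scaled (λ _ → refl) (logDerivative-scale u
        (logDerivative-⨂ (λ j → δ (lookup (Φ q) j)) (λ j → g (lookup (Φ q) j)) (λ j → logDerivative-g (lookup (Φ q) j))))
        where
        δ-vanish : ∀ k j → gcd (proj₁ j) q ≢ 1 → δ j k ≈ 0#
        δ-vanish k j ≢1 = trans (*-congʳ (trans (*-congʳ (χ-vanish (proj₁ j) ≢1)) (zeroˡ _))) (zeroˡ _)
        scaled : ∀ k → u ^ suc k * DS.sum (λ j → δ (lookup (Φ q) j)) k ≈ ι (sign k) * limitSum k
        scaled k = begin
          u ^ suc k * DS.sum (λ j → δ (lookup (Φ q) j)) k
            ≡⟨ ≡.cong (u ^ suc k *_) (≡.trans (sum-coeff (λ j → δ (lookup (Φ q) j)) k) (sum-lookup (Φ q) (λ j → δ j k))) ⟩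
          u ^ suc k * ∑ (Φ q) (λ j → δ j k)
            ≈⟨ *-congˡ (∑-Φ q (λ j → δ j k) (δ-vanish k)) ⟩
          u ^ suc k * ∑< q′ (λ i → δ (j⁺ i) k)
            ≈⟨ ∑-*ˡ _ (upTo q′) _ ⟩
          ∑< q′ (λ i → u ^ suc k * (χ (suc i) ^ suc k * (ι (ℚ.- 1/fact k) * Ψ k (j⁺ i))))
            ≈⟨ ∑-cong (upTo q′) (λ i → trans (*-congˡ (*-congˡ (*-congʳ (trans (reflexive (≡.cong ι (≡.sym (sign-coefficient k)))) (ι-* (sign k) _)))))
                 (solve 5 (λ U X s e ψ → U :* (X :* (s :* e :* ψ)) := s :* (X :* U :* (e :* ψ))) refl _ _ _ _ _)) ⟩
          ∑< q′ (λ i → ι (sign k) * (χ (suc i) ^ suc k * u ^ suc k * (ι (coefficient k) * Ψ k (j⁺ i))))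
            ≈⟨ ∑-cong (upTo q′) (λ i → *-congˡ (*-congʳ (^-distrib-* (χ (suc i)) u (suc k)))) ⟨
          ∑< q′ (λ i → ι (sign k) * (w i ^ suc k * (ι (coefficient k) * Ψ k (j⁺ i))))
            ≈⟨ ∑-*ˡ _ (upTo q′) _ ⟨
          ι (sign k) * limitSum k ∎

    elementary-limit : ∀ n → (λ N → elementary summand (interval N) n) ⟶
      u ^ n * ∑ (familiesWithSum (length (Φ q)) n) (λ k → product (λ j → g (lookup (Φ q) j) (k j)))
    elementary-limit n = lim-cong (λ _ → refl)
      (*-congˡ (sym (∑-familiesWithSum (length (Φ q)) n (λ j → g (lookup (Φ q) j)))))
      (logDerivative-limit
        (λ N → logDerivative-elementary summand (λ x → - summand x) (λ x → -‿inverseˡ (summand x)) (interval N))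
        logDerivative-G β-limit
        (lim-cong (λ N → sym (+-identityʳ 1#)) (sym (trans (*-identityˡ _) G₀)) (lim-const 1#)) n)

-- Character sums

module CharacterSum (R : CommutativeRing 0ℓ 0ℓ) (q′ : ℕ) where
  open CommutativeRing R hiding (zero)
  open Sums commutativeSemiring
  open Algebra.Properties.CommutativeMonoid.Sum +-commutativeMonoid using (sum; sum-permute; sum-cong-≋)
  open Algebra.Properties.Semiring.Sum semiring using (*-distribˡ-sum)

  private
    q : ℕ
    q = suc q′

    sum-toℕ : ∀ n f → sum {n} (λ i → f (toℕ i)) ≈ ∑< n f
    sum-toℕ zero    f = refl
    sum-toℕ (suc n) f = trans (+-congˡ (sum-toℕ n (f ∘ suc))) (reflexive (≡.sym (∑<-suc n f)))

    inverse : ∀ a → gcd a q ≡ 1 → ∃ λ b → (a ℕ.* b) ℕ.% q ≡ 1 ℕ.% q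
    inverse a coprime with ℕ.coprime-Bézout (ℕ.gcd≡1⇒coprime coprime)
    ... | Bézout.+- x y eq = x , ≡.trans (≡.cong (ℕ._% q) (≡.trans (ℕ.*-comm a x) (≡.sym eq))) (ℕ.[m+kn]%n≡m%n 1 y q)
    -- In this case x a ≡ -1 modulo q, so the inverse of a is -x, represented by x (q - 1).
    ... | Bézout.-+ x y eq = x ℕ.* q′ , ≡.trans (≡.sym (ℕ.[m+kn]%n≡m%n (a ℕ.* (x ℕ.* q′)) 1 q))
      (≡.trans (≡.cong (ℕ._% q) (≡.trans
          (solve 3 (λ a x q′ → a :* (x :* q′) :+ con 1 :* (con 1 :+ q′) := con 1 :+ (con 1 :+ x :* a) :* q′) ≡.refl a x q′)
          (≡.cong suc (≡.trans (≡.cong (ℕ._* q′) eq)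
            (solve 3 (λ y q q′ → y :* q :* q′ := y :* q′ :* q) ≡.refl y q q′)))))
        (ℕ.[m+kn]%n≡m%n 1 (y ℕ.* q′) q))
      where open Data.Nat.Solver.+-*-Solver

    multiply : ℕ → Fin q → Fin q
    multiply a i = (a ℕ.* toℕ i) ℕ.mod q

    toℕ-multiply : ∀ a i → toℕ (multiply a i) ≡ (a ℕ.* toℕ i) ℕ.% q
    toℕ-multiply a i = Fin.toℕ-fromℕ< _

    multiply-inverse : ∀ a b → (a ℕ.* b) ℕ.% q ≡ 1 ℕ.% q → ∀ i → multiply a (multiply b i) ≡ i
    multiply-inverse a b ab≡1 i = Fin.toℕ-injective (begin
      toℕ (multiply a (multiply b i))              ≡⟨ toℕ-multiply a (multiply b i) ⟩
      (a ℕ.* toℕ (multiply b i)) ℕ.% q             ≡⟨ ≡.cong (λ t → (a ℕ.* t) ℕ.% q) (toℕ-multiply b i) ⟩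
      (a ℕ.* ((b ℕ.* toℕ i) ℕ.% q)) ℕ.% q          ≡⟨ ℕ.%-distribˡ-* a _ q ⟩
      (a ℕ.% q ℕ.* ((b ℕ.* toℕ i) ℕ.% q ℕ.% q)) ℕ.% q  ≡⟨ ≡.cong (λ t → (a ℕ.% q ℕ.* t) ℕ.% q) (ℕ.m%n%n≡m%n (b ℕ.* toℕ i) q) ⟩
      (a ℕ.% q ℕ.* ((b ℕ.* toℕ i) ℕ.% q)) ℕ.% q    ≡⟨ ℕ.%-distribˡ-* a _ q ⟨
      (a ℕ.* (b ℕ.* toℕ i)) ℕ.% q                  ≡⟨ ≡.cong (ℕ._% q) (ℕ.*-assoc a b (toℕ i)) ⟨
      (a ℕ.* b ℕ.* toℕ i) ℕ.% q                    ≡⟨ ℕ.%-distribˡ-* (a ℕ.* b) (toℕ i) q ⟩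
      ((a ℕ.* b) ℕ.% q ℕ.* (toℕ i ℕ.% q)) ℕ.% q    ≡⟨ ≡.cong (λ t → (t ℕ.* (toℕ i ℕ.% q)) ℕ.% q) ab≡1 ⟩
      (1 ℕ.% q ℕ.* (toℕ i ℕ.% q)) ℕ.% q            ≡⟨ ℕ.%-distribˡ-* 1 (toℕ i) q ⟨
      (1 ℕ.* toℕ i) ℕ.% q                          ≡⟨ ≡.cong (ℕ._% q) (ℕ.*-identityˡ (toℕ i)) ⟩
      toℕ i ℕ.% q                                  ≡⟨ ℕ.m<n⇒m%n≡m (Fin.toℕ<n i) ⟩
      toℕ i                                        ∎)
      where open ≡.≡-Reasoning

  module _ (χ : ℕ → Carrier) (χ-* : ∀ m n → χ (m ℕ.* n) ≈ χ m * χ n) (χ-periodic : ∀ n → χ (n ℕ.+ q) ≈ χ n) where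

    private
      χ-+kq : ∀ n k → χ (n ℕ.+ k ℕ.* q) ≈ χ n
      χ-+kq n zero    = reflexive (≡.cong χ (ℕ.+-identityʳ n))
      χ-+kq n (suc k) = trans (reflexive (≡.cong χ (≡.trans (≡.cong (n ℕ.+_) (ℕ.+-comm q (k ℕ.* q))) (≡.sym (ℕ.+-assoc n (k ℕ.* q) q)))))
        (trans (χ-periodic (n ℕ.+ k ℕ.* q)) (χ-+kq n k))

      χ-% : ∀ n → χ (n ℕ.% q) ≈ χ n
      χ-% n = trans (sym (χ-+kq (n ℕ.% q) (n ℕ./ q))) (reflexive (≡.cong χ (≡.sym (ℕ.m≡m%n+[m/n]*n n q))))

    -- Multiplication by a permutes the residues modulo q.
    χ-*-sum : ∀ a → gcd a q ≡ 1 → χ a * ∑< q χ ≈ ∑< q χ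
    χ-*-sum a coprime = begin
      χ a * ∑< q χ                                   ≈⟨ *-congˡ (sum-toℕ q χ) ⟨
      χ a * sum {q} (λ i → χ (toℕ i))                ≈⟨ *-distribˡ-sum (χ a) (λ (i : Fin q) → χ (toℕ i)) ⟩
      sum {q} (λ i → χ a * χ (toℕ i))                ≈⟨ sum-cong-≋ {q} (λ i → trans (sym (χ-* a (toℕ i)))
                                                          (trans (sym (χ-% (a ℕ.* toℕ i))) (reflexive (≡.cong χ (≡.sym (toℕ-multiply a i)))))) ⟩
      sum {q} (λ i → χ (toℕ (multiply a i)))         ≈⟨ sum-permute (λ i → χ (toℕ i)) π ⟨
      sum {q} (λ i → χ (toℕ i))                      ≈⟨ sum-toℕ q χ ⟩
      ∑< q χ                                         ∎
      where
      open SetoidReasoning setoid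
      b : ℕ
      b = proj₁ (inverse a coprime)
      ab≡1 : (a ℕ.* b) ℕ.% q ≡ 1 ℕ.% q
      ab≡1 = proj₂ (inverse a coprime)
      π : Permutation q q
      π = permutation (multiply a) (multiply b) (multiply-inverse a b ab≡1)
        (multiply-inverse b a (≡.trans (≡.cong (ℕ._% q) (ℕ.*-comm b a)) ab≡1))

    χ-1-*-sum : χ 0 ≈ 0# → ∀ a → gcd a q ≡ 1 → (χ a - 1#) * ∑< q′ (χ ∘ suc) ≈ 0#
    χ-1-*-sum χ0≈0 a coprime = begin
      (χ a - 1#) * ∑< q′ (χ ∘ suc)            ≈⟨ *-congˡ S≈ ⟨
      (χ a - 1#) * ∑< q χ                     ≈⟨ distribʳ _ (χ a) (- 1#) ⟩
      χ a * ∑< q χ + - 1# * ∑< q χ            ≈⟨ +-cong (χ-*-sum a coprime) (Algebra.Properties.Ring.-1*x≈-x ring _) ⟩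
      ∑< q χ - ∑< q χ                         ≈⟨ -‿inverseʳ _ ⟩
      0#                                      ∎
      where
      open SetoidReasoning setoid
      S≈ : ∑< q χ ≈ ∑< q′ (χ ∘ suc)
      S≈ = trans (reflexive (∑<-suc q′ χ)) (trans (+-congʳ χ0≈0) (+-identityˡ _))

  -1≈0⇒≈1 : ∀ x → x - 1# ≈ 0# → x ≈ 1#
  -1≈0⇒≈1 x h = trans (sym (+-identityʳ x)) (trans (+-congˡ (sym (-‿inverseˡ 1#)))
    (trans (sym (+-assoc x (- 1#) 1#)) (trans (+-congʳ h) (+-identityˡ 1#))))

-- Complex numbers as a ring with limits

module ComplexNumbers where
  open ℚ-Order
  open RealRing using (pointwise; flip; halves)
  private
    module R = RealRing
    module L = Limits R.archimedeanRing
    module ℚS = +-*-Solver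
    open ℚS using (_:+_; _:*_; _:-_; :-_; _:=_; con)

  commutativeRing : CommutativeRing 0ℓ 0ℓ
  commutativeRing = record
    { Carrier = ℂ ; _≈_ = _≈ᶜ_ ; _+_ = _+ᶜ_ ; _*_ = _*ᶜ_ ; -_ = -ᶜ_ ; 0# = 0ᶜ ; 1# = 1ᶜ
    ; isCommutativeRing = record
      { isRing = record
        { +-isAbelianGroup = record
          { isGroup = record
            { isMonoid = record
              { isSemigroup = record
                { isMagma = record
                  { isEquivalence = record
                    { refl = λ {z} → pointwise {re z} {re z} (λ _ → ≡.refl) , pointwise {im z} {im z} (λ _ → ≡.refl)
                    ; sym = λ {z} {w} (p , q) → R.≈-sym {re z} {re w} p , R.≈-sym {im z} {im w} q
                    ; trans = λ {z} {w} {v} (p , q) (p′ , q′) →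
                        R.≈-trans {re z} {re w} {re v} p p′ , R.≈-trans {im z} {im w} {im v} q q′ }
                  ; ∙-cong = λ {z} {z′} {w} {w′} (p , q) (p′ , q′) →
                      R.+-cong {re z} {re z′} {re w} {re w′} p p′ , R.+-cong {im z} {im z′} {im w} {im w′} q q′ }
                ; assoc = λ z w v → (pointwise {re (z +ᶜ w +ᶜ v)} {re (z +ᶜ (w +ᶜ v))} λ n → ℚ.+-assoc (seq (re z) n) _ _)
                                  , (pointwise {im (z +ᶜ w +ᶜ v)} {im (z +ᶜ (w +ᶜ v))} λ n → ℚ.+-assoc (seq (im z) n) _ _) }
              ; identity = (λ z → (pointwise {re (0ᶜ +ᶜ z)} {re z} λ n → ℚ.+-identityˡ _) , (pointwise {im (0ᶜ +ᶜ z)} {im z} λ n → ℚ.+-identityˡ _))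
                         , (λ z → (pointwise {re (z +ᶜ 0ᶜ)} {re z} λ n → ℚ.+-identityʳ _) , (pointwise {im (z +ᶜ 0ᶜ)} {im z} λ n → ℚ.+-identityʳ _)) }
            ; inverse = (λ z → (pointwise {re (-ᶜ z +ᶜ z)} {0ʳ} λ n → ℚ.+-inverseˡ (seq (re z) n)) , (pointwise {im (-ᶜ z +ᶜ z)} {0ʳ} λ n → ℚ.+-inverseˡ (seq (im z) n)))
                      , (λ z → (pointwise {re (z +ᶜ -ᶜ z)} {0ʳ} λ n → ℚ.+-inverseʳ (seq (re z) n)) , (pointwise {im (z +ᶜ -ᶜ z)} {0ʳ} λ n → ℚ.+-inverseʳ (seq (im z) n)))
            ; ⁻¹-cong = λ {z} {w} (p , q) → R.neg-cong {re z} {re w} p , R.neg-cong {im z} {im w} q }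
          ; comm = λ z w → (pointwise {re (z +ᶜ w)} {re (w +ᶜ z)} λ n → ℚ.+-comm (seq (re z) n) _) , (pointwise {im (z +ᶜ w)} {im (w +ᶜ z)} λ n → ℚ.+-comm (seq (im z) n) _) }
        ; *-cong = λ {z} {z′} {w} {w′} (p , q) (p′ , q′) →
            R.+-cong {re z *ʳ re w} {re z′ *ʳ re w′} { -ʳ (im z *ʳ im w)} { -ʳ (im z′ *ʳ im w′)}
              (R.*-cong {re z} {re z′} {re w} {re w′} p p′)
              (R.neg-cong {im z *ʳ im w} {im z′ *ʳ im w′} (R.*-cong {im z} {im z′} {im w} {im w′} q q′))
          , R.+-cong {re z *ʳ im w} {re z′ *ʳ im w′} {im z *ʳ re w} {im z′ *ʳ re w′}
              (R.*-cong {re z} {re z′} {im w} {im w′} p q′)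
              (R.*-cong {im z} {im z′} {re w} {re w′} q p′)
        ; *-assoc = λ z w v →
            (pointwise {re (z *ᶜ w *ᶜ v)} {re (z *ᶜ (w *ᶜ v))} λ n →
              ℚS.solve 6 (λ a b c d e f → (a :* c :- b :* d) :* e :- (a :* d :+ b :* c) :* f
                := a :* (c :* e :- d :* f) :- b :* (c :* f :+ d :* e)) ≡.refl
                (seq (re z) n) (seq (im z) n) (seq (re w) n) (seq (im w) n) (seq (re v) n) (seq (im v) n))
          , (pointwise {im (z *ᶜ w *ᶜ v)} {im (z *ᶜ (w *ᶜ v))} λ n →
              ℚS.solve 6 (λ a b c d e f → (a :* c :- b :* d) :* f :+ (a :* d :+ b :* c) :* e
                := a :* (c :* f :+ d :* e) :+ b :* (c :* e :- d :* f)) ≡.refl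
                (seq (re z) n) (seq (im z) n) (seq (re w) n) (seq (im w) n) (seq (re v) n) (seq (im v) n))
        ; *-identity = (λ z → (pointwise {re (1ᶜ *ᶜ z)} {re z} λ n →
                              ℚS.solve 2 (λ a b → con 1ℚ :* a :- con 0ℚ :* b := a) ≡.refl (seq (re z) n) (seq (im z) n))
                            , (pointwise {im (1ᶜ *ᶜ z)} {im z} λ n →
                              ℚS.solve 2 (λ a b → con 1ℚ :* b :+ con 0ℚ :* a := b) ≡.refl (seq (re z) n) (seq (im z) n)))
                     , (λ z → (pointwise {re (z *ᶜ 1ᶜ)} {re z} λ n →
                              ℚS.solve 2 (λ a b → a :* con 1ℚ :- b :* con 0ℚ := a) ≡.refl (seq (re z) n) (seq (im z) n))
                            , (pointwise {im (z *ᶜ 1ᶜ)} {im z} λ n →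
                              ℚS.solve 2 (λ a b → a :* con 0ℚ :+ b :* con 1ℚ := b) ≡.refl (seq (re z) n) (seq (im z) n)))
        ; distrib = (λ z w v →
                (pointwise {re (z *ᶜ (w +ᶜ v))} {re (z *ᶜ w +ᶜ z *ᶜ v)} λ n →
                  ℚS.solve 6 (λ a b c d e f → a :* (c :+ e) :- b :* (d :+ f) := (a :* c :- b :* d) :+ (a :* e :- b :* f)) ≡.refl
                    (seq (re z) n) (seq (im z) n) (seq (re w) n) (seq (im w) n) (seq (re v) n) (seq (im v) n))
              , (pointwise {im (z *ᶜ (w +ᶜ v))} {im (z *ᶜ w +ᶜ z *ᶜ v)} λ n →
                  ℚS.solve 6 (λ a b c d e f → a :* (d :+ f) :+ b :* (c :+ e) := (a :* d :+ b :* c) :+ (a :* f :+ b :* e)) ≡.refl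
                    (seq (re z) n) (seq (im z) n) (seq (re w) n) (seq (im w) n) (seq (re v) n) (seq (im v) n)))
            , (λ z w v →
                (pointwise {re ((w +ᶜ v) *ᶜ z)} {re (w *ᶜ z +ᶜ v *ᶜ z)} λ n →
                  ℚS.solve 6 (λ a b c d e f → (c :+ e) :* a :- (d :+ f) :* b := (c :* a :- d :* b) :+ (e :* a :- f :* b)) ≡.refl
                    (seq (re z) n) (seq (im z) n) (seq (re w) n) (seq (im w) n) (seq (re v) n) (seq (im v) n))
              , (pointwise {im ((w +ᶜ v) *ᶜ z)} {im (w *ᶜ z +ᶜ v *ᶜ z)} λ n →
                  ℚS.solve 6 (λ a b c d e f → (c :+ e) :* b :+ (d :+ f) :* a := (c :* b :+ d :* a) :+ (e :* b :+ f :* a)) ≡.refl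
                    (seq (re z) n) (seq (im z) n) (seq (re w) n) (seq (im w) n) (seq (re v) n) (seq (im v) n))) }
      ; *-comm = λ z w →
          (pointwise {re (z *ᶜ w)} {re (w *ᶜ z)} λ n →
            ℚS.solve 4 (λ a b c d → a :* c :- b :* d := c :* a :- d :* b) ≡.refl (seq (re z) n) (seq (im z) n) (seq (re w) n) (seq (im w) n))
        , (pointwise {im (z *ᶜ w)} {im (w *ᶜ z)} λ n →
            ℚS.solve 4 (λ a b c d → a :* d :+ b :* c := c :* b :+ d :* a) ≡.refl (seq (re z) n) (seq (im z) n) (seq (re w) n) (seq (im w) n)) } }

  ℚ-algebra : ℚ-Algebra
  ℚ-algebra = record
    { commutativeRing = commutativeRing
    ; ι = λ p → fromℝ (fromℚ p)
    ; ι-0 = C.refl {0ᶜ}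
    ; ι-1 = C.refl {1ᶜ}
    ; ι-+ = λ p q → (pointwise {fromℚ (p ℚ.+ q)} {fromℚ p +ʳ fromℚ q} λ _ → ≡.refl) , (pointwise {0ʳ} {0ʳ +ʳ 0ʳ} λ _ → ≡.refl)
    ; ι-* = λ p q →
        (pointwise {fromℚ (p ℚ.* q)} {fromℚ p *ʳ fromℚ q -ʳ 0ʳ *ʳ 0ʳ} λ _ → ℚS.solve 2 (λ p q → p :* q := p :* q :- con 0ℚ :* con 0ℚ) ≡.refl p q)
      , (pointwise {0ʳ} {fromℚ p *ʳ 0ʳ +ʳ 0ʳ *ʳ fromℚ q} λ _ → ℚS.solve 2 (λ p q → con 0ℚ := p :* con 0ℚ :+ con 0ℚ :* q) ≡.refl p q)
    ; ι-neg = λ p → (pointwise {fromℚ (ℚ.- p)} { -ʳ fromℚ p} λ _ → ≡.refl) , (pointwise {0ʳ} { -ʳ 0ʳ} λ _ → ≡.refl)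
    }
    where module C = CommutativeRing commutativeRing

  limitRing : LimitRing
  limitRing = record
    { ℚ-algebra = ℚ-algebra
    ; _⟶_ = _⟶ᶜ_
    ; lim-cong = λ {s} {t} {l} {m} s≈t (p , q) (h , k) →
        L.lim-cong {re ∘ s} {re ∘ t} {re l} {re m} (λ n → proj₁ (s≈t n)) p h , L.lim-cong {im ∘ s} {im ∘ t} {im l} {im m} (λ n → proj₂ (s≈t n)) q k
    ; lim-const = λ l → L.lim-const (re l) , L.lim-const (im l)
    ; lim-+ = λ {s} {t} {l} {m} (h , k) (h′ , k′) →
        L.lim-+ {re ∘ s} {re ∘ t} {re l} {re m} h h′ , L.lim-+ {im ∘ s} {im ∘ t} {im l} {im m} k k′
    ; lim-* = λ {s} {t} {l} {m} (h , k) (h′ , k′) →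
        L.lim-+ {λ n → re (s n) *ʳ re (t n)} {λ n → -ʳ (im (s n) *ʳ im (t n))} {re l *ʳ re m} { -ʳ (im l *ʳ im m)}
          (L.lim-* {re ∘ s} {re ∘ t} {re l} {re m} h h′)
          (L.lim-neg {λ n → im (s n) *ʳ im (t n)} {im l *ʳ im m} (L.lim-* {im ∘ s} {im ∘ t} {im l} {im m} k k′))
      , L.lim-+ {λ n → re (s n) *ʳ im (t n)} {λ n → im (s n) *ʳ re (t n)} {re l *ʳ im m} {im l *ʳ re m}
          (L.lim-* {re ∘ s} {im ∘ t} {re l} {im m} h k′)
          (L.lim-* {im ∘ s} {re ∘ t} {im l} {re m} k h′)
    ; lim-suc = λ {s} {l} (h , k) → L.lim-suc {re ∘ s} {re l} h , L.lim-suc {im ∘ s} {im l} k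
    ; lim-interleave = λ q {s} {l} h →
        L.lim-interleave q {re ∘ s} {re l} (λ r r<q → proj₁ (h r r<q)) , L.lim-interleave q {im ∘ s} {im l} (λ r r<q → proj₂ (h r r<q))
    }

-- Double-negation stability and absence of zero divisors in ℂ

module Stability where
  open ℚ-Order
  open RealRing using (pointwise; flip; halves; bounded)
  private
    module R = RealRing
    module ℚS = +-*-Solver
    open ℚS using (_:+_; _:*_; _:-_; :-_; _:=_; con)

    Null : ℝ → Set
    Null x = ∀ ε → 0ℚ ℚ.< ε → Eventually λ n → ℚ.∣ seq x n ∣ ℚ.≤ ε

    null⇒≈0 : ∀ {x} → Null x → x ≈ʳ 0ʳ
    null⇒≈0 {x} h ε 0<ε = eventually-map (λ n → ≡.subst (λ t → ℚ.∣ t ∣ ℚ.≤ ε) (≡.sym (ℚ.+-identityʳ (seq x n)))) (h ε 0<ε)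

    ≈0⇒null : ∀ {x} → x ≈ʳ 0ʳ → Null x
    ≈0⇒null {x} h ε 0<ε = eventually-map (λ n → ≡.subst (λ t → ℚ.∣ t ∣ ℚ.≤ ε) (ℚ.+-identityʳ (seq x n))) (h ε 0<ε)

    AwayFrom0 : ℝ → Set
    AwayFrom0 x = ∃ λ δ → 0ℚ ℚ.< δ × Eventually λ n → δ ℚ.≤ ℚ.∣ seq x n ∣

    -- Decided by one rational term: if the terms from N on differ by at most ε/4, then |x_N| ≤ ε/2
    -- keeps the later ones below ε, and |x_N| > ε/2 keeps them above ε/4.
    small-or-away : ∀ x ε → 0ℚ ℚ.< ε → (Eventually λ n → ℚ.∣ seq x n ∣ ℚ.≤ ε) ⊎ AwayFrom0 x
    small-or-away x ε 0<ε with cauchy x (½ ℚ.* (½ ℚ.* ε)) (half-pos (half-pos 0<ε))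
    ... | N , hN with ℚ.∣ seq x N ∣ ℚ.≤? ½ ℚ.* ε
    ... | yes le = inj₁ (N , λ n Nn → halves
          (ℚS.solve 2 (λ a b → a := (a :- b) :+ b) ≡.refl (seq x n) (seq x N))
          (ℚ.≤-trans (hN n N Nn ℕ.≤-refl) (≤-by (½ ℚ.* (½ ℚ.* ε)) (ℚ.<⇒≤ (half-pos (half-pos 0<ε))) (≡.sym (half+half (½ ℚ.* ε)))))
          le)
    ... | no ≰ = inj₂ (½ ℚ.* (½ ℚ.* ε) , half-pos (half-pos 0<ε) , N , λ n Nn →
          ≤-by ((ℚ.∣ seq x N ∣ ℚ.- ½ ℚ.* ε) ℚ.+ (½ ℚ.* (½ ℚ.* ε) ℚ.- ℚ.∣ seq x N ℚ.- seq x n ∣) ℚ.+ (ℚ.∣ seq x N ℚ.- seq x n ∣ ℚ.+ ℚ.∣ seq x n ∣ ℚ.- ℚ.∣ seq x N ∣))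
            (0≤+0≤ (0≤+0≤ (0≤- (ℚ.<⇒≤ (ℚ.≰⇒> ≰))) (0≤- (hN N n ℕ.≤-refl Nn)))
              (0≤- (ℚ.≤-trans (ℚ.≤-reflexive (≡.cong ℚ.∣_∣ (ℚS.solve 2 (λ a b → a := (a :- b) :+ b) ≡.refl (seq x N) (seq x n))))
                     (ℚ.∣p+q∣≤∣p∣+∣q∣ (seq x N ℚ.- seq x n) (seq x n)))))
            (ℚS.solve 4 (λ e a b c → b := con ½ :* (con ½ :* e) :+ ((a :- con ½ :* e) :+ (con ½ :* (con ½ :* e) :- c) :+ (c :+ b :- a))) ≡.refl
              ε ℚ.∣ seq x N ∣ ℚ.∣ seq x n ∣ ℚ.∣ seq x N ℚ.- seq x n ∣))

    away⇒≉0 : ∀ {x} → AwayFrom0 x → ¬ Null x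
    away⇒≉0 (δ , 0<δ , hδ) null =
      let N , h = eventually-× hδ (null (½ ℚ.* δ) (half-pos 0<δ))
          δ≤ , ≤½δ = h N ℕ.≤-refl
          δ≤½δ = ℚ.≤-trans δ≤ ≤½δ
          ½δ<δ = ℚ.<-respʳ-≡ (half+half δ) (ℚ.<-respˡ-≡ (ℚ.+-identityʳ (½ ℚ.* δ)) (ℚ.+-monoʳ-< (½ ℚ.* δ) (half-pos 0<δ)))
      in ℚ.<-irrefl ≡.refl (ℚ.<-≤-trans ½δ<δ δ≤½δ)

    ¬away⇒null : ∀ {x} → ¬ AwayFrom0 x → Null x
    ¬away⇒null {x} ¬away ε 0<ε with small-or-away x ε 0<ε
    ... | inj₁ small = small
    ... | inj₂ away  = contradiction away ¬away

    -- Being null is equivalent to the negation of being away from 0, and negations are stable.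
    stable : ∀ {x} → ¬ ¬ Null x → Null x
    stable {x} ¬¬null = ¬away⇒null {x} λ away → ¬¬null (away⇒≉0 {x} away)

    -- If x were bounded away from 0, then y would be null; hence x is not away from 0, which makes
    -- it null.
    cancel : ∀ {x y} → Null (x *ʳ y) → ¬ Null y → Null x
    cancel {x} {y} xy ¬y = ¬away⇒null {x} λ (δ , 0<δ , hδ) → ¬y λ ε 0<ε → eventually-map
      (λ n (δ≤ , le) → ℚ.*-cancelˡ-≤-pos δ {{ℚ.positive 0<δ}} (ℚ.≤-trans
        (ℚ.*-monoʳ-≤-nonNeg ℚ.∣ seq y n ∣ {{ℚ.∣-∣-nonNeg (seq y n)}} δ≤)
        (ℚ.≤-trans (ℚ.≤-reflexive (≡.sym (ℚ.∣p*q∣≡∣p∣*∣q∣ (seq x n) (seq y n)))) le)))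
      (eventually-× hδ (xy (δ ℚ.* ε) (0<*0< 0<δ 0<ε)))

    square≤ : ∀ p ε → 0ℚ ℚ.< ε → p ℚ.* p ℚ.≤ ε ℚ.* ε → ℚ.∣ p ∣ ℚ.≤ ε
    square≤ p ε 0<ε le with ℚ.∣ p ∣ ℚ.≤? ε
    ... | yes p≤ = p≤
    ... | no  p≰ = contradiction
      (ℚ.<-≤-trans (ℚ.<-≤-trans (ℚ.*-monoʳ-<-pos ε {{ℚ.positive 0<ε}} ε<p)
          (ℚ.*-monoʳ-≤-nonNeg ℚ.∣ p ∣ {{ℚ.∣-∣-nonNeg p}} (ℚ.<⇒≤ ε<p)))
        (ℚ.≤-trans (ℚ.≤-reflexive (≡.trans (≡.sym (ℚ.∣p*q∣≡∣p∣*∣q∣ p p)) (ℚ.0≤p⇒∣p∣≡p (0≤square p)))) le))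
      (ℚ.<-irrefl ≡.refl)
      where
      ε<p : ε ℚ.< ℚ.∣ p ∣
      ε<p = ℚ.≰⇒> p≰

    summandˡ-null : ∀ x y → Null (x *ʳ x +ʳ y *ʳ y) → Null x
    summandˡ-null x y h ε 0<ε = eventually-map
      (λ n le → square≤ (seq x n) ε 0<ε (ℚ.≤-trans (≤-by (seq y n ℚ.* seq y n) (0≤square (seq y n)) ≡.refl)
        (ℚ.≤-trans (p≤∣p∣ _) le)))
      (h (ε ℚ.* ε) (0<*0< 0<ε 0<ε))

    norm : ℂ → ℝ
    norm z = re z *ʳ re z +ʳ im z *ʳ im z

    norm-null : ∀ z → Null (norm z) → z ≈ᶜ 0ᶜ
    norm-null z h = null⇒≈0 {re z} (summandˡ-null (re z) (im z) h)
      , null⇒≈0 {im z} (summandˡ-null (im z) (re z) (≈0⇒null {im z *ʳ im z +ʳ re z *ʳ re z}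
          (R.≈-trans {im z *ʳ im z +ʳ re z *ʳ re z} {norm z} {0ʳ}
            (pointwise {im z *ʳ im z +ʳ re z *ʳ re z} {norm z} λ n → ℚ.+-comm (seq (im z) n ℚ.* seq (im z) n) _)
            (null⇒≈0 {norm z} h))))

    combination-null : ∀ {x y z} (a b : ℕ → ℚ) → (∀ n → seq z n ≡ a n ℚ.* seq x n ℚ.+ b n ℚ.* seq y n) →
      (∃ λ B → 0ℚ ℚ.< B × Eventually λ n → ℚ.∣ a n ∣ ℚ.≤ B) → (∃ λ B → 0ℚ ℚ.< B × Eventually λ n → ℚ.∣ b n ∣ ℚ.≤ B) →
      Null x → Null y → Null z
    combination-null {x} {y} {z} a b eq (A , 0<A , hA) (B , 0<B , hB) hx hy ε 0<ε =
      let δ , 0<δ , Aδ = divide (½ ℚ.* ε) 0<A (half-pos 0<ε)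
          η , 0<η , Bη = divide (½ ℚ.* ε) 0<B (half-pos 0<ε)
      in eventually-map
        (λ n (a≤ , b≤ , x≤ , y≤) → halves (eq n) (product≤ (a n) (seq x n) 0<A Aδ a≤ x≤) (product≤ (b n) (seq y n) 0<B Bη b≤ y≤))
        (eventually-× hA (eventually-× hB (eventually-× (hx δ 0<δ) (hy η 0<η))))

  ≈0-stable : ∀ {z} → ¬ ¬ z ≈ᶜ 0ᶜ → z ≈ᶜ 0ᶜ
  ≈0-stable {z} ¬¬z =
      null⇒≈0 {re z} (stable {re z} λ ¬n → ¬¬z λ z≈0 → ¬n (≈0⇒null {re z} (proj₁ z≈0)))
    , null⇒≈0 {im z} (stable {im z} λ ¬n → ¬¬z λ z≈0 → ¬n (≈0⇒null {im z} (proj₂ z≈0)))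

  -- Multiplying z w by the conjugate of w writes both parts of z |w|² as combinations of the null
  -- parts of z w with bounded coefficients; the real number |w|² is then cancelled.
  *-≈0 : ∀ {z w} → z *ᶜ w ≈ᶜ 0ᶜ → ¬ w ≈ᶜ 0ᶜ → z ≈ᶜ 0ᶜ
  *-≈0 {z} {w} (p , q) w≉0 =
      null⇒≈0 {re z} (cancel {re z} {norm w}
        (combination-null {re (z *ᶜ w)} {im (z *ᶜ w)} {re z *ʳ norm w} (seq (re w)) (seq (im w))
          (λ n → ℚS.solve 4 (λ a b c d → a :* (c :* c :+ d :* d) := c :* (a :* c :- b :* d) :+ d :* (a :* d :+ b :* c)) ≡.refl
            (seq (re z) n) (seq (im z) n) (seq (re w) n) (seq (im w) n))
          (bounded (re w)) (bounded (im w)) re-null im-null) norm≉0)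
    , null⇒≈0 {im z} (cancel {im z} {norm w}
        (combination-null {im (z *ᶜ w)} {re (z *ᶜ w)} {im z *ʳ norm w} (seq (re w)) (λ n → ℚ.- seq (im w) n)
          (λ n → ℚS.solve 4 (λ a b c d → b :* (c :* c :+ d :* d) := c :* (a :* d :+ b :* c) :+ (:- d) :* (a :* c :- b :* d)) ≡.refl
            (seq (re z) n) (seq (im z) n) (seq (re w) n) (seq (im w) n))
          (bounded (re w)) (bounded (-ʳ im w)) im-null re-null) norm≉0)
    where
    norm≉0 : ¬ Null (norm w)
    norm≉0 h = w≉0 (norm-null w h)
    re-null : Null (re (z *ᶜ w))
    re-null = ≈0⇒null {re (z *ᶜ w)} p
    im-null : Null (im (z *ᶜ w))
    im-null = ≈0⇒null {im (z *ᶜ w)} q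

-- Vanishing of the sum of a nonprincipal character

module NonprincipalSum (R : CommutativeRing 0ℓ 0ℓ) (q′ : ℕ) where
  open CommutativeRing R hiding (zero)
  open Sums commutativeSemiring using (∑<)
  open CharacterSum R q′

  private
    q : ℕ
    q = suc q′

  module _
    (≈0-stable : ∀ {x} → ¬ ¬ x ≈ 0# → x ≈ 0#)
    (*-≈0 : ∀ {x y} → x * y ≈ 0# → ¬ y ≈ 0# → x ≈ 0#)
    (χ : ℤ → Carrier)
    (χ-* : ∀ a b → χ (a ℤ.* b) ≈ χ a * χ b)
    (χ-1 : χ (+ 1) ≈ 1#)
    (χ-periodic : ∀ a → χ (a ℤ.+ + q) ≈ χ a)
    (χ-vanish : ∀ a → gcd ℤ.∣ a ∣ q ≢ 1 → χ a ≈ 0#)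
    (nonprincipal : ¬ (∀ a → gcd ℤ.∣ a ∣ q ≡ 1 → χ a ≈ 1#)) where

    private
      χℕ : ℕ → Carrier
      χℕ n = χ (+ n)

      χℕ-* : ∀ m n → χℕ (m ℕ.* n) ≈ χℕ m * χℕ n
      χℕ-* m n = trans (reflexive (≡.cong χ (ℤ.pos-* m n))) (χ-* (+ m) (+ n))

      -- A character of period 1 is constantly χ(1) = 1, hence principal.
      q≢1 : q ≢ 1
      q≢1 q≡1 = nonprincipal λ a _ → trans (≈χ1 a) χ-1
        where
        step : ∀ a → χ (a ℤ.+ + 1) ≈ χ a
        step = ≡.subst (λ q → ∀ a → χ (a ℤ.+ + q) ≈ χ a) q≡1 χ-periodic
        ≈χ1 : ∀ a → χ a ≈ χ (+ 1)
        ≈χ1 (+ zero)        = sym (step (+ 0))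
        ≈χ1 (+ suc zero)    = refl
        ≈χ1 (+ suc (suc n)) = trans (reflexive (≡.cong (λ m → χ (+ m)) (ℕ.+-comm 1 (suc n)))) (trans (step (+ suc n)) (≈χ1 (+ suc n)))
        ≈χ1 ℤ.-[1+ zero ]   = trans (sym (step ℤ.-[1+ 0 ])) (≈χ1 (+ 0))
        ≈χ1 ℤ.-[1+ suc n ]  = trans (sym (step ℤ.-[1+ suc n ])) (≈χ1 ℤ.-[1+ n ])

    χ-q≈0 : χ (+ q) ≈ 0#
    χ-q≈0 = χ-vanish (+ q) λ eq → q≢1 (ℕ.gcd≡1⇒coprime eq (ℕ.∣-refl , ℕ.∣-refl))

    private
      S : Carrier
      S = ∑< q′ (λ i → χ (+ suc i))

      principalℕ : ¬ S ≈ 0# → ∀ n → gcd n q ≡ 1 → χℕ n ≈ 1#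
      principalℕ S≉0 n coprime = -1≈0⇒≈1 (χℕ n) (*-≈0 (χ-1-*-sum χℕ χℕ-* (λ n → χ-periodic (+ n))
        (χ-vanish (+ 0) λ eq → q≢1 (ℕ.0-coprimeTo-m⇒m≡1 (ℕ.gcd≡1⇒coprime eq))) n coprime) S≉0)

      coprime-q′ : gcd q′ q ≡ 1
      coprime-q′ = ℕ.coprime⇒gcd≡1 (ℕ.sym (≡.subst (λ n → ℕ.Coprime n q′) (ℕ.+-comm q′ 1) (ℕ.coprime-+ (ℕ.1-coprimeTo q′))))

      principal : ¬ S ≈ 0# → ∀ a → gcd ℤ.∣ a ∣ q ≡ 1 → χ a ≈ 1#
      principal S≉0 (+ n)      coprime = principalℕ S≉0 n coprime
      principal S≉0 ℤ.-[1+ n ] coprime = begin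
        χ ℤ.-[1+ n ]                     ≡⟨ ≡.cong χ (ℤ.-1*i≡-i (+ suc n)) ⟨
        χ (ℤ.-[1+ 0 ] ℤ.* + suc n)       ≈⟨ χ-* ℤ.-[1+ 0 ] (+ suc n) ⟩
        -- χ(-1) = χ(q - 1) by periodicity, and q - 1 is coprime to q; negative arguments thus
        -- reduce to natural ones.
        χ ℤ.-[1+ 0 ] * χℕ (suc n)        ≈⟨ *-cong (trans (sym (χ-periodic ℤ.-[1+ 0 ])) (principalℕ S≉0 q′ coprime-q′)) (principalℕ S≉0 (suc n) coprime) ⟩
        1# * 1#                          ≈⟨ *-identityˡ 1# ⟩
        1#                               ∎
        where open SetoidReasoning setoid

    -- (χ(a) - 1) S = 0 for all a coprime to q. A sum S that is not 0 would force all these χ(a) to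
    -- be 1, so S ≠ 0 is refuted, and stability turns this into S = 0.
    χ-sum≈0 : ∑< q′ (λ i → χ (+ suc i)) ≈ 0#
    χ-sum≈0 = ≈0-stable λ S≉0 → nonprincipal (principal S≉0)

module ReciprocalLimits where
  open ℚ-Order
  open Fractions using (fromNat)

  fromℝ-limit : ∀ {s l} → s ⟶ʳ l → (λ n → fromℝ (s n)) ⟶ᶜ fromℝ l
  fromℝ-limit h = h , Limits.lim-const RealRing.archimedeanRing 0ʳ

  r-null : ∀ {y} → 0ℚ ℚ.< y → (λ m → fromℝ (fromℚ (Reciprocals.r y m))) ⟶ᶜ 0ᶜ
  r-null {y} 0<y = fromℝ-limit {λ m → fromℚ (Reciprocals.r y m)} {0ʳ} λ ε 0<ε →
    let δ , 0<δ , εδ = divide 1ℚ 0<ε (ℚ.positive⁻¹ 1ℚ)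
        N , δ≤N = Fractions.archimedean δ
    in N , λ m N≤m η 0<η → 0 , λ _ _ → ≡.subst (ℚ._≤ ε ℚ.+ η)
        (≡.sym (≡.trans (≡.cong ℚ.∣_∣ (ℚ.+-identityʳ (Reciprocals.r y m))) (ℚ.0≤p⇒∣p∣≡p (ℚ.<⇒≤ (Reciprocals.0<r 0<y m)))))
        (ℚ.≤-trans (ℚ.*-cancelˡ-≤-pos (y ℚ.+ fromNat m) {{ℚ.positive (Reciprocals.0<y+i 0<y m)}} (begin
          (y ℚ.+ fromNat m) ℚ.* Reciprocals.r y m   ≡⟨ Reciprocals.*-r 0<y m ⟩
          1ℚ                                        ≡⟨ εδ ⟨
          ε ℚ.* δ                                   ≤⟨ ℚ.*-monoˡ-≤-nonNeg ε {{ℚ.nonNegative (ℚ.<⇒≤ 0<ε)}}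
                                                         (ℚ.≤-trans δ≤N (ℚ.≤-trans (Fractions.fromNat-mono N≤m) (≤-by y (ℚ.<⇒≤ 0<y) (ℚ.+-comm y (fromNat m))))) ⟩
          ε ℚ.* (y ℚ.+ fromNat m)                   ≡⟨ ℚ.*-comm ε _ ⟩
          (y ℚ.+ fromNat m) ℚ.* ε                   ∎))
        (≤-by η (ℚ.<⇒≤ 0<η) ≡.refl))
    where open ℚ.≤-Reasoning

-- The limit

module BellFactor (Q : ℚ-Algebra) where
  open ℚ-Algebra Q hiding (zero)
  open RawSemiringDefs (CommutativeSemiring.rawSemiring commutativeSemiring) using (product) renaming (_×_ to _·_; _^_ to _^_)
  open Algebra.Properties.Semiring.Mult semiring using (×-comm-*; ×-assoc-*)
  open Scalars Q
  open Sums commutativeSemiring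
  open PowerSeries commutativeSemiring using (Series; IsLogDerivative; logDerivative-cong; _⋆_)
  open Exponential commutativeSemiring (λ n → ι (Fractions.1/suc n)) ·-ι-1/suc using (1/n!; exp)
  open Bell commutativeSemiring (λ n → ι (Fractions.1/suc n)) ·-ι-1/suc
  open NatSolver commutativeSemiring
  open SetoidReasoning setoid
  open Fractions using (fromNat)

  bellReciprocal : ∀ {m} → Vector ℕ m → Vector Carrier m
  bellReciprocal j i = ι (1/fact (j i))

  bellBase : ∀ {m} → Vector Carrier m → Vector Carrier m
  bellBase x i = x i * ι (1/fact (suc (toℕ i)))

  bellPower : ∀ {m} → Vector Carrier m → Vector ℕ m → Vector Carrier m
  bellPower x j i = bellBase x i ^ j i

  bellTerm : (n k : ℕ) → Vector Carrier (suc (n ℕ.∸ k)) → Vector ℕ (suc (n ℕ.∸ k)) → Carrier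
  bellTerm n k x j =
    ι (fromNat (n !)) * product (bellReciprocal j) * product (bellPower x j)

  -- The Bell polynomial over an arbitrary ℚ-algebra; `seq-bell` compares it over ℝ with `Bell`.
  bell : (n k : ℕ) → Vector Carrier (suc (n ℕ.∸ k)) → Carrier
  bell n k x = ∑ (bellExponents n k) (bellTerm n k x)

  -1# : Carrier
  -1# = - 1#

  alternatingTerm : (ℕ → Carrier) → ℕ → ℕ⁺ → Carrier
  alternatingTerm x n k = -1# ^ proj₁ k * bell n (proj₁ k) (λ i → x (toℕ i))

  private
    1/n!≈ : ∀ n → 1/n! n ≈ ι (1/fact n)
    1/n!≈ zero    = sym ι-1
    1/n!≈ (suc n) = trans (*-congˡ (1/n!≈ n)) (trans (sym (ι-* _ _)) (reflexive (≡.cong ι (Fractions.1/fact-suc n))))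

    product-* : ∀ {m} (f g h : Vector Carrier m) → (∀ i → g i * f i ≈ h i) → product f * product g ≈ product h
    product-* {zero}  f g h eq = *-identityˡ _
    product-* {suc m} f g h eq = trans
      (solve 4 (λ a b c d → a :* b :* (c :* d) := c :* a :* (b :* d)) refl _ _ _ _)
      (*-cong (eq Fin.zero) (product-* (f ∘ Fin.suc) (g ∘ Fin.suc) (h ∘ Fin.suc) (eq ∘ Fin.suc)))

  module _ (x : ℕ → Carrier) where

    private
      c : ℕ → Carrier
      c i = x i * ι (1/fact (suc i))

    bell≈ : ∀ n k → bell n k (λ i → x (toℕ i)) ≈ ι (fromNat (n !)) * bellSum c n k
    bell≈ n k = trans (∑-cong (bellExponents n k) λ j → trans (*-assoc _ _ _)
        (*-congˡ (product-* (λ i → ι (1/fact (j i))) (λ i → c (toℕ i) ^ j i) (λ i → exp (c (toℕ i)) (j i)) λ i → *-congˡ (sym (1/n!≈ (j i))))))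
      (sym (∑-*ˡ (ι (fromNat (n !))) (bellExponents n k) _))

    coefficients : Series
    coefficients = exp∘shift (λ i → -1# * c i)

    coefficients-bell : ∀ n (term : ℕ⁺ → Carrier) → 1 ℕ.≤ n → (∀ k → term k ≈ alternatingTerm x n k) →
      ι (1/fact n) * ∑ (interval n) term ≈ coefficients n
    coefficients-bell n term 1≤n term≈ = begin
      ι (1/fact n) * ∑ (interval n) term
        ≈⟨ *-congˡ (trans (∑-cong (interval n) term≈) (∑-map _ (upTo n) _)) ⟩
      ι (1/fact n) * ∑< n (λ k → -1# ^ suc k * bell n (suc k) (λ i → x (toℕ i)))
        ≈⟨ ∑-*ˡ _ (upTo n) _ ⟩
      ∑< n (λ k → ι (1/fact n) * (-1# ^ suc k * bell n (suc k) (λ i → x (toℕ i))))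
        ≈⟨ ∑-cong (upTo n) (λ k → trans (*-congˡ (*-congˡ (bell≈ n (suc k))))
             (trans (solve 4 (λ f s n b → f :* (s :* (n :* b)) := (n :* f) :* (s :* b)) refl _ _ _ _)
               (trans (*-congʳ inverse) (*-identityˡ _)))) ⟩
      ∑< n (λ k → -1# ^ suc k * bellSum c n (suc k))
        ≈⟨ exp∘shift-bell -1# c n 1≤n ⟨
      coefficients n ∎
      where
      inverse : ι (fromNat (n !)) * ι (1/fact n) ≈ 1#
      inverse = trans (sym (ι-* _ _)) (trans (reflexive (≡.cong ι (Fractions.fromNat-*-1/fact n))) ι-1)

    coefficients-zero : coefficients 0 ≈ 1#
    coefficients-zero = exp∘shift-zero (λ i → -1# * c i)

    -- The exponent -Σ x_i tⁱ⁺¹/(i+1)! has the derivative -Σ x_i tⁱ/i!.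
    logDerivative-coefficients : IsLogDerivative (λ i → ι (ℚ.- 1/fact i) * x i) coefficients
    logDerivative-coefficients = logDerivative-cong scalar (λ _ → refl) (logDerivative-exp∘shift (λ i → -1# * c i))
      where
      scalar : ∀ i → suc i · (-1# * (x i * ι (1/fact (suc i)))) ≈ ι (ℚ.- 1/fact i) * x i
      scalar i = begin
        suc i · (-1# * (x i * ι (1/fact (suc i))))    ≈⟨ ×-comm-* (suc i) _ _ ⟨
        -1# * (suc i · (x i * ι (1/fact (suc i))))    ≈⟨ *-congˡ (×-comm-* (suc i) _ _) ⟨
        -1# * (x i * (suc i · ι (1/fact (suc i))))    ≈⟨ *-congˡ (*-congˡ (·-ι (suc i) _)) ⟩
        -1# * (x i * ι (suc i Fractions.· 1/fact (suc i)))
          ≈⟨ *-congˡ (*-congˡ (reflexive (≡.cong ι (≡.trans (≡.cong (suc i Fractions.·_) (≡.sym (Fractions.1/fact-suc i))) (factorial i))))) ⟩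
        -1# * (x i * ι (1/fact i))                    ≈⟨ trans (*-congˡ (*-comm _ _)) (sym (*-assoc _ _ _)) ⟩
        -1# * ι (1/fact i) * x i                      ≈⟨ *-congʳ (*-congʳ (trans (-‿cong (sym ι-1)) (sym (ι-neg 1ℚ)))) ⟩
        ι (ℚ.- 1ℚ) * ι (1/fact i) * x i                  ≈⟨ *-congʳ (ι-* _ _) ⟨
        ι (ℚ.- 1ℚ ℚ.* 1/fact i) * x i                    ≡⟨ ≡.cong (λ t → ι t * x i) (neg (1/fact i)) ⟩
        ι (ℚ.- 1/fact i) * x i                           ∎
        where
        neg : ∀ p → ℚ.- 1ℚ ℚ.* p ≡ ℚ.- p
        neg p = ≡.trans (≡.sym (ℚ.neg-distribˡ-* 1ℚ p)) (≡.cong ℚ.-_ (ℚ.*-identityˡ p))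
        factorial : ∀ i → suc i Fractions.· (Fractions.1/suc i ℚ.* 1/fact i) ≡ 1/fact i
        factorial i = ≡.trans (Fractions.·-fromNat (suc i) _) (≡.trans (≡.sym (ℚ.*-assoc (fromNat (suc i)) _ _))
          (≡.trans (≡.cong (ℚ._* 1/fact i) (Fractions.fromNat-*-1/suc i)) (ℚ.*-identityˡ _)))

record RealEmbedding (A : ArchimedeanRing) (C : LimitRing) : Set₁ where
  private
    module A = ArchimedeanRing A
    module C = LimitRing C
  field
    κ       : A.Carrier → C.Carrier
    κ-cong  : ∀ {x y} → x A.≈ y → κ x C.≈ κ y
    κ-+     : ∀ x y → κ (x A.+ y) C.≈ κ x C.+ κ y
    κ-*     : ∀ x y → κ (x A.* y) C.≈ κ x C.* κ y
    κ-neg   : ∀ x → κ (A.- x) C.≈ C.- κ x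
    κ-ι     : ∀ p → κ (A.ι p) C.≈ C.ι p
    κ-limit : ∀ {s l} → Limits._⟶_ A s l → (λ n → κ (s n)) C.⟶ κ l

-- Assembly over abstract real and complex rings

module MainTheorem (A : ArchimedeanRing) (exp : ArchimedeanRing.Carrier A → ArchimedeanRing.Carrier A)
  (isExponential : ExponentialBound.IsExponential A exp) (C : LimitRing) (embedding : RealEmbedding A C) where
  open RealEmbedding embedding
  private
    module A = ArchimedeanRing A
    module LA = Limits A
    module GA = GammaLimits A exp isExponential
    module BA = BellFactor A.ℚ-algebra
    module SA = PowerSeries A.commutativeSemiring
    module DA = RawSemiringDefs (CommutativeSemiring.rawSemiring A.commutativeSemiring)
  open LimitRing C hiding (zero)
  open RawSemiringDefs (CommutativeSemiring.rawSemiring commutativeSemiring) using (product) renaming (_×_ to _·_; _^_ to _^_)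
  open Sums commutativeSemiring
  open PowerSeries commutativeSemiring
  open SeriesLimits C
  open Fractions using (fromNat)
  open SetoidReasoning setoid

  private
    κ-0 : κ A.0# ≈ 0#
    κ-0 = trans (κ-cong (A.sym A.ι-0)) (trans (κ-ι 0ℚ) ι-0)

    κ-1 : κ A.1# ≈ 1#
    κ-1 = trans (κ-cong (A.sym A.ι-1)) (trans (κ-ι 1ℚ) ι-1)

    κ-· : ∀ n x → κ (n DA.× x) ≈ n · κ x
    κ-· zero    x = κ-0
    κ-· (suc n) x = trans (κ-+ x _) (+-congˡ (κ-· n x))

    κ-⋆ : ∀ a b n → κ ((a SA.⋆ b) n) ≈ ((κ ∘ a) ⋆ (κ ∘ b)) n
    κ-⋆ a b zero    = κ-* _ _
    κ-⋆ a b (suc n) = trans (κ-+ _ _) (+-cong (κ-* _ _) (κ-⋆ (SA.tail a) b n))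

    κ-logDerivative : ∀ {β a} → SA.IsLogDerivative β a → IsLogDerivative (κ ∘ β) (κ ∘ a)
    κ-logDerivative {β} {a} h n = trans (sym (κ-· (suc n) (a (suc n)))) (trans (κ-cong (h n)) (κ-⋆ β a n))

  -- S m stands for the alternating sum of the B_{m,k}.
  bellFactor : (S : ℕ → A.Carrier) (χⱼ : Carrier) → ℕ → Carrier
  bellFactor S χⱼ zero      = 1#
  bellFactor S χⱼ m@(suc _) = χⱼ ^ m * κ (A.ι (1/fact m)) * κ (S m)

  -- S m / m! is the coefficient of tᵐ in exp(-Σ x_i tⁱ⁺¹/(i+1)!).
  IsBellSum : (x S : ℕ → A.Carrier) → Set
  IsBellSum x S = ∀ m → 1 ℕ.≤ m → A.ι (1/fact m) A.* S m A.≈ BA.coefficients x m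

  private
    bellFactor≈ : ∀ {x S} → IsBellSum x S → ∀ χⱼ m → χⱼ ^ m * κ (BA.coefficients x m) ≈ bellFactor S χⱼ m
    bellFactor≈ {x} bell χⱼ zero      = trans (*-identityˡ _) (trans (κ-cong (BA.coefficients-zero x)) κ-1)
    bellFactor≈ {x} {S} bell χⱼ m@(suc _) = begin
      χⱼ ^ m * κ (BA.coefficients x m)             ≈⟨ *-congˡ (κ-cong (bell m (ℕ.s≤s ℕ.z≤n))) ⟨
      χⱼ ^ m * κ (A.ι (1/fact m) A.* S m)          ≈⟨ *-congˡ (κ-* _ _) ⟩
      χⱼ ^ m * (κ (A.ι (1/fact m)) * κ (S m))      ≈⟨ *-assoc _ _ _ ⟨
      bellFactor S χⱼ m                            ∎

    logDerivative-bellFactor : ∀ {x S} → IsBellSum x S → ∀ χⱼ →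
      IsLogDerivative (λ k → χⱼ ^ suc k * (ι (ℚ.- 1/fact k) * κ (x k))) (bellFactor S χⱼ)
    logDerivative-bellFactor {x} bell χⱼ = logDerivative-cong
      (λ k → *-congˡ (trans (κ-* _ _) (*-congʳ (κ-ι _)))) (bellFactor≈ bell χⱼ)
      (logDerivative-scale χⱼ (κ-logDerivative (BA.logDerivative-coefficients x)))

  module _ (q′ : ℕ)
    (≈0-stable : ∀ {x} → ¬ ¬ x ≈ 0# → x ≈ 0#)
    (*-≈0 : ∀ {x y} → x * y ≈ 0# → ¬ y ≈ 0# → x ≈ 0#)
    (χ : ℤ → Carrier)
    (χ-* : ∀ a b → χ (a ℤ.* b) ≈ χ a * χ b)
    (χ-1 : χ (+ 1) ≈ 1#)
    (χ-periodic : ∀ a → χ (a ℤ.+ + suc q′) ≈ χ a)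
    (χ-vanish : ∀ a → gcd ℤ.∣ a ∣ (suc q′) ≢ 1 → χ a ≈ 0#)
    (nonprincipal : ¬ (∀ a → gcd ℤ.∣ a ∣ (suc q′) ≡ 1 → χ a ≈ 1#))
    (r-null : ∀ {y} → 0ℚ ℚ.< y → (λ m → ι (Reciprocals.r y m)) ⟶ 0#)
    (L : ℕ → A.Carrier) (exp-L : ∀ n → 1 ℕ.≤ n → exp (L n) A.≈ A.ι (fromNat n))
    (Γ : ℚ → A.Carrier) (G⟶Γ : ∀ {y} → Reciprocals.InUnit y → (λ n → GA.G L n y) LA.⟶ Γ y)
    (ψ : ℕ → ℚ → A.Carrier) (digamma : GA.Derivative Γ (λ y → ψ 0 y A.* Γ y))
    (polygamma : ∀ j → GA.Derivative (ψ j) (ψ (suc j)))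
    (x : ℕ⁺ → ℕ → A.Carrier) (ψ≈x : ∀ k j → ψ k (+ proj₁ j / suc q′) A.≈ x j k)
    (S : ℕ⁺ → ℕ → A.Carrier) (bell : ∀ j → IsBellSum (x j) (S j)) where

    private
      module CS = CharacterSeries C q′ (λ n → χ (+ n))

      inUnit : ∀ i → i ℕ.< q′ → Reciprocals.InUnit (+ suc i / suc q′)
      inUnit i i<q′ = CS.0<y i , ℚ.≰⇒> λ 1≤y → ℚ.<-irrefl ≡.refl (ℚ.<-≤-trans
        (fromNat-mono-< (ℕ.s≤s i<q′)) (ℚ.≤-trans (ℚ.≤-reflexive (≡.sym (ℚ.*-identityʳ (fromNat (suc q′)))))
          (ℚ.≤-trans (ℚ.*-monoˡ-≤-nonNeg (fromNat (suc q′)) {{ℚ.nonNegative (Fractions.0≤fromNat (suc q′))}} 1≤y)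
            (ℚ.≤-reflexive (Fractions.fromNat-*-/ (suc i) (suc q′))))))
        where
        fromNat-mono-< : ∀ {m n} → m ℕ.< n → fromNat m ℚ.< fromNat n
        fromNat-mono-< {m} m<n = ℚ.<-≤-trans
          (ℚ.<-respʳ-≡ (≡.sym (Fractions.fromNat-suc m)) (ℚ.<-respˡ-≡ (ℚ.+-identityˡ (fromNat m)) (ℚ.+-monoˡ-< (fromNat m) (ℚ.positive⁻¹ 1ℚ))))
          (Fractions.fromNat-mono m<n)

      κ-coefficient : ∀ k i → κ (A.ι (GammaCoefficients.coefficient k) A.* ψ k (+ suc i / suc q′))
        ≈ ι (GammaCoefficients.coefficient k) * κ (x (suc i , _) k)
      κ-coefficient k i = trans (κ-* _ _) (*-cong (κ-ι _) (κ-cong (ψ≈x k (suc i , _))))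

    private
      bellFactors : ℕ⁺ → ℕ → Carrier
      bellFactors j = bellFactor (S j) (χ (+ proj₁ j))

      ∏-cong : ∀ {f g : ℕ⁺ → Carrier} → (∀ k → f k ≈ g k) → ∀ ks → ∏ ks f ≈ ∏ ks g
      ∏-cong f≈g []       = refl
      ∏-cong f≈g (k ∷ ks) = *-cong (f≈g k) (∏-cong f≈g ks)

      product-cong : ∀ {m} {f g : Fin m → Carrier} → (∀ i → f i ≈ g i) → product f ≈ product g
      product-cong {zero}  f≈g = refl
      product-cong {suc m} f≈g = *-cong (f≈g Fin.zero) (product-cong (f≈g ∘ Fin.suc))

    limit : ∀ (f : ℕ⁺ → Carrier) (F : ℕ⁺ → ℕ → Carrier) →
      (∀ k → f k ≈ χ (+ proj₁ k) * ι ((+ 1 / proj₁ k) {{proj₂ k}})) →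
      (∀ j m → F j m ≈ bellFactor (S j) (χ (+ proj₁ j)) m) →
      ∀ n (π : List ℕ⁺ → Carrier) (τ : Vector ℕ (length (Φ (suc q′))) → Carrier) →
      (∀ ks → π ks ≈ ∏ ks f) → (∀ k → τ k ≈ product (λ j → F (lookup (Φ (suc q′)) j) (k j))) →
      (λ N → ∑ (choose n (interval N)) π) ⟶
      ι ((+ 1 / (suc q′ ℕ.^ n)) {{ℕ.m^n≢0 (suc q′) n}}) * ∑ (familiesWithSum (length (Φ (suc q′))) n) τ
    limit f F f≈ F≈ n π τ π≈ τ≈ = lim-cong
      (λ N → ∑-cong (choose n (interval N)) λ ks → trans (∏-cong (λ k → sym (f≈ k)) ks) (sym (π≈ ks)))
      (*-cong (trans (ι-^ _ n) (reflexive (≡.cong ι (power n))))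
        (∑-cong (familiesWithSum (length (Φ (suc q′))) n) λ k →
          trans (product-cong λ j → sym (F≈ (lookup (Φ (suc q′)) j) (k j))) (sym (τ≈ k))))
      (CS.elementary-limit
        (λ n → χ-periodic (+ n)) (λ n → χ-vanish (+ n))
        (NonprincipalSum.χ-q≈0 commutativeRing q′ ≈0-stable *-≈0 χ χ-* χ-1 χ-periodic χ-vanish nonprincipal)
        (NonprincipalSum.χ-sum≈0 commutativeRing q′ ≈0-stable *-≈0 χ χ-* χ-1 χ-periodic χ-vanish nonprincipal)
        r-null (λ n → κ (L n)) (λ k j → κ (x j k))
        (λ i i<q′ → lim-cong
          (λ n → trans (κ-+ _ _) (+-cong (κ-ι _) (κ-neg _)))
          (κ-coefficient 0 i)
          (κ-limit (GA.harmonicSum-limit L exp-L Γ G⟶Γ ψ digamma polygamma (inUnit i i<q′))))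
        (λ k i i<q′ → lim-cong
          (λ n → κ-ι _)
          (κ-coefficient (suc k) i)
          (κ-limit (GA.powerSum-limit L exp-L Γ G⟶Γ ψ digamma polygamma k (inUnit i i<q′))))
        bellFactors
        (λ j → refl)
        (λ j → logDerivative-bellFactor (bell j) (χ (+ proj₁ j)))
        n)
      where
      power : ∀ n → (+ 1 / suc q′) Fractions.^ n ≡ (+ 1 / (suc q′ ℕ.^ n)) {{ℕ.m^n≢0 (suc q′) n}}
      power zero    = ≡.refl
      power (suc n) = Fractions.*-cancelˡ (fromNat (suc q′ ℕ.^ suc n))
        (ℚ.positive⁻¹ _ {{ℚ.normalize-pos (suc q′ ℕ.^ suc n) 1 {{_}} {{ℕ.m^n≢0 (suc q′) (suc n)}}}})
        (≡.trans (≡.cong₂ ℚ._*_ (Fractions.fromNat-* (suc q′) (suc q′ ℕ.^ n)) (≡.cong ((+ 1 / suc q′) ℚ.*_) (power n)))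
          (≡.trans (ℚS.solve 4 (λ a b c e → a ℚS.:* b ℚS.:* (c ℚS.:* e) ℚS.:= (a ℚS.:* c) ℚS.:* (b ℚS.:* e)) ≡.refl (fromNat (suc q′)) (fromNat (suc q′ ℕ.^ n)) (+ 1 / suc q′) ((+ 1 / (suc q′ ℕ.^ n)) {{ℕ.m^n≢0 (suc q′) n}}))
            (≡.trans (≡.cong₂ ℚ._*_ (Fractions.fromNat-*-/ 1 (suc q′)) (Fractions.fromNat-*-/ 1 (suc q′ ℕ.^ n) {{ℕ.m^n≢0 (suc q′) n}}))
              (≡.sym (Fractions.fromNat-*-/ 1 (suc q′ ℕ.^ suc n) {{ℕ.m^n≢0 (suc q′) (suc n)}})))))
        where module ℚS = +-*-Solver

-- The alternating Bell sums over ℝ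

module BellBridge where
  private
    module BA = BellFactor RealRing.ℚ-algebra
    module ΣR = Sums (CommutativeRing.commutativeSemiring RealRing.commutativeRing)
    module DR = RawSemiringDefs (CommutativeSemiring.rawSemiring (CommutativeRing.commutativeSemiring RealRing.commutativeRing))

  seq-∑ : ∀ {A : Set} m (xs : List A) (f g : A → ℝ) → (∀ x → seq (f x) m ≡ seq (g x) m) →
    seq (ΣR.∑ xs f) m ≡ seq (Opsʳ.∑ xs g) m
  seq-∑ m []       f g eq = ≡.refl
  seq-∑ m (x ∷ xs) f g eq = ≡.cong₂ ℚ._+_ (eq x) (seq-∑ m xs f g eq)

  seq-product : ∀ {k} m (f g : Vector ℝ k) → (∀ i → seq (f i) m ≡ seq (g i) m) →
    seq (DR.product f) m ≡ seq (Opsʳ.product g) m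
  seq-product {zero}  m f g eq = ≡.refl
  seq-product {suc k} m f g eq = ≡.cong₂ ℚ._*_ (eq Fin.zero) (seq-product m (f ∘ Fin.suc) (g ∘ Fin.suc) (eq ∘ Fin.suc))

  seq-^ : ∀ m x y k → seq x m ≡ seq y m → seq (x DR.^ k) m ≡ seq (y Opsʳ.^ k) m
  seq-^ m x y zero    eq = ≡.refl
  seq-^ m x y (suc k) eq = ≡.cong₂ ℚ._*_ eq (seq-^ m x y k eq)

  seq-bell : ∀ n k x m → seq (BA.bell n k x) m ≡ seq (Bell n k x) m
  seq-bell n k x m = seq-∑ m (bellExponents n k) (BA.bellTerm n k x)
    (λ j → fromℕ (n !)
      *ʳ Opsʳ.product (λ i → fromℚ (1/fact (j i)))
      *ʳ Opsʳ.product (λ i → (x i *ʳ fromℚ (1/fact (suc (toℕ i)))) Opsʳ.^ j i))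
    λ j → ≡.cong₂ ℚ._*_
      (≡.cong (seq (fromℕ (n !)) m ℚ.*_) (seq-product m (BA.bellReciprocal j) (λ i → fromℚ (1/fact (j i))) (λ i → ≡.refl)))
      (seq-product m (BA.bellPower x j) (λ i → (x i *ʳ fromℚ (1/fact (suc (toℕ i)))) Opsʳ.^ j i)
        (λ i → seq-^ m (BA.bellBase x i) (x i *ʳ fromℚ (1/fact (suc (toℕ i)))) (j i) ≡.refl))

  seq-alternating : ∀ (x : ℕ → ℝ) n (k : ℕ⁺) m →
    seq ((-ʳ 1ʳ) Opsʳ.^ (proj₁ k) *ʳ Bell n (proj₁ k) (λ i → x (toℕ i))) m ≡ seq (BA.alternatingTerm x n k) m
  seq-alternating x n (k , _) m = ≡.sym
    (≡.cong₂ ℚ._*_ (seq-^ m BA.-1# (-ʳ 1ʳ) k ≡.refl) (seq-bell n k (λ i → x (toℕ i)) m))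

  bellSumʳ : (ℕ → ℝ) → ℕ → ℝ
  bellSumʳ x n = Opsʳ.∑ (interval n) λ (k , _) → (-ʳ 1ʳ) Opsʳ.^ k *ʳ Bell n k (λ i → x (toℕ i))

  bellSumʳ-coefficients : ∀ (x : ℕ → ℝ) n → 1 ℕ.≤ n → fromℚ (1/fact n) *ʳ bellSumʳ x n ≈ʳ BA.coefficients x n
  bellSumʳ-coefficients x n 1≤n = BA.coefficients-bell x n
    (λ (k , _) → (-ʳ 1ʳ) Opsʳ.^ k *ʳ Bell n k (λ i → x (toℕ i))) 1≤n
    λ k → RealRing.pointwise {(-ʳ 1ʳ) Opsʳ.^ (proj₁ k) *ʳ Bell n (proj₁ k) (λ i → x (toℕ i))} {BA.alternatingTerm x n k} (seq-alternating x n k)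

-- Γ and its companions at rational points

module RealFunctions where
  open Fractions using (fromNat)

  positive-fromℚ : ∀ {y} → 0ℚ ℚ.< y → Positive (fromℚ y)
  positive-fromℚ {y} 0<y = y , 0<y , 0 , λ _ _ → ℚ.≤-refl

  -- Positivity of a rational number is decidable, so a function on (0,∞) becomes a total function
  -- on ℚ; the value 0 elsewhere is a placeholder.
  onℚ : Fun⁺ → ℚ → ℝ
  onℚ f y = extend (0ℚ ℚ.<? y)
    where
    extend : Dec (0ℚ ℚ.< y) → ℝ
    extend (yes 0<y) = f (fromℚ y) (positive-fromℚ 0<y)
    extend (no  _)   = 0ʳ

  onℚ-positive : ∀ f {y} (0<y : 0ℚ ℚ.< y) → onℚ f y ≡ f (fromℚ y) (positive-fromℚ 0<y)
  onℚ-positive f {y} 0<y with 0ℚ ℚ.<? y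
  -- A function in `Fun⁺` might depend on the proof of positivity; for rationals there is at most
  -- one proof of 0 < y.
  ... | yes 0<y′ = ≡.cong (λ p → f (fromℚ y) (positive-fromℚ p)) (ℚ.<-irrelevant 0<y′ 0<y)
  ... | no  ≮    = contradiction 0<y ≮

  isExponential : ExponentialBound.IsExponential RealRing.archimedeanRing RealExponential.expʳ
  isExponential = ExponentialBound.isExponential RealRing.archimedeanRing RealExponential.expʳ
    (λ {x} {y} → RealExponential.expʳ-cong {x} {y}) RealExponential.expʳ-+ RealExponential.1+x≤expʳ

  private
    module G = GammaLimits RealRing.archimedeanRing RealExponential.expʳ isExponential

  hasDerivative⇒derivative : ∀ {f f′} {F F′ : ℚ → ℝ} →
    (∀ {y} (0<y : 0ℚ ℚ.< y) → F y ≡ f (fromℚ y) (positive-fromℚ 0<y)) →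
    (∀ {y} (0<y : 0ℚ ℚ.< y) → F′ y ≡ f′ (fromℚ y) (positive-fromℚ 0<y)) →
    HasDerivative f f′ → G.Derivative F F′
  hasDerivative⇒derivative {f} {f′} {F} {F′} F≡ F′≡ der {y} (0<y , _) ε 0<ε =
    let δ , 0<δ , hδ = der (fromℚ y) (positive-fromℚ 0<y) ε 0<ε
    in δ , 0<δ , λ h (0<y+h , _) h≤δ → transfer h (F≡ 0<y+h) (F≡ 0<y) (F′≡ 0<y)
      (hδ (fromℚ (y ℚ.+ h)) (positive-fromℚ 0<y+h) λ η 0<η → 0 , λ _ _ → ℚ.≤-trans
        (ℚ.≤-reflexive (≡.cong ℚ.∣_∣ (displacement h))) (ℚ-Order.≤-by (δ ℚ.+ η ℚ.- ℚ.∣ h ∣)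
          (ℚ-Order.0≤- (ℚ.≤-trans h≤δ (ℚ-Order.≤-by η (ℚ.<⇒≤ 0<η) ≡.refl)))
          (ℚS.solve 2 (λ a b → a ℚS.:= b ℚS.:+ (a ℚS.:- b)) ≡.refl (δ ℚ.+ η) ℚ.∣ h ∣)))
    where
    module ℚS = +-*-Solver
    displacement : ∀ h → (y ℚ.+ h) ℚ.- y ≡ h
    displacement h = ℚS.solve 2 (λ y h → (y ℚS.:+ h) ℚS.:- y ℚS.:= h) ≡.refl y h
    transfer : ∀ h {a b c : ℝ} → F (y ℚ.+ h) ≡ a → F y ≡ b → F′ y ≡ c →
      ∣ a -ʳ b -ʳ c *ʳ (fromℚ (y ℚ.+ h) -ʳ fromℚ y) ∣ʳ ≤ʳ fromℚ ε *ʳ ∣ fromℚ (y ℚ.+ h) -ʳ fromℚ y ∣ʳ →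
      ∣ F (y ℚ.+ h) -ʳ F y -ʳ F′ y *ʳ fromℚ h ∣ʳ ≤ʳ fromℚ ε *ʳ fromℚ ℚ.∣ h ∣
    transfer h ≡.refl ≡.refl ≡.refl le η 0<η = eventually-map
      (λ n → ≡.subst (λ k → ℚ.∣ seq (F (y ℚ.+ h)) n ℚ.- seq (F y) n ℚ.- seq (F′ y) n ℚ.* k ∣ ℚ.≤ ε ℚ.* ℚ.∣ k ∣ ℚ.+ η) (displacement h))
      (le η 0<η)

  open RealExponential using (expʳ; expʳ-cong; isExp⇒≈)

  private
    exp-log : ∀ n x y (p : IsPower n x y) → expʳ (proj₁ p) ≈ʳ fromℕ n
    exp-log n x y (l , isExp , _) = RealRing.≈-sym {fromℕ n} {expʳ l} (isExp⇒≈ {l} {fromℕ n} isExp)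

    power≈exp : ∀ n x y (p : IsPower n x y) → y ≈ʳ expʳ (x *ʳ proj₁ p)
    power≈exp n x y (l , _ , isExp) = isExp⇒≈ {x *ʳ l} {y} isExp

    log-unique : ∀ n a b → expʳ a ≈ʳ fromℕ n → expʳ b ≈ʳ fromℕ n → a ≈ʳ b
    log-unique n a b ea eb = G.exp-injective {a} {b}
      (RealRing.≈-trans {expʳ a} {fromℕ n} {expʳ b} ea (RealRing.≈-sym {expʳ b} {fromℕ n} eb))

    -- Every instance of `IsPower` brings its own logarithm of n. By injectivity of exp they agree,
    -- so one sequence of logarithms serves all arguments x.
    power≈ : ∀ n x y (p : IsPower n x y) l → expʳ l ≈ʳ fromℕ n → y ≈ʳ expʳ (x *ʳ l)
    power≈ n x y p l el = RealRing.≈-trans {y} {expʳ (x *ʳ proj₁ p)} {expʳ (x *ʳ l)} (power≈exp n x y p)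
      (expʳ-cong {x *ʳ proj₁ p} {x *ʳ l}
        (RealRing.*-cong {x} {x} {proj₁ p} {l} (RealRing.pointwise {x} {x} λ _ → ≡.refl) (log-unique n (proj₁ p) l (exp-log n x y p) el)))

  module _ {Γ : Fun⁺} (isGamma : IsGamma Γ) where

    private
      1>0 : Positive 1ʳ
      1>0 = positive-fromℚ (ℚ.positive⁻¹ 1ℚ)

      power : ∀ x (x>0 : Positive x) → ℕ → ℝ
      power x x>0 = proj₁ (isGamma x x>0)

      isPower : ∀ x x>0 n → 1 ℕ.≤ n → IsPower n x (power x x>0 n)
      isPower x x>0 = proj₁ (proj₂ (isGamma x x>0))

    -- log n, extracted from the power n¹ in Euler's limit for Γ(1); the value at 0 is a
    -- placeholder.
    L : ℕ → ℝ
    L zero    = 0ʳ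
    L (suc n) = proj₁ (isPower 1ʳ 1>0 (suc n) (ℕ.s≤s ℕ.z≤n))

    exp-L : ∀ n → 1 ℕ.≤ n → expʳ (L n) ≈ʳ fromℕ n
    exp-L (suc n) _ = exp-log (suc n) 1ʳ (power 1ʳ 1>0 (suc n)) (isPower 1ʳ 1>0 (suc n) (ℕ.s≤s ℕ.z≤n))

    private
      reciprocals : ∀ {z} → 0ℚ ℚ.< z → ℕ → ℝ
      reciprocals {z} 0<z i = recip (fromℚ z +ʳ fromℕ i) (shift-positive (fromℚ z) (positive-fromℚ 0<z) i)

      seq-∏ : ∀ (f : ℕ → ℝ) (g : ℕ → ℚ) m → (∀ i → seq (f i) m ≡ g i) → ∀ is →
        seq (Opsʳ.∏ is f) m ≡ List.foldr (λ i s → g i ℚ.* s) 1ℚ is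
      seq-∏ f g m eq []       = ≡.refl
      seq-∏ f g m eq (i ∷ is) = ≡.cong₂ ℚ._*_ (eq i) (seq-∏ f g m eq is)

      gammaSequence : ∀ {z} → 0ℚ ℚ.< z → ℕ → ℝ
      gammaSequence {z} 0<z n = fromℕ (n !) *ʳ power (fromℚ z) (positive-fromℚ 0<z) n *ʳ Opsʳ.∏ (upTo (suc n)) (reciprocals 0<z)

      gammaSequence≈ : ∀ {z} (0<z : 0ℚ ℚ.< z) n → 1 ℕ.≤ n → gammaSequence 0<z n ≈ʳ G.G L n z
      gammaSequence≈ {z} 0<z n 1≤n = RealRing.*-cong
        {fromℕ (n !) *ʳ power (fromℚ z) (positive-fromℚ 0<z) n} {fromℕ (n !) *ʳ expʳ (fromℚ z *ʳ L n)}
        {Opsʳ.∏ (upTo (suc n)) (reciprocals 0<z)} {fromℚ (Reciprocals.P n z)}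
        (RealRing.*-cong {fromℕ (n !)} {fromℕ (n !)} {power (fromℚ z) (positive-fromℚ 0<z) n} {expʳ (fromℚ z *ʳ L n)}
          (RealRing.pointwise {fromℕ (n !)} {fromℕ (n !)} λ _ → ≡.refl)
            (power≈ n (fromℚ z) (power (fromℚ z) (positive-fromℚ 0<z) n) (isPower (fromℚ z) (positive-fromℚ 0<z) n 1≤n) (L n) (exp-L n 1≤n)))
        (RealRing.pointwise {Opsʳ.∏ (upTo (suc n)) (reciprocals 0<z)} {fromℚ (Reciprocals.P n z)} λ m → seq-∏ (reciprocals 0<z) (Reciprocals.r z) m (λ i → ≡.refl) (upTo (suc n)))

    G⟶Γ : ∀ {z} → Reciprocals.InUnit z → (λ n → G.G L n z) ⟶ʳ onℚ Γ z
    G⟶Γ {z} (0<z , _) = Limits.lim-eventually RealRing.archimedeanRing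
      {gammaSequence 0<z} {λ n → G.G L n z} {Γ (fromℚ z) (positive-fromℚ 0<z)} {onℚ Γ z}
      -- Powers nˣ are specified for n ≥ 1 only, so the two sequences are compared from 1 on.
      (1 , gammaSequence≈ 0<z)
      (≡.subst (λ y → Γ (fromℚ z) (positive-fromℚ 0<z) ≈ʳ y) (≡.sym (onℚ-positive Γ 0<z))
        (RealRing.pointwise {Γ (fromℚ z) (positive-fromℚ 0<z)} {Γ (fromℚ z) (positive-fromℚ 0<z)} λ _ → ≡.refl))
      (proj₂ (proj₂ (isGamma (fromℚ z) (positive-fromℚ 0<z))))

realEmbedding : RealEmbedding RealRing.archimedeanRing ComplexNumbers.limitRing
realEmbedding = record
  { κ = fromℝ
  ; κ-cong = λ p → p , pointwise {0ʳ} {0ʳ} λ _ → ≡.refl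
  ; κ-+ = λ x y → (pointwise {x +ʳ y} {x +ʳ y} λ _ → ≡.refl) , (pointwise {0ʳ} {0ʳ +ʳ 0ʳ} λ _ → ≡.refl)
  ; κ-* = λ x y →
      (pointwise {x *ʳ y} {x *ʳ y -ʳ 0ʳ *ʳ 0ʳ} λ n → ℚS.solve 2 (λ x y → x ℚS.:* y ℚS.:= x ℚS.:* y ℚS.:- ℚS.con 0ℚ ℚS.:* ℚS.con 0ℚ) ≡.refl (seq x n) (seq y n))
    , (pointwise {0ʳ} {x *ʳ 0ʳ +ʳ 0ʳ *ʳ y} λ n → ℚS.solve 2 (λ x y → ℚS.con 0ℚ ℚS.:= x ℚS.:* ℚS.con 0ℚ ℚS.:+ ℚS.con 0ℚ ℚS.:* y) ≡.refl (seq x n) (seq y n))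
  ; κ-neg = λ x → (pointwise { -ʳ x} { -ʳ x} λ _ → ≡.refl) , (pointwise {0ʳ} { -ʳ 0ʳ} λ _ → ≡.refl)
  ; κ-ι = λ p → (pointwise {fromℚ p} {fromℚ p} λ _ → ≡.refl) , (pointwise {0ʳ} {0ʳ} λ _ → ≡.refl)
  ; κ-limit = λ {s} {l} → ReciprocalLimits.fromℝ-limit {s} {l}
  }
  where
  open RealRing using (pointwise)
  module ℚS = +-*-Solver

module SumsOfProducts where
  -- Equality of all rational approximations, which is finer than `_≈ᶜ_` and compares different
  -- spellings of one expression.
  _≐_ : ℂ → ℂ → Set
  z ≐ w = ∀ m → (seq (re z) m ≡ seq (re w) m) × (seq (im z) m ≡ seq (im w) m)

  ∑-≐ : ∀ (js : List ℕ⁺) (F : ℕ⁺ → ℕ → ℂ) (ks : List (Vector ℕ (length js))) (τ : Vector ℕ (length js) → ℂ) →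
    (∀ k → τ k ≐ Opsᶜ.product (λ j → F (lookup js j) (k j))) →
    Opsᶜ.∑ ks τ ≐ Opsᶜ.∑ ks (λ k → Opsᶜ.product (λ j → F (lookup js j) (k j)))
  ∑-≐ js F []       τ eq m = ≡.refl , ≡.refl
  ∑-≐ js F (k ∷ ks) τ eq m =
      ≡.cong₂ ℚ._+_ (proj₁ (eq k m)) (proj₁ (∑-≐ js F ks τ eq m))
    , ≡.cong₂ ℚ._+_ (proj₂ (eq k m)) (proj₂ (∑-≐ js F ks τ eq m))

  -- s ⟶ʳ l unfolds to Tends s (seq l).
  Tends : (ℕ → ℝ) → (ℕ → ℚ) → Set
  Tends s a = ∀ ε → 0ℚ ℚ.< ε → Eventually λ n → ∀ η → 0ℚ ℚ.< η → Eventually λ m →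
    ℚ.∣ seq (s n) m ℚ.+ ℚ.- a m ∣ ℚ.≤ ε ℚ.+ η

  tends : ∀ {s : ℕ → ℝ} {a b : ℕ → ℚ} → (∀ m → a m ≡ b m) → Tends s a → Tends s b
  tends {s} eq lim ε 0<ε with N , hN ← lim ε 0<ε =
    N , λ n N≤n η 0<η → proj₁ (hN n N≤n η 0<η) , λ m M≤m →
      ≡.subst (λ a → ℚ.∣ seq (s n) m ℚ.+ ℚ.- a ∣ ℚ.≤ ε ℚ.+ η) (eq m) (proj₂ (hN n N≤n η 0<η) m M≤m)

  limit-∑ : ∀ (P : ℕ → ℂ) (c : ℂ) (js : List ℕ⁺) (F : ℕ⁺ → ℕ → ℂ) (ks : List (Vector ℕ (length js)))
    (τ : Vector ℕ (length js) → ℂ) →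
    (∀ k → τ k ≐ Opsᶜ.product (λ j → F (lookup js j) (k j))) →
    P ⟶ᶜ c *ᶜ Opsᶜ.∑ ks τ →
    P ⟶ᶜ c *ᶜ Opsᶜ.∑ ks (λ k → Opsᶜ.product (λ j → F (lookup js j) (k j)))
  limit-∑ P c js F ks τ eq (lim-re , lim-im) =
      tends {λ n → re (P n)} (λ m → ≡.cong₂ (λ x y → seq (re c) m ℚ.* x ℚ.+ ℚ.- (seq (im c) m ℚ.* y))
        (proj₁ (∑-≐ js F ks τ eq m)) (proj₂ (∑-≐ js F ks τ eq m))) lim-re
    , tends {λ n → im (P n)} (λ m → ≡.cong₂ (λ x y → seq (re c) m ℚ.* y ℚ.+ seq (im c) m ℚ.* x)
        (proj₁ (∑-≐ js F ks τ eq m)) (proj₂ (∑-≐ js F ks τ eq m))) lim-im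

-- Specialisation to ℝ and ℂ

module DirichletSeries (Γ : Fun⁺) (isGamma : IsGamma Γ) (ψ : ℕ → Fun⁺) (isPolygamma : IsPolygamma Γ ψ)
  (q′ : ℕ) .{{q≢0 : NonZero (suc q′)}} (χ : ℤ → ℂ) (isCharacter : IsDirichletCharacter (suc q′) χ) (nonprincipal : ¬ Principal (suc q′) χ) where
  open RealFunctions
  open BellBridge
  open SumsOfProducts using (_≐_)
  open IsPolygamma isPolygamma
  open IsDirichletCharacter isCharacter
  private
    module MT = MainTheorem RealRing.archimedeanRing RealExponential.expʳ isExponential ComplexNumbers.limitRing realEmbedding
    module C = CommutativeRing ComplexNumbers.commutativeRing
    module G = GammaLimits RealRing.archimedeanRing RealExponential.expʳ isExponential

    onℚ≈ : ∀ k j → onℚ (ψ k) (+ proj₁ j / suc q′) ≈ʳ ψ k (point (suc q′) {{q≢0}} j) (point-positive (suc q′) {{q≢0}} j)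
    onℚ≈ k (j , j≢0) = ≡.subst (λ y → onℚ (ψ k) (+ j / suc q′) ≈ʳ y)
      (onℚ-positive (ψ k) (ℚ.positive⁻¹ _ {{ℚ.normalize-pos j (suc q′) {{_}} {{j≢0}}}}))
      (RealRing.pointwise {onℚ (ψ k) (+ j / suc q′)} {onℚ (ψ k) (+ j / suc q′)} λ _ → ≡.refl)

  onℚ-* : ∀ (f g : Fun⁺) {y} (0<y : 0ℚ ℚ.< y) →
    onℚ f y *ʳ onℚ g y ≡ f (fromℚ y) (positive-fromℚ 0<y) *ʳ g (fromℚ y) (positive-fromℚ 0<y)
  onℚ-* f g {y} 0<y = multiply (onℚ f y) (onℚ g y) (f (fromℚ y) (positive-fromℚ 0<y)) (g (fromℚ y) (positive-fromℚ 0<y))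
    (onℚ-positive f 0<y) (onℚ-positive g 0<y)
    where
    multiply : ∀ a b a′ b′ → a ≡ a′ → b ≡ b′ → a *ʳ b ≡ a′ *ʳ b′
    multiply a b a′ b′ ≡.refl ≡.refl = ≡.refl

  digamma-derivative : G.Derivative (onℚ Γ) (λ y → onℚ (ψ 0) y *ʳ onℚ Γ y)
  digamma-derivative = hasDerivative⇒derivative {Γ} {λ y y>0 → ψ 0 y y>0 *ʳ Γ y y>0} {onℚ Γ} {λ y → onℚ (ψ 0) y *ʳ onℚ Γ y}
    (onℚ-positive Γ) (onℚ-* (ψ 0) Γ) digamma

  bellFactor≈ : ∀ (S : ℕ → ℝ) z m → z Opsᶜ.^ suc m *ᶜ fromℝ (fromℚ (1/fact (suc m))) *ᶜ fromℝ (S (suc m)) ≈ᶜ MT.bellFactor S z (suc m)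
  bellFactor≈ S z m = C.refl {MT.bellFactor S z (suc m)}

  factor≈ : ∀ j m → factor (suc q′) {{q≢0}} ψ χ j m ≈ᶜ MT.bellFactor (bellSumʳ (λ k → ψ k (point (suc q′) {{q≢0}} j) (point-positive (suc q′) {{q≢0}} j))) (χ (+ proj₁ j)) m
  factor≈ j zero    = C.refl {1ᶜ}
  factor≈ j (suc m) = bellFactor≈ (bellSumʳ (λ k → ψ k (point (suc q′) {{q≢0}} j) (point-positive (suc q′) {{q≢0}} j))) (χ (+ proj₁ j)) m

  private
    module PC = PowerSeries C.commutativeSemiring
    module DC = RawSemiringDefs (CommutativeSemiring.rawSemiring C.commutativeSemiring)

    ≐⇒≈ : ∀ z w → z ≐ w → z ≈ᶜ w
    ≐⇒≈ z w eq = RealRing.pointwise {re z} {re w} (proj₁ ∘ eq) , RealRing.pointwise {im z} {im w} (proj₂ ∘ eq)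

    multiplyˡ : ∀ a b {c c′ d d′ : ℚ} → c ≡ c′ → d ≡ d′ →
      (a ℚ.* c ℚ.- b ℚ.* d ≡ a ℚ.* c′ ℚ.- b ℚ.* d′) × (a ℚ.* d ℚ.+ b ℚ.* c ≡ a ℚ.* d′ ℚ.+ b ℚ.* c′)
    multiplyˡ a b ≡.refl ≡.refl = ≡.refl , ≡.refl

    ∏-≐ : ∀ (f : ℕ⁺ → ℂ) ks → PC.∏ ks f ≐ Opsᶜ.∏ ks f
    ∏-≐ f []       m = ≡.refl , ≡.refl
    ∏-≐ f (k ∷ ks) m = multiplyˡ (seq (re (f k)) m) (seq (im (f k)) m) (proj₁ (∏-≐ f ks m)) (proj₂ (∏-≐ f ks m))

    product-≐ : ∀ {m} (f : Vector ℂ m) → DC.product f ≐ Opsᶜ.product f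
    product-≐ {zero}  f m = ≡.refl , ≡.refl
    product-≐ {suc k} f m = multiplyˡ (seq (re (f Fin.zero)) m) (seq (im (f Fin.zero)) m)
      (proj₁ (product-≐ (f ∘ Fin.suc) m)) (proj₂ (product-≐ (f ∘ Fin.suc) m))

  limit : ∀ (f : ℕ⁺ → ℂ) (F : ℕ⁺ → ℕ → ℂ) →
    (∀ k → f k ≈ᶜ χ (+ proj₁ k) *ᶜ fromℝ (fromℚ ((+ 1 / proj₁ k) {{proj₂ k}}))) →
    (∀ j m → F j m ≈ᶜ factor (suc q′) {{q≢0}} ψ χ j m) →
    ∀ n (P : ℕ → ℂ) (π : List ℕ⁺ → ℂ) (τ : Vector ℕ (length (Φ (suc q′))) → ℂ) →
    (∀ N → Opsᶜ.∑ (choose n (interval N)) π ≈ᶜ P N) → (∀ ks → π ks ≈ᶜ Opsᶜ.∏ ks f) → (∀ k → τ k ≈ᶜ Opsᶜ.product (λ j → F (lookup (Φ (suc q′)) j) (k j))) →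
    P ⟶ᶜ
      fromℝ (fromℚ ((+ 1 / (suc q′ ℕ.^ n)) {{ℕ.m^n≢0 (suc q′) n {{q≢0}}}})) *ᶜ Opsᶜ.∑ (familiesWithSum (length (Φ (suc q′))) n) τ
  limit f F f≈ F≈ n P π τ P≈ π≈ τ≈ = LimitRing.lim-cong ComplexNumbers.limitRing {λ N → Opsᶜ.∑ (choose n (interval N)) π} {P} {l} {l} P≈ (C.refl {l}) (MT.limit q′
    (λ {z} → Stability.≈0-stable {z}) (λ {z} {w} → Stability.*-≈0 {z} {w})
    χ χ-* χ-1 χ-periodic χ-vanish nonprincipal
    ReciprocalLimits.r-null
    (L {Γ} isGamma) (exp-L {Γ} isGamma) (onℚ Γ) (λ {z} → G⟶Γ {Γ} isGamma {z}) (λ k → onℚ (ψ k))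
    digamma-derivative
    (λ k → hasDerivative⇒derivative {ψ k} {ψ (suc k)} {onℚ (ψ k)} {onℚ (ψ (suc k))}
      (onℚ-positive (ψ k)) (onℚ-positive (ψ (suc k))) (derivative k))
    (λ j k → ψ k (point (suc q′) {{q≢0}} j) (point-positive (suc q′) {{q≢0}} j)) onℚ≈
    (λ j → bellSumʳ (λ k → ψ k (point (suc q′) {{q≢0}} j) (point-positive (suc q′) {{q≢0}} j)))
    (λ j → bellSumʳ-coefficients (λ k → ψ k (point (suc q′) {{q≢0}} j) (point-positive (suc q′) {{q≢0}} j)))
    f F f≈
    (λ j m → C.trans {F j m} {factor (suc q′) {{q≢0}} ψ χ j m}
      {MT.bellFactor (bellSumʳ (λ k → ψ k (point (suc q′) {{q≢0}} j) (point-positive (suc q′) {{q≢0}} j))) (χ (+ proj₁ j)) m}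
      (F≈ j m) (factor≈ j m))
    n π τ
    (λ ks → C.trans {π ks} {Opsᶜ.∏ ks f} {PC.∏ ks f} (π≈ ks)
      (C.sym {PC.∏ ks f} {Opsᶜ.∏ ks f} (≐⇒≈ (PC.∏ ks f) (Opsᶜ.∏ ks f) (∏-≐ f ks))))
    (λ k → C.trans {τ k} {Opsᶜ.product (λ j → F (lookup (Φ (suc q′)) j) (k j))} {DC.product (λ j → F (lookup (Φ (suc q′)) j) (k j))} (τ≈ k)
      (C.sym {DC.product (λ j → F (lookup (Φ (suc q′)) j) (k j))} {Opsᶜ.product (λ j → F (lookup (Φ (suc q′)) j) (k j))}
        (≐⇒≈ (DC.product (λ j → F (lookup (Φ (suc q′)) j) (k j))) (Opsᶜ.product (λ j → F (lookup (Φ (suc q′)) j) (k j)))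
          (product-≐ (λ j → F (lookup (Φ (suc q′)) j) (k j)))))))
    where
    l : ℂ
    l = fromℝ (fromℚ ((+ 1 / (suc q′ ℕ.^ n)) {{ℕ.m^n≢0 (suc q′) n {{q≢0}}}})) *ᶜ Opsᶜ.∑ (familiesWithSum (length (Φ (suc q′))) n) τ

dirichletLimit : (Γ : Fun⁺) → IsGamma Γ →
    (ψ : ℕ → Fun⁺) → IsPolygamma Γ ψ →
    (q : ℕ) .{{q≢0 : NonZero q}} (χ : ℤ → ℂ) →
    IsDirichletCharacter q χ → ¬ Principal q χ →
    (f : ℕ⁺ → ℂ) (F : ℕ⁺ → ℕ → ℂ) →
    (∀ k → f k ≈ᶜ χ (+ proj₁ k) *ᶜ fromℝ (fromℚ ((+ 1 / proj₁ k) {{proj₂ k}}))) →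
    (∀ j m → F j m ≈ᶜ factor q ψ χ j m) →
    ∀ n (P : ℕ → ℂ) (π : List ℕ⁺ → ℂ) (c : ℂ) →
    (∀ N → Opsᶜ.∑ (choose n (interval N)) π ≈ᶜ P N) →
    (∀ ks → π ks ≈ᶜ Opsᶜ.∏ ks f) →
    fromℝ (fromℚ ((+ 1 / (q ℕ.^ n)) {{ℕ.m^n≢0 q n}})) ≈ᶜ c →
    P ⟶ᶜ c *ᶜ Opsᶜ.∑ (familiesWithSum (length (Φ q)) n) (λ k →
      Opsᶜ.product (λ j → F (lookup (Φ q) j) (k j)))
dirichletLimit Γ isGamma ψ isPolygamma (suc q′) {{q≢0}} χ isCharacter nonprincipal f F f≈ F≈ n P π c P≈ π≈ c≈ =
  SumsOfProducts.limit-∑ P c (Φ (suc q′)) F (familiesWithSum (length (Φ (suc q′))) n) τ (λ k m → ≡.refl , ≡.refl)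
    (LimitRing.lim-cong ComplexNumbers.limitRing {P} {P} {c₀ *ᶜ S} {c *ᶜ S} (λ N → C.refl {P N})
      (C.*-cong {c₀} {c} {S} {S} c≈ (C.refl {S}))
      (limit f F f≈ F≈
        n P π τ P≈ π≈ (λ k → C.refl {τ k})))
  where
  open DirichletSeries Γ isGamma ψ isPolygamma q′ {{q≢0}} χ isCharacter nonprincipal
  module C = CommutativeRing ComplexNumbers.commutativeRing
  τ : Vector ℕ (length (Φ (suc q′))) → ℂ
  τ k = Opsᶜ.product (λ j → F (lookup (Φ (suc q′)) j) (k j))
  c₀ S : ℂ
  c₀ = fromℝ (fromℚ ((+ 1 / (suc q′ ℕ.^ n)) {{ℕ.m^n≢0 (suc q′) n}}))
  S = Opsᶜ.∑ (familiesWithSum (length (Φ (suc q′))) n) τ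

open import Data.Nat.Base using (_≤_; _^_)
open import Data.Nat.Properties using (m^n≢0)

theorem3 : (Γ : Fun⁺) → IsGamma Γ →
    (ψ : ℕ → Fun⁺) → IsPolygamma Γ ψ →
    (q : ℕ) .{{_ : NonZero q}} (χ : ℤ → ℂ) →
    IsDirichletCharacter q χ → Primitive q χ → ¬ Principal q χ →
    ∀ n → 1 ≤ n →
    partialL χ n ⟶ᶜ
    fromℝ (fromℚ ((+ 1 / (q ^ n)) {{m^n≢0 q n}})) *ᶜ
    Opsᶜ.∑ (familiesWithSum (length (Φ q)) n) (λ k →
    Opsᶜ.product (λ j → factor q ψ χ (lookup (Φ q) j) (k j)))
theorem3 Γ isGamma ψ isPolygamma q {{q≢0}} χ isCharacter _ nonprincipal n _ =
  dirichletLimit Γ isGamma ψ isPolygamma q {{q≢0}} χ isCharacter nonprincipal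
    (λ (k , k≢0) → χ (+ k) *ᶜ fromℝ (fromℚ ((+ 1 / k) {{k≢0}}))) (factor q {{q≢0}} ψ χ)
    (λ (k , k≢0) → refl {χ (+ k) *ᶜ fromℝ (fromℚ ((+ 1 / k) {{k≢0}}))})
    (λ j m → refl {factor q {{q≢0}} ψ χ j m})
    n (partialL χ n)
    (λ ks → Opsᶜ.∏ ks λ (k , k≢0) → χ (+ k) *ᶜ fromℝ (fromℚ ((+ 1 / k) {{k≢0}})))
    (fromℝ (fromℚ ((+ 1 / (q ^ n)) {{m^n≢0 q n {{q≢0}}}})))
    (λ N → refl {partialL χ n N})
    (λ ks → refl {Opsᶜ.∏ ks λ (k , k≢0) → χ (+ k) *ᶜ fromℝ (fromℚ ((+ 1 / k) {{k≢0}}))})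
    (refl {fromℝ (fromℚ ((+ 1 / (q ^ n)) {{m^n≢0 q n {{q≢0}}}}))})
  where
  open CommutativeRing ComplexNumbers.commutativeRing using (refl)
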